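{- Every 3-connected quartic planar graph other than the octahedron has a 4-locally self-avoiding Eulerian circuit.
   Context: All graphs are finite and simple; quartic means 4-regular. A trail is a sequence of vertices $v_0v_1\ldots v_\ell$ with consecutive vertices adjacent and no repeated edge; a circuit is a closed trail; it is Eulerian if it traverses every edge. A subcycle of a circuit $x_1\ldots x_n$ is a subtrail $x_i\ldots x_j$ of consecutive vertices (read cyclically) with $x_i=x_j$ and $x_i,\ldots,x_{j-1}$ distinct; its length is its number of edges. A circuit is 4-locally self-avoiding if it has no subcycle of length at most 4. The octahedron is the unique 4-regular graph on 6 vertices ($K_6$ minus a perfect matching). -}

module Defs where

open import Data.Nat using (ℕ; zero; suc; _+_; _*_; _≤_; _<_; _≡ᵇ_; _<ᵇ_; _≤ᵇ_; _/_; _%_)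
open import Data.Nat.DivMod using (m%n<n)
open import Data.Fin using (Fin; toℕ; fromℕ<) renaming (zero to fz; suc to fs)
open import Data.Bool using (Bool; true; false; not; _∧_; if_then_else_)
open import Data.Product using (Σ; _×_; _,_; ∃; ∃-syntax; proj₁; proj₂)
open import Data.Sum using (_⊎_)
open import Relation.Nullary using (¬_)
open import Relation.Binary.PropositionalEquality using (_≡_; refl; cong)
open import Function.Bundles using (_↔_; Inverse)

record Graph (n : ℕ) : Set where
  field
    adj    : Fin n → Fin n → Bool
    sym    : ∀ u v → adj u v ≡ adj v u
    irrefl : ∀ v → adj v v ≡ false
open Graph public

sumFin : ∀ {n} → (Fin n → ℕ) → ℕ
sumFin {zero}  f = 0
sumFin {suc n} f = f fz + sumFin (λ i → f (fs i))

count : ∀ {n} → (Fin n → Bool) → ℕ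
count p = sumFin (λ i → if p i then 1 else 0)

count₂ : ∀ {n} → (Fin n → Fin n → Bool) → ℕ
count₂ p = sumFin (λ u → count (p u))

allBelow : ℕ → (ℕ → Bool) → Bool
allBelow zero    p = true
allBelow (suc b) p = allBelow b p ∧ p b

iter : ∀ {A : Set} → (A → A) → ℕ → A → A
iter f zero    a = a
iter f (suc t) a = f (iter f t a)

degree : ∀ {n} → Graph n → Fin n → ℕ
degree G v = count (adj G v)

Quartic : ∀ {n} → Graph n → Set
Quartic G = ∀ v → degree G v ≡ 4

numEdges : ∀ {n} → Graph n → ℕ
numEdges G = count₂ (λ u v → adj G u v ∧ (toℕ u <ᵇ toℕ v))

data Reach {n : ℕ} (G : Graph n) (S : Fin n → Bool) : Fin n → Fin n → Set where
  here : ∀ {u} → Reach G S u u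
  step : ∀ {u w v} → adj G u w ≡ true → S w ≡ false → Reach G S w v → Reach G S u v

ConnectedAvoiding : ∀ {n} → Graph n → (Fin n → Bool) → Set
ConnectedAvoiding G S = ∀ u v → S u ≡ false → S v ≡ false → Reach G S u v

KConnected : ℕ → ∀ {n} → Graph n → Set
KConnected k {n} G =
  k < n × (∀ (S : Fin n → Bool) → suc (count S) ≤ k → ConnectedAvoiding G S)

ThreeConnected : ∀ {n} → Graph n → Set
ThreeConnected = KConnected 3

-- A rotation system: for each vertex v, rot v is a cyclic permutation of
-- the neighbourhood of v (values of rot v off the neighbourhood are
-- irrelevant).
record RotationSystem {n : ℕ} (G : Graph n) : Set where
  field
    rot      : Fin n → Fin n → Fin n
    rot-nbr  : ∀ v u → adj G v u ≡ true → adj G v (rot v u) ≡ true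
    rot-cyc  : ∀ v u w → adj G v u ≡ true → adj G v w ≡ true →
               ∃[ t ] iter (rot v) t u ≡ w
open RotationSystem public

module _ {n : ℕ} {G : Graph n} (R : RotationSystem G) where

  Dart : Set
  Dart = Fin n × Fin n

  faceStep : Dart → Dart
  faceStep (u , v) = (v , rot R v u)

  key : Dart → ℕ
  key (u , v) = toℕ u * n + toℕ v

  -- the dart d is the key-minimal dart of its face (orbit of faceStep);
  -- every orbit has fewer than n * n elements, so t < n * n suffices.
  isFaceRep : Dart → Bool
  isFaceRep d = allBelow (n * n) (λ t → key d ≤ᵇ key (iter faceStep t d))

  numFaces : ℕ
  numFaces = count₂ (λ u v → adj G u v ∧ isFaceRep (u , v))

-- A (connected) graph is planar iff it has a rotation system of genus 0,
-- i.e. satisfying Euler's formula V − E + F = 2.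
Planar : ∀ {n} → Graph n → Set
Planar {n} G = Σ (RotationSystem G) λ R → n + numFaces R ≡ 2 + numEdges G

Isomorphic : ∀ {n m} → Graph n → Graph m → Set
Isomorphic {n} {m} G H =
  Σ (Fin n ↔ Fin m) λ f → ∀ u v → adj H (Inverse.to f u) (Inverse.to f v) ≡ adj G u v

private
  ≡ᵇ-sym : ∀ a b → (a ≡ᵇ b) ≡ (b ≡ᵇ a)
  ≡ᵇ-sym zero zero = refl
  ≡ᵇ-sym zero (suc b) = refl
  ≡ᵇ-sym (suc a) zero = refl
  ≡ᵇ-sym (suc a) (suc b) = ≡ᵇ-sym a b

  ≡ᵇ-refl : ∀ a → (a ≡ᵇ a) ≡ true
  ≡ᵇ-refl zero = refl
  ≡ᵇ-refl (suc a) = ≡ᵇ-refl a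

-- K₆ minus the perfect matching {0,1},{2,3},{4,5}
octahedron : Graph 6
octahedron = record
  { adj    = λ i j → not (toℕ i / 2 ≡ᵇ toℕ j / 2)
  ; sym    = λ i j → cong not (≡ᵇ-sym (toℕ i / 2) (toℕ j / 2))
  ; irrefl = λ i → cong not (≡ᵇ-refl (toℕ i / 2))
  }

-- A circuit x₀ x₁ … x_k read cyclically (x_{k+1} = x₀), of length suc k.
record Circuit {n : ℕ} (G : Graph n) : Set where
  field
    len-1 : ℕ
    vtx   : Fin (suc len-1) → Fin n
  len : ℕ
  len = suc len-1
  pos : ℕ → Fin n
  pos j = vtx (fromℕ< (m%n<n j len))
  edgeAt : ℕ → Fin n × Fin n
  edgeAt j = pos j , pos (suc j)
open Circuit public

SameEdge : ∀ {n} → Fin n × Fin n → Fin n × Fin n → Set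
SameEdge (a , b) (c , d) = (a ≡ c × b ≡ d) ⊎ (a ≡ d × b ≡ c)

IsCircuit : ∀ {n} {G : Graph n} → Circuit G → Set
IsCircuit {G = G} C =
  (∀ i → i < len C → adj G (pos C i) (pos C (suc i)) ≡ true) ×
  (∀ i j → i < len C → j < len C → SameEdge (edgeAt C i) (edgeAt C j) → i ≡ j)

IsEulerian : ∀ {n} {G : Graph n} → Circuit G → Set
IsEulerian {G = G} C =
  IsCircuit C ×
  (∀ u v → adj G u v ≡ true → ∃[ i ] (i < len C × SameEdge (edgeAt C i) (u , v)))

IsSubcycle : ∀ {n} {G : Graph n} → Circuit G → ℕ → ℕ → Set
IsSubcycle C i ℓ =
  1 ≤ ℓ × ℓ ≤ len C ×
  pos C i ≡ pos C (i + ℓ) ×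
  (∀ a b → a < ℓ → b < ℓ → pos C (i + a) ≡ pos C (i + b) → a ≡ b)

LocallySelfAvoiding : ℕ → ∀ {n} {G : Graph n} → Circuit G → Set
LocallySelfAvoiding k C =
  ¬ (∃[ i ] ∃[ ℓ ] (i < len C × ℓ ≤ k × IsSubcycle C i ℓ))

{-# OPTIONS --safe #-}
-- A transition system pairs the four edges at every vertex: straight (opposite edges of the rotation) or turned
-- in one of two ways. It decomposes the edges into closed trails, and we look for one with a single trail and
-- without closed subtrails of length 3 or 4. By the Jordan curve theorem (a count of faces by Euler's formula)
-- and 3-connectedness every triangle is a face, and every chordless 4-cycle is a face, or has exactly two tips
-- (vertices whose remaining edges both lie on one side), or is a ring, passed straight at all four vertices.
-- Start with all vertices straight. The only closed subtrails of length at most 4 are then rings, and rings do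
-- not cross, since a ring with two common neighbours would span an octahedron. Turning two opposite vertices of
-- each ring, and their common neighbour off the ring if there is one, destroys it; the parity of the ends of a
-- trail tells how to turn so that all edges at a turned vertex lie on one trail. From then on, as long as two
-- trails meet, they meet at a straight vertex, and that vertex or one close to it can be turned so as to merge
-- them without closing a short subtrail.
module Submission where

open import Defs renaming (sym to adj-sym; step to reach-step; here to reach-here)
open import Data.Nat using (ℕ; zero; suc; _+_; _*_; _∸_; _≤_; _<_; z≤n; s≤s; _<ᵇ_; _≤?_; _<?_)
open import Data.Nat.Properties hiding (_≟_; suc-injective)
open import Data.Nat.DivMod using (_%_; _/_; m%n<n; m≡m%n+[m/n]*n)
open import Data.Fin using (Fin; toℕ; combine; fromℕ<) renaming (zero to fz; suc to fs)
open import Data.Fin.Properties using (_≟_; pigeonhole; combine-injective; toℕ-injective; toℕ<n; suc-injective; toℕ-combine; any?; all?; toℕ-fromℕ<)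
open import Data.Bool using (T; Bool; true; false; not; _∧_; _∨_; if_then_else_; _xor_)
open import Data.Bool.Properties using (xor-same; xor-comm; xor-assoc; xor-identityʳ; ∧-comm; ∧-zeroʳ; ∧-identityʳ; ∨-zeroʳ; T-≡; not-involutive) renaming (_≟_ to _≟B_)
open import Data.Bool.Solver using (module xor-∧-Solver)
open import Data.Product using (Σ; _×_; _,_; ∃-syntax; proj₁; proj₂; swap)
open import Data.Maybe using (Maybe; just; nothing; is-nothing)
open import Data.Maybe.Properties using (just-injective) renaming (≡-dec to ≡M-dec)
open import Data.Sum using (_⊎_; inj₁; inj₂) renaming (swap to ⊎-swap)
open import Data.Empty using (⊥; ⊥-elim)
open import Data.Unit using (⊤; tt)
open import Data.Product.Properties using (≡-dec)
open import Data.List using (List; []; _∷_; length; _++_; map; foldr)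
open import Data.List.Properties using (length-++; map-++)
open import Data.List.Membership.Propositional using (_∈_)
open import Data.List.Membership.Propositional.Properties using (∈-++⁺ˡ; ∈-++⁺ʳ; ∈-++⁻; ∈-map⁺; ∈-map⁻)
open import Data.List.Relation.Unary.Any using (here; there)
open import Data.List.Relation.Unary.All using (All; []; _∷_)
open import Data.List.Relation.Unary.Unique.Propositional using (Unique)
open import Data.List.Relation.Unary.AllPairs using ([]; _∷_)
import Data.List.Membership.DecPropositional as DecMembership
import Data.List.Relation.Unary.All as All
open import Relation.Nullary using (¬_; Dec; yes; no; contradiction)
open import Relation.Nullary.Decidable using (⌊_⌋; _×-dec_; _⊎-dec_; ¬?; map′; from-yes)
open import Relation.Binary.PropositionalEquality using (_≡_; _≢_; refl; sym; trans; cong; cong₂; subst; module ≡-Reasoning)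
open import Function using (_∘_; case_of_)
open import Function.Bundles using (Equivalence; mk↔ₛ′)
open import Relation.Binary.Definitions using (tri<; tri≈; tri>)
open xor-∧-Solver using (solve; con; _:+_; _:=_)

-- Euler's formula is used once. List the edges as a closed curve without one edge, then that edge,
-- then all others. Read forwards an edge may merge two components of the graph, read backwards it
-- may merge two faces, but never both, and Euler's formula leaves no edge idle; so the last edge of
-- a curve has different sides. Even degree gives the parity: an even number of edges runs from a
-- chordless curve into one side. A vertex passed straight contributes one of them, a turned vertex
-- none or two. Hence a triangle is not straight at all three vertices, and a four-cycle is straight
-- at an even number of them. A turn creates two corners, and a new closed subtrail has to use one
-- of them, so safety is a property of single corners (`Blocked`). A straight vertex has two turns.
-- If both are unsafe, two blocked corners share an edge, and the long case analysis is about such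
-- pairs. Turned vertices never become straight again, so the number of straight vertices bounds
-- both phases.

pattern 2nd e = there (here e)
pattern 3rd e = there (2nd e)
pattern 4th e = there (3rd e)

-- Sums modulo two over finite sets

xsum : ∀ {n} → (Fin n → Bool) → Bool
xsum {zero}  f = false
xsum {suc n} f = f fz xor xsum (f ∘ fs)

xsum-cong : ∀ {n} {f g : Fin n → Bool} → (∀ i → f i ≡ g i) → xsum f ≡ xsum g
xsum-cong {zero}  e = refl
xsum-cong {suc n} e = cong₂ _xor_ (e fz) (xsum-cong (e ∘ fs))

xsum-false : ∀ {n} {f : Fin n → Bool} → (∀ i → f i ≡ false) → xsum f ≡ false
xsum-false {zero}  e = refl
xsum-false {suc n} e = trans (cong₂ _xor_ (e fz) (xsum-false (e ∘ fs))) refl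

xor-4 : ∀ a b c d → (a xor b) xor (c xor d) ≡ (a xor c) xor (b xor d)
xor-4 a b c d = begin
  (a xor b) xor (c xor d)   ≡⟨ xor-assoc a b _ ⟩
  a xor (b xor (c xor d))   ≡⟨ cong (a xor_) (xor-assoc b c d) ⟨
  a xor ((b xor c) xor d)   ≡⟨ cong (λ z → a xor (z xor d)) (xor-comm b c) ⟩
  a xor ((c xor b) xor d)   ≡⟨ cong (a xor_) (xor-assoc c b d) ⟩
  a xor (c xor (b xor d))   ≡⟨ xor-assoc a c _ ⟨
  (a xor c) xor (b xor d)   ∎
  where open ≡-Reasoning

xsum-xor : ∀ {n} (f g : Fin n → Bool) → xsum (λ i → f i xor g i) ≡ xsum f xor xsum g
xsum-xor {zero}  f g = refl
xsum-xor {suc n} f g =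
  trans (cong ((f fz xor g fz) xor_) (xsum-xor (f ∘ fs) (g ∘ fs)))
        (xor-4 (f fz) (g fz) (xsum (f ∘ fs)) (xsum (g ∘ fs)))

-- The handshake argument: every unordered pair is counted twice. The parity arguments about curves,
-- dual components and ends of trails all go back to it.
xsum-symmetric : ∀ {n} (f : Fin n → Fin n → Bool) → (∀ u v → f u v ≡ f v u) → (∀ v → f v v ≡ false) →
  xsum (λ u → xsum (f u)) ≡ false
xsum-symmetric {zero}  f s i = refl
xsum-symmetric {suc n} f s i = begin
  (f fz fz xor A) xor xsum (λ u → f (fs u) fz xor xsum (f (fs u) ∘ fs))
    ≡⟨ cong₂ _xor_ (cong (_xor A) (i fz)) (xsum-xor (λ u → f (fs u) fz) (λ u → xsum (f (fs u) ∘ fs))) ⟩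
  A xor (xsum (λ u → f (fs u) fz) xor xsum (λ u → xsum (f (fs u) ∘ fs)))
    ≡⟨ cong (A xor_) (cong₂ _xor_ (xsum-cong (λ u → s (fs u) fz)) (xsum-symmetric (λ u v → f (fs u) (fs v)) (λ u v → s (fs u) (fs v)) (i ∘ fs))) ⟩
  A xor (A xor false)
    ≡⟨ cong (A xor_) (xor-identityʳ A) ⟩
  A xor A
    ≡⟨ xor-same A ⟩
  false ∎
  where
  open ≡-Reasoning
  A = xsum (f fz ∘ fs)

infixl 6 _∖_

abstract
  _∖_ : ∀ {n} → (Fin n → Bool) → Fin n → Fin n → Bool
  (p ∖ a) i = if ⌊ i ≟ a ⌋ then false else p i

  ∖-same : ∀ {n} (p : Fin n → Bool) a → (p ∖ a) a ≡ false
  ∖-same p a with a ≟ a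
  ... | yes _ = refl
  ... | no a≢a = contradiction refl a≢a

  ∖-other : ∀ {n} (p : Fin n → Bool) {a i} → i ≢ a → (p ∖ a) i ≡ p i
  ∖-other p {a} {i} i≢a with i ≟ a
  ... | yes e = contradiction e i≢a
  ... | no _ = refl

  ∖-true : ∀ {n} (p : Fin n → Bool) {a i} → (p ∖ a) i ≡ true → p i ≡ true × i ≢ a
  ∖-true p {a} {i} e with i ≟ a
  ... | no i≢a = e , i≢a

fs≢fz : ∀ {n} {i : Fin n} → fs i ≢ fz
fs≢fz ()

∖-suc : ∀ {n} (p : Fin (suc n) → Bool) a i → (p ∖ fs a) (fs i) ≡ ((p ∘ fs) ∖ a) i
∖-suc p a i = case i ≟ a of λ where
  (yes refl) → trans (∖-same p (fs a)) (sym (∖-same (p ∘ fs) a))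
  (no i≢a)   → trans (∖-other p (i≢a ∘ suc-injective)) (sym (∖-other (p ∘ fs) i≢a))

xsum-∖ : ∀ {n} (p : Fin n → Bool) a → xsum p ≡ p a xor xsum (p ∖ a)
xsum-∖ {suc n} p fz = cong (p fz xor_) (cong₂ _xor_ (sym (∖-same p fz)) (xsum-cong {f = p ∘ fs} {g = (p ∖ fz) ∘ fs} (λ i → sym (∖-other p {i = fs i} fs≢fz))))
xsum-∖ {suc n} p (fs a) = begin
  p fz xor xsum (p ∘ fs)                              ≡⟨ cong (p fz xor_) (xsum-∖ (p ∘ fs) a) ⟩
  p fz xor (p (fs a) xor xsum ((p ∘ fs) ∖ a))         ≡⟨ xor-assoc (p fz) _ _ ⟨
  (p fz xor p (fs a)) xor xsum ((p ∘ fs) ∖ a)         ≡⟨ cong (_xor xsum ((p ∘ fs) ∖ a)) (xor-comm (p fz) _) ⟩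
  (p (fs a) xor p fz) xor xsum ((p ∘ fs) ∖ a)         ≡⟨ xor-assoc (p (fs a)) _ _ ⟩
  p (fs a) xor (p fz xor xsum ((p ∘ fs) ∖ a))         ≡⟨ cong₂ (λ y z → p (fs a) xor (y xor z)) (sym (∖-other p (fs≢fz ∘ sym))) (xsum-cong {f = (p ∘ fs) ∖ a} {g = (p ∖ fs a) ∘ fs} (λ i → sym (∖-suc p a i))) ⟩
  p (fs a) xor ((p ∖ fs a) fz xor xsum ((p ∖ fs a) ∘ fs))      ∎
  where open ≡-Reasoning

-- Counting in finite sets

bit : Bool → ℕ
bit b = if b then 1 else 0

sumFin-cong : ∀ {n} {f g : Fin n → ℕ} → (∀ i → f i ≡ g i) → sumFin f ≡ sumFin g
sumFin-cong {zero}  e = refl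
sumFin-cong {suc n} e = cong₂ _+_ (e fz) (sumFin-cong (e ∘ fs))

count-cong : ∀ {n} {p q : Fin n → Bool} → (∀ i → p i ≡ q i) → count p ≡ count q
count-cong e = sumFin-cong (cong bit ∘ e)

count-∖ : ∀ {n} (p : Fin n → Bool) a → count p ≡ bit (p a) + count (p ∖ a)
count-∖ {suc n} p fz = cong (bit (p fz) +_) (cong₂ _+_ (cong bit (sym (∖-same p fz))) (count-cong {p = p ∘ fs} {q = (p ∖ fz) ∘ fs} (λ i → sym (∖-other p {i = fs i} fs≢fz))))
count-∖ {suc n} p (fs a) = begin
  bit (p fz) + count (p ∘ fs)                                  ≡⟨ cong (bit (p fz) +_) (count-∖ (p ∘ fs) a) ⟩
  bit (p fz) + (bit (p (fs a)) + count ((p ∘ fs) ∖ a))         ≡⟨ +-assoc (bit (p fz)) _ _ ⟨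
  (bit (p fz) + bit (p (fs a))) + count ((p ∘ fs) ∖ a)         ≡⟨ cong (_+ count ((p ∘ fs) ∖ a)) (+-comm (bit (p fz)) _) ⟩
  (bit (p (fs a)) + bit (p fz)) + count ((p ∘ fs) ∖ a)         ≡⟨ +-assoc (bit (p (fs a))) _ _ ⟩
  bit (p (fs a)) + (bit (p fz) + count ((p ∘ fs) ∖ a))         ≡⟨ cong₂ (λ y z → bit (p (fs a)) + (bit y + z)) (sym (∖-other p (fs≢fz ∘ sym))) (count-cong {p = (p ∘ fs) ∖ a} {q = (p ∖ fs a) ∘ fs} (λ i → sym (∖-suc p a i))) ⟩
  bit (p (fs a)) + (bit ((p ∖ fs a) fz) + count ((p ∖ fs a) ∘ fs))      ∎
  where open ≡-Reasoning

count-zero : ∀ {n} {p : Fin n → Bool} → (∀ i → p i ≡ false) → count p ≡ 0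
count-zero {zero}  e = refl
count-zero {suc n} e = cong₂ _+_ (cong bit (e fz)) (count-zero (e ∘ fs))

bool-false : ∀ {b} → b ≢ true → b ≡ false
bool-false {false} h = refl
bool-false {true}  h = contradiction refl h

true≢false : true ≢ false
true≢false ()

sumFin-mono : ∀ {n} {f g : Fin n → ℕ} → (∀ i → f i ≤ g i) → sumFin f ≤ sumFin g
sumFin-mono {zero}  e = z≤n
sumFin-mono {suc n} e = +-mono-≤ (e fz) (sumFin-mono (e ∘ fs))

bit-mono : ∀ {a b} → (a ≡ true → b ≡ true) → bit a ≤ bit b
bit-mono {false} h = z≤n
bit-mono {true}  h rewrite h refl = ≤-refl

count-mono : ∀ {n} {p q : Fin n → Bool} → (∀ i → p i ≡ true → q i ≡ true) → count p ≤ count q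
count-mono h = sumFin-mono (λ i → bit-mono (h i))

-- Periodicity of injective maps on finite sets

iter-+ : ∀ {A : Set} (f : A → A) s t a → iter f (s + t) a ≡ iter f s (iter f t a)
iter-+ f zero    t a = refl
iter-+ f (suc s) t a = cong f (iter-+ f s t a)

iter-suc : ∀ {A : Set} (f : A → A) t a → iter f (suc t) a ≡ iter f t (f a)
iter-suc f zero    a = refl
iter-suc f (suc t) a = cong f (iter-suc f t a)

-- The maps in question are injective only on darts that are edges, since `rot` is arbitrary off the
-- neighbourhood; `Good` is this restriction.
module Orbit {n : ℕ} (f : Fin n × Fin n → Fin n × Fin n) (Good : Fin n × Fin n → Set)
  (good : ∀ {d} → Good d → Good (f d))
  (inj : ∀ {d e} → Good d → Good e → f d ≡ f e → d ≡ e) where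

  iter-good : ∀ t {d} → Good d → Good (iter f t d)
  iter-good zero    g = g
  iter-good (suc t) g = good (iter-good t g)

  iter-cancel : ∀ s {d e} → Good d → Good e → iter f s d ≡ iter f s e → d ≡ e
  iter-cancel zero    gd ge eq = eq
  iter-cancel (suc s) gd ge eq = iter-cancel s gd ge (inj (iter-good s gd) (iter-good s ge) eq)

  -- Pigeonhole among n * n + 1 iterates, then cancellation of the common steps. The bound matches
  -- the window of `isFaceRep`.
  period : ∀ {d} → Good d → ∃[ p ] (1 ≤ p × p ≤ n * n × iter f p d ≡ d)
  period {d} gd with pigeonhole (n<1+n (n * n)) (λ (i : Fin (suc (n * n))) → let e = iter f (toℕ i) d in combine (proj₁ e) (proj₂ e))
  ... | i , j , i<j , eq = p , m<n⇒0<n∸m i<j , ≤-trans (m∸n≤m (toℕ j) (toℕ i)) (≤-pred (toℕ<n j)) ,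
        sym (iter-cancel (toℕ i) gd (iter-good p gd) (trans eq′ (trans (cong (λ k → iter f k d) (sym (m+[n∸m]≡n (<⇒≤ i<j)))) (iter-+ f (toℕ i) p d))))
    where
    p = toℕ j ∸ toℕ i
    eq′ : iter f (toℕ i) d ≡ iter f (toℕ j) d
    eq′ with combine-injective _ _ _ _ eq
    ... | e₁ , e₂ = cong₂ _,_ e₁ e₂

count-cover : ∀ {n} (l : List (Fin n)) {p : Fin n → Bool} → (∀ i → p i ≡ true → i ∈ l) → count p ≤ length l
count-cover [] h = ≤-reflexive (count-zero (λ i → bool-false (λ e → case h i e of λ ())))
count-cover (x ∷ l) {p} h = subst (_≤ suc (length l)) (sym (count-∖ p x)) (+-mono-≤ (bit≤1 (p x)) (count-cover l λ i e → rest i (∖-true p e)))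
  where
  bit≤1 : ∀ b → bit b ≤ 1
  bit≤1 false = z≤n
  bit≤1 true  = s≤s z≤n
  rest : ∀ i → p i ≡ true × i ≢ x → i ∈ l
  rest i (e , i≢x) with h i e
  ... | here i≡x = contradiction i≡x i≢x
  ... | there m = m

-- Each member is removed before the next one is tested, which rules out repetitions; so the length
-- of the list bounds `count` from below.
Subset : ∀ {n} → List (Fin n) → (Fin n → Bool) → Set
Subset []      p = ⊤
Subset (x ∷ l) p = p x ≡ true × Subset l (p ∖ x)

count-subset : ∀ {n} (l : List (Fin n)) {p : Fin n → Bool} → Subset l p → length l ≤ count p
count-subset []      h = z≤n
count-subset (x ∷ l) {p} (e , h) = subst (suc (length l) ≤_) (sym (trans (count-∖ p x) (cong (λ b → bit b + count (p ∖ x)) e))) (s≤s (count-subset l h))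

∖-keep : ∀ {n} {p : Fin n → Bool} {a i} → i ≢ a → p i ≡ true → (p ∖ a) i ≡ true
∖-keep {p = p} i≢a e = trans (∖-other p i≢a) e

sumFin-step : ∀ {n} {f g : Fin n → ℕ} z → (∀ i → i ≢ z → f i ≤ g i) → f z ≤ suc (g z) → sumFin f ≤ suc (sumFin g)
sumFin-step {suc n} fz h e = +-mono-≤ e (sumFin-mono (λ i → h (fs i) fs≢fz))
sumFin-step {suc n} {f} {g} (fs z) h e =
  subst (sumFin f ≤_) (+-suc (g fz) _) (+-mono-≤ (h fz (fs≢fz ∘ sym)) (sumFin-step z (λ i i≢z → h (fs i) (i≢z ∘ suc-injective)) e))

count-step : ∀ {n} {p q : Fin n → Bool} z → (∀ i → p i ≡ true → i ≢ z → q i ≡ true) → count p ≤ suc (count q)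
count-step {p = p} {q} z h = sumFin-step z (λ i i≢z → bit-mono (λ e → h i e i≢z)) (≤-trans (bit≤1 (p z)) (s≤s z≤n))
  where
  bit≤1 : ∀ b → bit b ≤ 1
  bit≤1 false = z≤n
  bit≤1 true  = s≤s z≤n

-- The laws of counting that bound a number of classes. Stated abstractly, they let one argument
-- serve vertices (`counter₁`) and darts (`counter₂`).
Counter : Set → Set
Counter A = Σ ((A → Bool) → ℕ) λ C →
  C (λ _ → false) ≡ 0 ×
  (∀ (p q : A → Bool) → (∀ i → p i ≡ true → q i ≡ true) → C p ≤ C q) ×
  (∀ (p q : A → Bool) z → (∀ i → p i ≡ true → i ≢ z → q i ≡ true) → C p ≤ suc (C q))

counter₁ : ∀ {n} → Counter (Fin n)
counter₁ {n} = count , count-zero {n} {λ _ → false} (λ _ → refl) , (λ p q → count-mono {p = p} {q}) , (λ p q → count-step {p = p} {q})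

counter₂ : ∀ {n} → Counter (Fin n × Fin n)
counter₂ {n} = (λ p → count₂ (λ u v → p (u , v)))
  , trans (sumFin-cong {n} {λ _ → count {n} (λ _ → false)} {λ _ → 0} (λ _ → count-zero {n} {λ _ → false} (λ _ → refl))) (sum0 n)
  , (λ p q h → sumFin-mono (λ u → count-mono {p = λ v → p (u , v)} {q = λ v → q (u , v)} (λ v → h (u , v))))
  , (λ { p q (a , b) h → sumFin-step a
           (λ u u≢a → count-mono {p = λ v → p (u , v)} {q = λ v → q (u , v)} (λ v e → h (u , v) e (u≢a ∘ cong proj₁)))
           (count-step {p = λ v → p (a , v)} {q = λ v → q (a , v)} b (λ v e v≢b → h (a , v) e (v≢b ∘ cong proj₂))) })
  where
  sum0 : ∀ n → sumFin {n} (λ _ → 0) ≡ 0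
  sum0 zero = refl
  sum0 (suc n) = sum0 n

-- Partitions represented by a map to class representatives

module Union {A : Set} (_≟A_ : (a b : A) → Dec (a ≡ b)) where

  -- The classes are the fibres of ρ. Since the whole fibre of b is redirected, equality of values
  -- remains the class relation, with no chains to follow.
  join : (A → A) → A → A → A → A
  join ρ a b i with ρ i ≟A ρ b
  ... | yes _ = ρ a
  ... | no  _ = ρ i

  join-glue : ∀ ρ a b → join ρ a b a ≡ join ρ a b b
  join-glue ρ a b with ρ a ≟A ρ b | ρ b ≟A ρ b
  ... | _      | no h = contradiction refl h
  ... | yes _  | yes _ = refl
  ... | no _   | yes _ = refl

  join-mono : ∀ ρ a b {i j} → ρ i ≡ ρ j → join ρ a b i ≡ join ρ a b j
  join-mono ρ a b {i} {j} e with ρ i ≟A ρ b | ρ j ≟A ρ b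
  ... | yes _ | yes _ = refl
  ... | yes h | no k  = contradiction (trans (sym e) h) k
  ... | no h  | yes k = contradiction (trans e k) h
  ... | no _  | no _  = e

  Respects : {B : Set} → (A → B) → (A → A) → Set
  Respects f ρ = ∀ i → f (ρ i) ≡ f i

  join-respects : ∀ {B : Set} {f : A → B} {ρ} a b → f a ≡ f b → Respects f ρ → Respects f (join ρ a b)
  join-respects {f = f} {ρ} a b e h i with ρ i ≟A ρ b
  ... | yes k = trans (h a) (trans e (trans (sym (h b)) (trans (cong f (sym k)) (h i))))
  ... | no _ = h i

  joins : (A → A) → List (A × A) → A → A
  joins ρ [] = ρ
  joins ρ ((a , b) ∷ L) = join (joins ρ L) a b

  joins-mono : ∀ ρ L {i j} → ρ i ≡ ρ j → joins ρ L i ≡ joins ρ L j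
  joins-mono ρ [] e = e
  joins-mono ρ ((a , b) ∷ L) e = join-mono (joins ρ L) a b (joins-mono ρ L e)

  joins-suffix : ∀ ρ K L {i j} → joins ρ L i ≡ joins ρ L j → joins ρ (K ++ L) i ≡ joins ρ (K ++ L) j
  joins-suffix ρ [] L e = e
  joins-suffix ρ ((a , b) ∷ K) L e = join-mono (joins ρ (K ++ L)) a b (joins-suffix ρ K L e)

  joins-glue : ∀ ρ L {a b} → (a , b) ∈ L → joins ρ L a ≡ joins ρ L b
  joins-glue ρ ((a , b) ∷ L) (here refl) = join-glue (joins ρ L) a b
  joins-glue ρ ((c , d) ∷ L) (there m) = join-mono (joins ρ L) c d (joins-glue ρ L m)

  joins-respects : ∀ {B : Set} {f : A → B} {ρ} L → (∀ {a b} → (a , b) ∈ L → f a ≡ f b) → Respects f ρ → Respects f (joins ρ L)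
  joins-respects [] h k = k
  joins-respects ((a , b) ∷ L) h k = join-respects a b (h (here refl)) (joins-respects L (h ∘ there) k)

  -- Classes are counted by fixed points: a join destroys at most one, the old representative `ρ b`.
  fixed : (A → Bool) → (A → A) → A → Bool
  fixed D ρ i = D i ∧ ⌊ ρ i ≟A i ⌋

  fixed-intro : ∀ {D ρ i} → D i ≡ true → ρ i ≡ i → fixed D ρ i ≡ true
  fixed-intro {D} {ρ} {i} d e with ρ i ≟A i
  ... | yes _ = trans (∧-identityʳ _) d
  ... | no h  = contradiction e h

  fixed-elim : ∀ {D ρ i} → fixed D ρ i ≡ true → D i ≡ true × ρ i ≡ i
  fixed-elim {D} {ρ} {i} t with D i | ρ i ≟A i
  ... | true | yes e = refl , e

  join-same : ∀ ρ {a b} → ρ a ≡ ρ b → ∀ i → join ρ a b i ≡ ρ i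
  join-same ρ {a} {b} e i with ρ i ≟A ρ b
  ... | yes k = trans e (sym k)
  ... | no _ = refl

  split : (A → A) → A × A → Bool
  split ρ (a , b) = not ⌊ ρ a ≟A ρ b ⌋

  split-true : ∀ {ρ a b} → split ρ (a , b) ≡ true → ρ a ≢ ρ b
  split-true {ρ} {a} {b} t with ρ a ≟A ρ b
  ... | no h = h

  split-false : ∀ {ρ a b} → ρ a ≡ ρ b → split ρ (a , b) ≡ false
  split-false {ρ} {a} {b} e with ρ a ≟A ρ b
  ... | yes _ = refl
  ... | no h = contradiction e h

  module Count (c : Counter A) (D : A → Bool) where
    private C = proj₁ c

    join-count : ∀ ρ e → C (fixed D ρ) ≤ bit (split ρ e) + C (fixed D (join ρ (proj₁ e) (proj₂ e)))
    join-count ρ (a , b) with ρ a ≟A ρ b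
    ... | yes e = proj₁ (proj₂ (proj₂ c)) _ _ λ i t → let d , k = fixed-elim {D} {ρ} {i} t in fixed-intro {D} {join ρ a b} d (trans (join-same ρ e i) k)
    ... | no _ = proj₂ (proj₂ (proj₂ c)) _ _ (ρ b) λ i t i≢ → let d , k = fixed-elim {D} {ρ} {i} t in fixed-intro {D} {join ρ a b} d (keep i k i≢)
      where
      keep : ∀ i → ρ i ≡ i → i ≢ ρ b → join ρ a b i ≡ i
      keep i k i≢ with ρ i ≟A ρ b
      ... | yes h = contradiction (trans (sym k) h) i≢
      ... | no _ = k

    -- Number of joins that merge two classes, the list being processed from its end.
    merges : (A → A) → List (A × A) → ℕ
    merges ρ [] = 0
    merges ρ (e ∷ L) = bit (split (joins ρ L) e) + merges ρ L

    merges-count : ∀ ρ L → C (fixed D ρ) ≤ merges ρ L + C (fixed D (joins ρ L))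
    merges-count ρ [] = ≤-refl
    merges-count ρ (e ∷ L) = begin
      C (fixed D ρ)                                                  ≤⟨ merges-count ρ L ⟩
      merges ρ L + C (fixed D (joins ρ L))                           ≤⟨ +-monoʳ-≤ (merges ρ L) (join-count (joins ρ L) e) ⟩
      merges ρ L + (b + C (fixed D (joins ρ (e ∷ L))))               ≡⟨ +-assoc (merges ρ L) b _ ⟨
      (merges ρ L + b) + C (fixed D (joins ρ (e ∷ L)))               ≡⟨ cong (_+ C (fixed D (joins ρ (e ∷ L)))) (+-comm (merges ρ L) b) ⟩
      (b + merges ρ L) + C (fixed D (joins ρ (e ∷ L)))               ∎
      where
      open ≤-Reasoning
      b = bit (split (joins ρ L) e)

    one-class : ∀ ρ {z} → D z ≡ true → (∀ {i} → D i ≡ true → ρ i ≡ ρ z) → C (fixed D ρ) ≤ 1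
    one-class ρ {z} d h = subst (C (fixed D ρ) ≤_) (cong suc (proj₁ (proj₂ c)))
      (proj₂ (proj₂ (proj₂ c)) _ (λ _ → false) (ρ z) λ i t i≢ → let d′ , k = fixed-elim {D} {ρ} {i} t in contradiction (trans (sym k) (h d′)) i≢)

    -- The count behind spanning trees: ending in one class takes an effective join for every class
    -- but one. For vertices this bounds n, for darts the number of faces.
    merges-connected : ∀ ρ L {z} → D z ≡ true → (∀ {i} → D i ≡ true → joins ρ L i ≡ joins ρ L z) → C (fixed D ρ) ≤ suc (merges ρ L)
    merges-connected ρ L d h = ≤-trans (merges-count ρ L) (≤-trans (+-monoʳ-≤ (merges ρ L) (one-class (joins ρ L) d h)) (≤-reflexive (+-comm (merges ρ L) 1)))

-- Lists of edges

collect : ∀ {n} {A : Set} → (Fin n → List A) → List A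
collect {zero}  f = []
collect {suc n} f = f fz ++ collect (f ∘ fs)

collect-length : ∀ {n} {A : Set} (f : Fin n → List A) → length (collect f) ≡ sumFin (length ∘ f)
collect-length {zero}  f = refl
collect-length {suc n} f = trans (length-++ (f fz)) (cong (length (f fz) +_) (collect-length (f ∘ fs)))

∈-collect : ∀ {n} {A : Set} (f : Fin n → List A) {a} i → a ∈ f i → a ∈ collect f
∈-collect f fz m = ∈-++⁺ˡ m
∈-collect f (fs i) m = ∈-++⁺ʳ (f fz) (∈-collect (f ∘ fs) i m)

∈-collect⁻ : ∀ {n} {A : Set} (f : Fin n → List A) {a} → a ∈ collect f → ∃[ i ] a ∈ f i
∈-collect⁻ {suc n} f m with ∈-++⁻ (f fz) m
... | inj₁ k = fz , k
... | inj₂ k = let i , j = ∈-collect⁻ (f ∘ fs) k in fs i , j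

when : {A : Set} → Bool → A → List A
when b a = if b then a ∷ [] else []

pairs : ∀ {n} → (Fin n → Fin n → Bool) → List (Fin n × Fin n)
pairs p = collect λ u → collect λ v → when (p u v) (u , v)

pairs-length : ∀ {n} (p : Fin n → Fin n → Bool) → length (pairs p) ≡ count₂ p
pairs-length p = trans (collect-length (λ u → collect λ v → when (p u v) (u , v)))
  (sumFin-cong λ u → trans (collect-length (λ v → when (p u v) (u , v))) (sumFin-cong (λ v → when-length (p u v))))
  where
  when-length : ∀ {A : Set} {a : A} b → length (when b a) ≡ bit b
  when-length false = refl
  when-length true  = refl

∈-pairs : ∀ {n} {p : Fin n → Fin n → Bool} {u v} → p u v ≡ true → (u , v) ∈ pairs p
∈-pairs {p = p} {u} {v} e = ∈-collect (λ u → collect λ v → when (p u v) (u , v)) u (∈-collect (λ v → when (p u v) (u , v)) v (subst (λ b → (u , v) ∈ when b (u , v)) (sym e) (here refl)))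

∈-pairs⁻ : ∀ {n} {p : Fin n → Fin n → Bool} {u v} → (u , v) ∈ pairs p → p u v ≡ true
∈-pairs⁻ {p = p} m with ∈-collect⁻ (λ u → collect λ v → when (p u v) (u , v)) m
... | u , m₁ with ∈-collect⁻ (λ v → when (p u v) (u , v)) m₁
...   | v , m₂ with p u v in eq
...     | true with m₂
...       | here refl = eq

count₂-split : ∀ {n} (p q : Fin n → Fin n → Bool) →
  count₂ p ≡ count₂ (λ u v → p u v ∧ q u v) + count₂ (λ u v → p u v ∧ not (q u v))
count₂-split {n} p q = trans (sumFin-cong λ u → trans (sumFin-cong λ v → bits (p u v) (q u v)) (sum-+ (λ v → bit (p u v ∧ q u v)) (λ v → bit (p u v ∧ not (q u v)))))
  (sum-+ (λ u → count (λ v → p u v ∧ q u v)) (λ u → count (λ v → p u v ∧ not (q u v))))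
  where
  bits : ∀ a b → bit a ≡ bit (a ∧ b) + bit (a ∧ not b)
  bits false b = refl
  bits true false = refl
  bits true true = refl
  sum-+ : ∀ {n} (f g : Fin n → ℕ) → sumFin (λ i → f i + g i) ≡ sumFin f + sumFin g
  sum-+ {zero} f g = refl
  sum-+ {suc n} f g = trans (cong (f fz + g fz +_) (sum-+ (f ∘ fs) (g ∘ fs))) (mix (f fz) (g fz) _ _)
    where
    mix : ∀ a b c d → (a + b) + (c + d) ≡ (a + c) + (b + d)
    mix a b c d = trans (+-assoc a b _) (trans (cong (a +_) (trans (sym (+-assoc b c d)) (trans (cong (_+ d) (+-comm b c)) (+-assoc c b d)))) (sym (+-assoc a c _)))

-- Keys of darts and decidable propositions

allBelow-elim : ∀ b {p : ℕ → Bool} → allBelow b p ≡ true → ∀ t → t < b → p t ≡ true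
allBelow-elim (suc b) {p} h t t<b with allBelow b p in eq
... | true with m≤n⇒m<n∨m≡n t<b
...   | inj₁ (s≤s l) = allBelow-elim b eq t l
...   | inj₂ refl = h

key-injective : ∀ {n} {G : Graph n} (R : RotationSystem G) {d e} → key R d ≡ key R e → d ≡ e
key-injective {n} R {u , v} {u′ , v′} eq =
  let e₁ , e₂ = combine-injective u v u′ v′ (toℕ-injective (trans (toℕ-combine u v) (trans (mul u v) (trans eq (trans (sym (mul u′ v′)) (sym (toℕ-combine u′ v′)))))))
  in cong₂ _,_ e₁ e₂
  where
  mul : ∀ (u v : Fin n) → n * toℕ u + toℕ v ≡ toℕ u * n + toℕ v
  mul u v = cong (_+ toℕ v) (*-comm n (toℕ u))

toWit : {A : Set} (A? : Dec A) → ⌊ A? ⌋ ≡ true → A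
toWit (yes a) e = a

fromWit : {A : Set} (A? : Dec A) → A → ⌊ A? ⌋ ≡ true
fromWit (yes _) a = refl
fromWit (no ¬a) a = contradiction a ¬a

fromWit¬ : {A : Set} (A? : Dec A) → ¬ A → ⌊ A? ⌋ ≡ false
fromWit¬ (yes a) ¬a = contradiction a ¬a
fromWit¬ (no _)  ¬a = refl

∧-elim : ∀ {a b} → a ∧ b ≡ true → a ≡ true × b ≡ true
∧-elim {true} {true} e = refl , refl

∧-intro : ∀ {a b} → a ≡ true → b ≡ true → a ∧ b ≡ true
∧-intro refl refl = refl

⌊⌋-cong : {A B : Set} (A? : Dec A) (B? : Dec B) → (A → B) → (B → A) → ⌊ A? ⌋ ≡ ⌊ B? ⌋
⌊⌋-cong (yes a) B? f g = sym (fromWit B? (f a))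
⌊⌋-cong (no ¬a) B? f g = sym (fromWit¬ B? (¬a ∘ g))

bool-eq : ∀ {a b : Bool} → (a ≡ true → b ≡ true) → (b ≡ true → a ≡ true) → a ≡ b
bool-eq {false} {false} f g = refl
bool-eq {false} {true}  f g = contradiction (sym (g refl)) true≢false
bool-eq {true}          f g = sym (f refl)

-- The combinatorial Jordan curve theorem

bool-not : ∀ {a b : Bool} → a ≢ b → a ≡ not b
bool-not {false} {false} h = contradiction refl h
bool-not {false} {true}  h = refl
bool-not {true}  {false} h = refl
bool-not {true}  {true}  h = contradiction refl h

not-≢ : ∀ {b} → not b ≢ b
not-≢ {false} ()
not-≢ {true}  ()

xor-true : ∀ {a b} → a xor b ≡ true → b ≡ not a
xor-true {false} {true} e = refl
xor-true {true} {false} e = refl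

xor-false : ∀ {a b} → a xor b ≡ false → a ≡ b
xor-false {false} {false} e = refl
xor-false {true} {true} e = refl

-- An array plus its transpose is symmetric with zero diagonal, so the two sums agree modulo two.
xsum-swap : ∀ {n} (f : Fin n → Fin n → Bool) → xsum (λ u → xsum (f u)) ≡ xsum (λ u → xsum (λ v → f v u))
xsum-swap f = xor-false (trans (sym (xsum-xor (λ u → xsum (f u)) (λ u → xsum (λ v → f v u))))
  (trans (xsum-cong (λ u → sym (xsum-xor (f u) (λ v → f v u))))
         (xsum-symmetric (λ u v → f u v xor f v u) (λ u v → xor-comm (f u v) (f v u)) (λ v → xor-same (f v v)))))

choose : ∀ {n} {P Q : Fin n → Set} → (∀ i → P i ⊎ Q i) → (∀ i → P i) ⊎ (∃[ i ] Q i)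
choose {zero} h = inj₁ λ ()
choose {suc n} {P} h with h fz | choose (h ∘ fs)
... | inj₂ q | _ = inj₂ (fz , q)
... | inj₁ p | inj₂ (i , q) = inj₂ (fs i , q)
... | inj₁ p | inj₁ ps = inj₁ λ { fz → p ; (fs i) → ps i }

least-true : ∀ {P : ℕ → Set} → (∀ k → Dec (P k)) → ∀ m → P m → ∃[ k ] (k ≤ m × P k × (∀ j → j < k → ¬ P j))
least-true P? zero p = 0 , z≤n , p , λ _ ()
least-true {P} P? (suc m) p with P? 0
... | yes p₀ = 0 , z≤n , p₀ , λ _ ()
... | no ¬p₀ with least-true (P? ∘ suc) m p
...   | k , k≤m , q , min = suc k , s≤s k≤m , q , λ { zero _ → ¬p₀ ; (suc j) (s≤s l) → min j l }

count-< : ∀ {n} {p q : Fin n → Bool} → (∀ i → p i ≡ true → q i ≡ true) → ∀ a → p a ≡ false → q a ≡ true → count p < count q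
count-< {p = p} {q} h a pa qa = subst (suc (count p) ≤_) (sym (trans (count-∖ q a) (cong (λ b → bit b + count (q ∖ a)) qa)))
  (s≤s (count-mono {p = p} {q = q ∖ a} λ i e → ∖-keep {p = q} (λ { refl → true≢false (trans (sym e) pa) }) (h i e)))

-- Finite checks for the octahedron and parity identities for rings

antipode : Fin 6 → Fin 6
antipode fz = fs fz
antipode (fs fz) = fz
antipode (fs (fs fz)) = fs (fs (fs fz))
antipode (fs (fs (fs fz))) = fs (fs fz)
antipode (fs (fs (fs (fs fz)))) = fs (fs (fs (fs (fs fz))))
antipode (fs (fs (fs (fs (fs fz))))) = fs (fs (fs (fs fz)))

antipodal : ∀ i j → i ≡ j ⊎ adj octahedron i j ≡ true ⊎ j ≡ antipode i
antipodal = from-yes (all? λ i → all? λ j → (i ≟ j) ⊎-dec ((adj octahedron i j ≟B true) ⊎-dec (j ≟ antipode i)))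

one-true : ∀ {p s t} → true xor (p xor (s xor t)) ≡ false → p ≡ true ⊎ s ≡ true ⊎ t ≡ true
one-true {true} _ = inj₁ refl
one-true {false} {true} _ = inj₂ (inj₁ refl)
one-true {false} {false} {true} _ = inj₂ (inj₂ refl)

abstract
  -- Ends of trails at two opposite ring vertices: x and y belong to the arcs through the other two
  -- ring vertices and occur at both, so only the ends off the ring survive.
  parity-flat : ∀ x y f p q → (x xor (true xor (y xor f))) xor ((x xor (q xor (y xor p))) xor false) ≡ true xor (f xor (p xor q))
  parity-flat = solve 5 (λ x y f p q → (x :+ (con true :+ (y :+ f))) :+ ((x :+ (q :+ (y :+ p))) :+ con false) := con true :+ (f :+ (p :+ q))) refl

  -- With a hub its edges u and w to the two turned vertices cancel too. What remains are the outer
  -- ends at these vertices and the ends at the hub towards the other two ring vertices.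
  parity-hub : ∀ x y u w p s t → (x xor (u xor (y xor true))) xor ((y xor (w xor (x xor p))) xor ((u xor (s xor (w xor t))) xor false)) ≡ true xor (p xor (s xor t))
  parity-hub x y u w p s t = trans (sym (xor-assoc (x xor (u xor (y xor true))) (y xor (w xor (x xor p))) _)) (trans (cong (_xor ((u xor (s xor (w xor t))) xor false)) (left x y u w p)) (right u w p s t))
    where
    left : ∀ x y u w p → (x xor (u xor (y xor true))) xor (y xor (w xor (x xor p))) ≡ (u xor w) xor (true xor p)
    left = solve 5 (λ x y u w p → (x :+ (u :+ (y :+ con true))) :+ (y :+ (w :+ (x :+ p))) := (u :+ w) :+ (con true :+ p)) refl
    right : ∀ u w p s t → ((u xor w) xor (true xor p)) xor ((u xor (s xor (w xor t))) xor false) ≡ true xor (p xor (s xor t))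
    right = solve 5 (λ u w p s t → ((u :+ w) :+ (con true :+ p)) :+ ((u :+ (s :+ (w :+ t))) :+ con false) := con true :+ (p :+ (s :+ t))) refl

module Construction {n : ℕ} (G : Graph n) (R : RotationSystem G) (quartic : Quartic G) (3-connected : ThreeConnected G)
  (euler : n + numFaces R ≡ 2 + numEdges G) (not-octahedron : ¬ Isomorphic G octahedron) where

  -- The rotation at a vertex of degree four

  V : Set
  V = Fin n

  infix 4 _—_
  _—_ : V → V → Set
  u — v = adj G u v ≡ true

  —-sym : ∀ {u v} → u — v → v — u
  —-sym {u} {v} e = trans (adj-sym G v u) e

  —-≢ : ∀ {u v} → u — v → u ≢ v
  —-≢ {u} e refl = true≢false (trans (sym e) (irrefl G u))

  r r² r³ : V → V → V
  r = rot R
  r² v u = r v (r v u)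
  r³ v u = r v (r v (r v u))

  r-nbr : ∀ {v u} → v — u → v — r v u
  r-nbr {v} {u} = rot-nbr R v u

  r²-nbr : ∀ {v u} → v — u → v — r² v u
  r²-nbr = r-nbr ∘ r-nbr

  r³-nbr : ∀ {v u} → v — u → v — r³ v u
  r³-nbr = r-nbr ∘ r²-nbr

  private
    cycle : ∀ {v u} k → iter (r v) (suc k) u ≡ u → ∀ t → ∃[ j ] (j ≤ k × iter (r v) t u ≡ iter (r v) j u)
    cycle k e zero = 0 , z≤n , refl
    cycle {v} k e (suc t) with cycle k e t
    ... | j , j≤k , eq with j <? k
    ...   | yes j<k = suc j , j<k , cong (r v) eq
    ...   | no j≮k = 0 , z≤n , trans (cong (r v) (trans eq (cong (λ i → iter (r v) i _) (≤-antisym j≤k (≮⇒≥ j≮k))))) e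

    first3 : ∀ {v u} k → k ≤ 2 → ∀ j → j ≤ k → iter (r v) j u ∈ (u ∷ r v u ∷ r² v u ∷ [])
    first3 k h 0 _ = here refl
    first3 k h 1 _ = 2nd refl
    first3 k h 2 _ = 3rd refl
    first3 k h (suc (suc (suc j))) l = contradiction (≤-trans l h) λ { (s≤s (s≤s ())) }

    -- By `rot-cyc` the iterates exhaust the neighbourhood, so a period of at most three leaves
    -- fewer than four neighbours.
    aperiodic : ∀ {v u} k → k ≤ 2 → v — u → iter (r v) (suc k) u ≢ u
    aperiodic {v} {u} k h e eq = contradiction (subst (_≤ 3) (quartic v) (count-cover (u ∷ r v u ∷ r² v u ∷ []) cover)) λ { (s≤s (s≤s (s≤s ()))) }
      where
      cover : ∀ w → v — w → w ∈ (u ∷ r v u ∷ r² v u ∷ [])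
      cover w f with rot-cyc R v u w e f
      ... | t , refl with cycle k eq t
      ...   | j , j≤k , eq′ rewrite eq′ = first3 k h j j≤k

  r≢ : ∀ {v u} → v — u → r v u ≢ u
  r≢ = aperiodic 0 z≤n

  r²≢ : ∀ {v u} → v — u → r² v u ≢ u
  r²≢ = aperiodic 1 (s≤s z≤n)

  r³≢ : ∀ {v u} → v — u → r³ v u ≢ u
  r³≢ = aperiodic 2 (s≤s (s≤s z≤n))

  -- Otherwise the fourth iterate would be a fifth distinct neighbour.
  r⁴ : ∀ {v u} → v — u → r v (r³ v u) ≡ u
  r⁴ {v} {u} e with r v (r³ v u) ≟ u
  ... | yes eq = eq
  ... | no neq = contradiction (subst (5 ≤_) (quartic v) (count-subset (u ∷ r v u ∷ r² v u ∷ r³ v u ∷ r v (r³ v u) ∷ []) {adj G v}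
      ( e
      , ∖-keep (r≢ e) (r-nbr e)
      , ∖-keep (r≢ (r-nbr e)) (∖-keep (r²≢ e) (r²-nbr e))
      , ∖-keep (r≢ (r²-nbr e)) (∖-keep (r²≢ (r-nbr e)) (∖-keep (r³≢ e) (r³-nbr e)))
      , ∖-keep (r≢ (r³-nbr e)) (∖-keep (r²≢ (r²-nbr e)) (∖-keep (r³≢ (r-nbr e)) (∖-keep neq (r-nbr (r³-nbr e)))))
      , tt))) λ { (s≤s (s≤s (s≤s (s≤s ())))) }

  data Position (v u w : V) : Set where
    at0 : w ≡ u → Position v u w
    at1 : w ≡ r v u → Position v u w
    at2 : w ≡ r² v u → Position v u w
    at3 : w ≡ r³ v u → Position v u w

  position : ∀ {v u w} → v — u → v — w → Position v u w
  position {v} {u} {w} e f with rot-cyc R v u w e f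
  ... | t , refl with cycle 3 (r⁴ e) t
  ...   | 0 , _ , eq = at0 eq
  ...   | 1 , _ , eq = at1 eq
  ...   | 2 , _ , eq = at2 eq
  ...   | 3 , _ , eq = at3 eq
  ...   | suc (suc (suc (suc j))) , s≤s (s≤s (s≤s ())) , _

  xsum-nbrs : ∀ {v u} → v — u → (g : V → Bool) →
    xsum (λ w → adj G v w ∧ g w) ≡ g u xor (g (r v u) xor (g (r² v u) xor g (r³ v u)))
  xsum-nbrs {v} {u} e g = begin
    xsum f                                     ≡⟨ xsum-∖ f u ⟩
    f u xor xsum f₁                            ≡⟨ cong₂ _xor_ (at e) (xsum-∖ f₁ (r v u)) ⟩
    g u xor (f₁ (r v u) xor xsum f₂)           ≡⟨ cong (g u xor_) (cong₂ _xor_ (trans (∖-other f (r≢ e)) (at (r-nbr e))) (xsum-∖ f₂ (r² v u))) ⟩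
    g u xor (g (r v u) xor (f₂ (r² v u) xor xsum f₃))
      ≡⟨ cong (λ z → g u xor (g (r v u) xor z)) (cong₂ _xor_ (trans (∖-other f₁ (r≢ (r-nbr e))) (trans (∖-other f (r²≢ e)) (at (r²-nbr e)))) (xsum-∖ f₃ (r³ v u))) ⟩
    g u xor (g (r v u) xor (g (r² v u) xor (f₃ (r³ v u) xor xsum (f₃ ∖ r³ v u))))
      ≡⟨ cong (λ z → g u xor (g (r v u) xor (g (r² v u) xor z)))
           (cong₂ _xor_ (trans (∖-other f₂ (r≢ (r²-nbr e))) (trans (∖-other f₁ (r²≢ (r-nbr e))) (trans (∖-other f (r³≢ e)) (at (r³-nbr e))))) (xsum-false rest)) ⟩
    g u xor (g (r v u) xor (g (r² v u) xor (g (r³ v u) xor false)))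
      ≡⟨ cong (λ z → g u xor (g (r v u) xor (g (r² v u) xor z))) (xor-identityʳ _) ⟩
    g u xor (g (r v u) xor (g (r² v u) xor g (r³ v u))) ∎
    where
    open ≡-Reasoning
    f f₁ f₂ f₃ : V → Bool
    f w = adj G v w ∧ g w
    f₁ = f ∖ u
    f₂ = f₁ ∖ r v u
    f₃ = f₂ ∖ r² v u
    at : ∀ {w} → v — w → f w ≡ g w
    at h rewrite h = refl
    rest : ∀ w → (f₃ ∖ r³ v u) w ≡ false
    rest w = bool-false λ t →
      let t₃ , n₃ = ∖-true f₃ t
          t₂ , n₂ = ∖-true f₂ t₃
          t₁ , n₁ = ∖-true f₁ t₂
          t₀ , n₀ = ∖-true f t₁
      in case position e (adj-of t₀) of λ where
        (at0 eq) → n₀ eq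
        (at1 eq) → n₁ eq
        (at2 eq) → n₂ eq
        (at3 eq) → n₃ eq
      where
      adj-of : ∀ {w} → f w ≡ true → v — w
      adj-of {w} t with adj G v w
      ... | true = refl

  r-inj : ∀ {v u w} → v — u → v — w → r v u ≡ r v w → u ≡ w
  r-inj {v} eu ew eq = trans (sym (r⁴ eu)) (trans (cong (r³ v) eq) (r⁴ ew))

  connected : ∀ u v → Reach G (λ _ → false) u v
  connected u v = proj₂ 3-connected (λ _ → false) (≤-trans (≤-reflexive (cong suc (count-zero {n} {λ _ → false} (λ _ → refl)))) (s≤s z≤n)) u v refl refl

  -- Darts and faces

  D : Set
  D = V × V

  _≟D_ : (d e : D) → Dec (d ≡ e)
  _≟D_ = ≡-dec _≟_ _≟_

  adjD : D → Bool
  adjD (u , v) = adj G u v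

  φ : D → D
  φ = faceStep R

  φ-inj : ∀ {d e} → adjD d ≡ true → adjD e ≡ true → φ d ≡ φ e → d ≡ e
  φ-inj {u , v} {u′ , v′} a b eq with cong proj₁ eq
  ... | refl = cong (_, v) (r-inj (—-sym a) (—-sym b) (cong proj₂ eq))

  module FaceOrbit = Orbit φ (λ d → adjD d ≡ true) (λ {d} e → r-nbr (—-sym e)) (λ {d} {e} → φ-inj {d} {e})

  -- The dart of least key among the first iterates represents the face.
  least : ℕ → D → D
  least zero d = d
  least (suc k) d = if ⌊ key R (least k d) ≤? key R (iter φ (suc k) d) ⌋ then least k d else iter φ (suc k) d

  least-iter : ∀ k d → ∃[ t ] (t ≤ k × least k d ≡ iter φ t d)
  least-iter zero d = 0 , z≤n , refl
  least-iter (suc k) d with key R (least k d) ≤? key R (iter φ (suc k) d)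
  ... | yes _ = let t , l , e = least-iter k d in t , m≤n⇒m≤1+n l , e
  ... | no _ = suc k , ≤-refl , refl

  least-≤ : ∀ k d t → t ≤ k → key R (least k d) ≤ key R (iter φ t d)
  least-≤ zero d zero l = ≤-refl
  least-≤ (suc k) d t l with key R (least k d) ≤? key R (iter φ (suc k) d) | m≤n⇒m<n∨m≡n l
  ... | yes h | inj₁ (s≤s l′) = least-≤ k d t l′
  ... | yes h | inj₂ refl = h
  ... | no h  | inj₁ (s≤s l′) = ≤-trans (<⇒≤ (≰⇒> h)) (least-≤ k d t l′)
  ... | no h  | inj₂ refl = ≤-refl

  face : D → D
  face = least (n * n)

  -- The window of iterates moves by one step, and the iterate lost at one end recurs inside the
  -- other window because the period is at most n * n.
  face-φ : ∀ {d} → adjD d ≡ true → face (φ d) ≡ face d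
  face-φ {d} a = key-injective R (≤-antisym below above)
    where
    below : key R (face (φ d)) ≤ key R (face d)
    below with least-iter (n * n) d
    ... | suc t , l , e = subst (λ x → key R (face (φ d)) ≤ key R x) (trans (sym (iter-suc φ t d)) (sym e)) (least-≤ (n * n) (φ d) t (≤-trans (n≤1+n t) l))
    ... | zero , l , e with FaceOrbit.period a
    ...   | suc p , _ , l′ , eq = subst (λ x → key R (face (φ d)) ≤ key R x) (trans (trans (sym (iter-suc φ p d)) eq) (sym e)) (least-≤ (n * n) (φ d) p (≤-trans (n≤1+n p) l′))
    above : key R (face d) ≤ key R (face (φ d))
    above with least-iter (n * n) (φ d)
    ... | t , l , e with m≤n⇒m<n∨m≡n l
    ...   | inj₁ l′ = subst (λ x → key R (face d) ≤ key R x) (trans (iter-suc φ t d) (sym e)) (least-≤ (n * n) d (suc t) l′)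
    ...   | inj₂ refl with FaceOrbit.period a
    ...     | suc p , _ , l′ , eq = subst (λ x → key R (face d) ≤ key R x) e′ (least-≤ (n * n) d (t ∸ p) (m∸n≤m t p))
      where
      e′ : iter φ (t ∸ p) d ≡ face (φ d)
      e′ = sym (trans e (trans (sym (iter-suc φ t d)) (trans (cong (λ k → iter φ k d) k≡) (trans (iter-+ φ (t ∸ p) (suc p) d) (cong (iter φ (t ∸ p)) eq)))))
        where
        k≡ : suc t ≡ (t ∸ p) + suc p
        k≡ = sym (trans (+-suc (t ∸ p) p) (cong suc (m∸n+n≡m (≤-trans (n≤1+n p) l′))))

  face-fixed : ∀ {d} → adjD d ≡ true → isFaceRep R d ≡ true → face d ≡ d
  face-fixed {d} a h = key-injective R (≤-antisym (least-≤ (n * n) d 0 z≤n) below)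
    where
    at : ∀ t → t < n * n → key R d ≤ key R (iter φ t d)
    at t l = ≤ᵇ⇒≤ _ _ (subst T (sym (allBelow-elim (n * n) h t l)) tt)
    below : key R d ≤ key R (face d)
    below with least-iter (n * n) d
    ... | t , l , e with m≤n⇒m<n∨m≡n l
    ...   | inj₁ l′ = subst (λ x → key R d ≤ key R x) (sym e) (at t l′)
    -- `isFaceRep` stops before n * n while `least` includes it; this last iterate repeats an
    -- earlier one.
    ...   | inj₂ refl with FaceOrbit.period a
    ...     | suc p , _ , l′ , eq = subst (λ x → key R d ≤ key R x) e′ (at (t ∸ suc p) (∸-monoʳ-< {o = 0} (s≤s z≤n) l′))
      where
      e′ : iter φ (t ∸ suc p) d ≡ face d
      e′ = sym (trans e (trans (cong (λ k → iter φ k d) (sym (m∸n+n≡m l′))) (trans (iter-+ φ (t ∸ suc p) (suc p) d) (cong (iter φ (t ∸ suc p)) eq))))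

  -- Components, dual components and Euler's formula

  module UV = Union {V} _≟_
  module UD = Union {D} _≟D_
  module CV = UV.Count counter₁ (λ _ → true)
  module CD = UD.Count counter₂ adjD

  numFaces≤ : numFaces R ≤ proj₁ (counter₂ {n}) (UD.fixed adjD face)
  numFaces≤ = proj₁ (proj₂ (proj₂ (counter₂ {n}))) (λ (d : D) → adjD d ∧ isFaceRep R d) (UD.fixed adjD face) λ d t →
    let a , h = ∧-elim {adjD d} t in UD.fixed-intro {adjD} {face} {d} a (face-fixed a h)

  n≤ : n ≤ proj₁ (counter₁ {n}) (UV.fixed (λ _ → true) (λ i → i))
  n≤ = subst (_≤ count (UV.fixed (λ _ → true) (λ i → i))) (all n) (count-mono {p = λ _ → true} {q = UV.fixed (λ _ → true) (λ i → i)} (λ i _ → UV.fixed-intro {λ _ → true} {λ i → i} refl refl))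
    where
    all : ∀ m → count {m} (λ _ → true) ≡ m
    all zero = refl
    all (suc m) = cong suc (all m)

  flip : D → D × D
  flip (u , v) = (u , v) , (v , u)

  vjoin : List D → V → V
  vjoin = UV.joins (λ i → i)

  -- Deleting an edge merges the faces of its two darts, so the classes are the faces left after
  -- deleting the edges of L.
  fjoin : List D → D → D
  fjoin L = UD.joins face (map flip L)

  fjoin-φ : ∀ L {u v} → u — v → fjoin L (u , v) ≡ fjoin L (v , r v u)
  fjoin-φ L a = UD.joins-mono face (map flip L) (sym (face-φ a))

  Listed : List D → D → Set
  Listed L (u , v) = (u , v) ∈ L ⊎ (v , u) ∈ L

  fjoin-flip : ∀ L {u v} → Listed L (u , v) → fjoin L (u , v) ≡ fjoin L (v , u)
  fjoin-flip L (inj₁ m) = UD.joins-glue face (map flip L) (∈-map⁺ flip m)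
  fjoin-flip L (inj₂ m) = sym (UD.joins-glue face (map flip L) (∈-map⁺ flip m))

  vjoin-edge : ∀ L {u v} → Listed L (u , v) → vjoin L u ≡ vjoin L v
  vjoin-edge L (inj₁ m) = UV.joins-glue (λ i → i) L m
  vjoin-edge L (inj₂ m) = sym (UV.joins-glue (λ i → i) L m)

  some-nbr : ∀ v → ∃[ u ] v — u
  some-nbr v with any? (λ u → adj G v u ≟B true)
  ... | yes h = h
  ... | no h = contradiction (trans (sym (quartic v)) (count-zero (λ u → bool-false (λ e → h (u , e))))) λ ()

  -- `C` is constant along faces, so on the way around w it changes only across edges; back at the
  -- start it has changed an even number of times.
  even-changes : (C : V → V → Bool) → (∀ {u v} → u — v → C u v ≡ C v (r v u)) →
    ∀ w → xsum (λ z → adj G w z ∧ (C w z xor C z w)) ≡ false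
  even-changes C h w with some-nbr w
  ... | z , a = trans (xsum-nbrs a (λ z → C w z xor C z w)) (telescope (c a) (c (r-nbr a)) (c (r²-nbr a)) (trans (c (r³-nbr a)) (cong (C w) (r⁴ a))))
    where
    c : ∀ {z} → w — z → C z w ≡ C w (r w z)
    c a = h (—-sym a)
    telescope : ∀ {a b c d a′ b′ c′ d′} → a′ ≡ b → b′ ≡ c → c′ ≡ d → d′ ≡ a →
      (a xor a′) xor ((b xor b′) xor ((c xor c′) xor (d xor d′))) ≡ false
    telescope {a} {b} {c} {d} refl refl refl refl = begin
      (a xor b) xor ((b xor c) xor ((c xor d) xor (d xor a)))  ≡⟨ cong (λ z → (a xor b) xor ((b xor c) xor z)) (cancel c d a) ⟩
      (a xor b) xor ((b xor c) xor (c xor a))                  ≡⟨ cong ((a xor b) xor_) (cancel b c a) ⟩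
      (a xor b) xor (b xor a)                                  ≡⟨ cancel a b a ⟩
      a xor a                                                  ≡⟨ xor-same a ⟩
      false ∎
      where
      open ≡-Reasoning
      cancel : ∀ x y z → (x xor y) xor (y xor z) ≡ x xor z
      cancel x y z = trans (xor-assoc x y _) (cong (x xor_) (trans (sym (xor-assoc y y z)) (cong (_xor z) (xor-same y))))

  -- An edge bridging two components of X cannot also separate two dual components of the remaining edges.
  not-both : ∀ X K {u v} → u — v → (∀ {w z} → w — z → Listed X (w , z) ⊎ Listed ((u , v) ∷ K) (w , z)) →
    vjoin X u ≢ vjoin X v → fjoin K (u , v) ≢ fjoin K (v , u) → ⊥
  not-both X K {u} {v} uv full bridge sep = true≢false (trans (sym one) zeros)
    where
    open ≡-Reasoning
    U : V → Bool
    U w = ⌊ vjoin X w ≟ vjoin X u ⌋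
    C : V → V → Bool
    C w z = ⌊ fjoin K (w , z) ≟D fjoin K (u , v) ⌋
    -- `f` marks the edges whose darts `C` distinguishes, `g` those of them inside the component `U`
    -- of u, and `h` those leaving it. The rows of `f` are even and `g` counts its edges twice, so
    -- `h` is even too; but it contains uv alone.
    f g h : V → V → Bool
    f w z = adj G w z ∧ (C w z xor C z w)
    g w z = (U w ∧ U z) ∧ f w z
    h w z = (U w ∧ not (U z)) ∧ f w z

    C-φ : ∀ {w z} → w — z → C w z ≡ C z (r z w)
    C-φ a = ⌊⌋-cong (_ ≟D _) (_ ≟D _) (trans (sym (fjoin-φ K a))) (trans (fjoin-φ K a))

    f-sym : ∀ w z → f w z ≡ f z w
    f-sym w z = cong₂ _∧_ (adj-sym G w z) (xor-comm (C w z) (C z w))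

    split-row : ∀ w z → (U w ∧ f w z) ≡ g w z xor h w z
    split-row w z with U w | U z
    ... | false | _ = refl
    ... | true | true = sym (xor-identityʳ _)
    ... | true | false = refl

    rows : xsum (λ w → xsum (λ z → U w ∧ f w z)) ≡ false
    rows = xsum-false λ w → row w (U w)
      where
      row : ∀ w b → xsum (λ z → b ∧ f w z) ≡ false
      row w false = xsum-false {n} {λ _ → false} (λ _ → refl)
      row w true = even-changes C C-φ w

    gs : xsum (λ w → xsum (g w)) ≡ false
    gs = xsum-symmetric g (λ w z → cong₂ _∧_ (∧-comm (U w) (U z)) (f-sym w z)) λ w → trans (cong ((U w ∧ U w) ∧_) (trans (cong (_∧ (C w w xor C w w)) (irrefl G w)) refl)) (∧-zeroʳ _)

    zeros : xsum (λ w → xsum (h w)) ≡ false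
    zeros = begin
      xsum (λ w → xsum (h w))                               ≡⟨ cong (_xor xsum (λ w → xsum (h w))) gs ⟨
      xsum (λ w → xsum (g w)) xor xsum (λ w → xsum (h w))   ≡⟨ xsum-xor (λ w → xsum (g w)) (λ w → xsum (h w)) ⟨
      xsum (λ w → xsum (g w) xor xsum (h w))                ≡⟨ xsum-cong (λ w → sym (xsum-xor (g w) (h w))) ⟩
      xsum (λ w → xsum (λ z → g w z xor h w z))             ≡⟨ xsum-cong (λ w → xsum-cong (λ z → sym (split-row w z))) ⟩
      xsum (λ w → xsum (λ z → U w ∧ f w z))                 ≡⟨ rows ⟩
      false ∎

    only : ∀ w z → h w z ≡ true → w ≡ u × z ≡ v
    only w z t with ∧-elim {U w ∧ not (U z)} t
    ... | t₁ , t₂ with ∧-elim {U w} t₁ | ∧-elim {adj G w z} t₂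
    ...   | Uw , nUz | a , ch with full a
    ...     | inj₁ m = contradiction (fromWit (vjoin X z ≟ vjoin X u) (trans (sym (vjoin-edge X m)) (toWit (vjoin X w ≟ vjoin X u) Uw))) λ Uz → true≢false (trans (sym nUz) (cong not Uz))
    ...     | inj₂ (inj₁ (here refl)) = refl , refl
    ...     | inj₂ (inj₂ (here refl)) = contradiction (toWit (vjoin X v ≟ vjoin X u) Uw) (bridge ∘ sym)
    ...     | inj₂ (inj₁ (there m)) = contradiction (trans (sym ch) (trans (cong (C w z xor_) (sym (eqC (inj₁ m)))) (xor-same (C w z)))) true≢false
      where
      eqC : Listed K (w , z) → C w z ≡ C z w
      eqC l = ⌊⌋-cong (_ ≟D _) (_ ≟D _) (trans (sym (fjoin-flip K l))) (trans (fjoin-flip K l))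
    ...     | inj₂ (inj₂ (there m)) = contradiction (trans (sym ch) (trans (cong (C w z xor_) (sym (eqC (inj₂ m)))) (xor-same (C w z)))) true≢false
      where
      eqC : Listed K (w , z) → C w z ≡ C z w
      eqC l = ⌊⌋-cong (_ ≟D _) (_ ≟D _) (trans (sym (fjoin-flip K l))) (trans (fjoin-flip K l))

    huv : h u v ≡ true
    huv = ∧-intro (∧-intro (fromWit (vjoin X u ≟ vjoin X u) refl) (cong not (fromWit¬ (vjoin X v ≟ vjoin X u) (bridge ∘ sym))))
      (∧-intro uv (cong₂ _xor_ (fromWit (fjoin K (u , v) ≟D fjoin K (u , v)) refl) (fromWit¬ (fjoin K (v , u) ≟D fjoin K (u , v)) (sep ∘ sym))))

    one : xsum (λ w → xsum (h w)) ≡ true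
    one = begin
      xsum (λ w → xsum (h w))                       ≡⟨ xsum-∖ (λ w → xsum (h w)) u ⟩
      xsum (h u) xor xsum ((λ w → xsum (h w)) ∖ u)  ≡⟨ cong₂ _xor_ (xsum-∖ (h u) v) (xsum-false others) ⟩
      (h u v xor xsum (h u ∖ v)) xor false          ≡⟨ xor-identityʳ _ ⟩
      h u v xor xsum (h u ∖ v)                      ≡⟨ cong₂ _xor_ huv (xsum-false (λ z → bool-false λ t → let t′ , ne = ∖-true (h u) t in ne (proj₂ (only u z t′)))) ⟩
      true ∎
      where
      others : ∀ w → ((λ w → xsum (h w)) ∖ u) w ≡ false
      others w with w ≟ u
      ... | yes refl = ∖-same (λ w → xsum (h w)) u
      ... | no w≢u = trans (∖-other (λ w → xsum (h w)) w≢u) (xsum-false (λ z → bool-false (λ t → w≢u (proj₁ (only w z t)))))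

  -- Consumes a list from its front, whereas `joins` processes it from its end; the two processes
  -- thus run in opposite orders.
  onto : List D → List D → List D
  onto X []      = X
  onto X (e ∷ L) = onto (e ∷ X) L

  ∈-onto : ∀ X L {e} → e ∈ X ⊎ e ∈ L → e ∈ onto X L
  ∈-onto X [] (inj₁ m) = m
  ∈-onto X (x ∷ L) (inj₁ m) = ∈-onto (x ∷ X) L (inj₁ (there m))
  ∈-onto X (x ∷ L) (inj₂ (here refl)) = ∈-onto (x ∷ X) L (inj₁ (here refl))
  ∈-onto X (x ∷ L) (inj₂ (there m)) = ∈-onto (x ∷ X) L (inj₂ m)

  Listed-⊆ : ∀ {L K d} → (∀ {e} → e ∈ L → e ∈ K) → Listed L d → Listed K d
  Listed-⊆ h (inj₁ m) = inj₁ (h m)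
  Listed-⊆ h (inj₂ m) = inj₂ (h m)

  -- Merges of components when the edges are added in order, and merges of dual
  -- components when they are added in the opposite order.
  primal : List D → List D → ℕ
  primal X []      = 0
  primal X (e ∷ L) = bit (UV.split (vjoin X) e) + primal (e ∷ X) L

  dual : List D → ℕ
  dual L = CD.merges face (map flip L)

  merges-onto : ∀ X L → CV.merges (λ i → i) (onto X L) ≡ primal X L + CV.merges (λ i → i) X
  merges-onto X [] = refl
  merges-onto X (e ∷ L) = trans (merges-onto (e ∷ X) L) (trans (sym (+-assoc (primal (e ∷ X) L) b _)) (cong (_+ CV.merges (λ i → i) X) (+-comm (primal (e ∷ X) L) b)))
    where b = bit (UV.split (vjoin X) e)

  Full : List D → List D → Set
  Full X L = ∀ {w z} → w — z → Listed X (w , z) ⊎ Listed L (w , z)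

  Edges : List D → Set
  Edges L = ∀ {u v} → (u , v) ∈ L → u — v

  Full-shift : ∀ {X e L} → Full X (e ∷ L) → Full (e ∷ X) L
  Full-shift full a with full a
  ... | inj₁ m = inj₁ (Listed-⊆ there m)
  ... | inj₂ (inj₁ (here refl)) = inj₁ (inj₁ (here refl))
  ... | inj₂ (inj₂ (here refl)) = inj₁ (inj₂ (here refl))
  ... | inj₂ (inj₁ (there m)) = inj₂ (inj₁ m)
  ... | inj₂ (inj₂ (there m)) = inj₂ (inj₂ m)

  private
    swap4 : ∀ a b c d → (a + b) + (c + d) ≡ (a + c) + (b + d)
    swap4 a b c d = trans (+-assoc a b _) (trans (cong (a +_) (trans (sym (+-assoc b c d)) (trans (cong (_+ d) (+-comm b c)) (+-assoc c b d)))) (sym (+-assoc a c _)))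

    bits : ∀ a b → ¬ (a ≡ true × b ≡ true) → bit a + bit b ≤ 1
    bits false false h = z≤n
    bits false true  h = ≤-refl
    bits true  false h = ≤-refl
    bits true  true  h = contradiction (refl , refl) h

    step≤1 : ∀ X u v L → Edges ((u , v) ∷ L) → Full X ((u , v) ∷ L) → bit (UV.split (vjoin X) (u , v)) + bit (UD.split (fjoin L) (flip (u , v))) ≤ 1
    step≤1 X u v L ed full = bits _ _ λ (p , q) → not-both X L (ed (here refl)) full (UV.split-true {vjoin X} p) (UD.split-true {fjoin L} q)

    -- Each edge merges in at most one process: the edges before it and after it are the sets X and
    -- K of `not-both`.
    bound : ∀ X L → Edges L → Full X L → primal X L + dual L ≤ length L
    bound X [] ed full = z≤n
    bound X ((u , v) ∷ L) ed full = ≤-trans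
      (≤-reflexive (swap4 (bit (UV.split (vjoin X) (u , v))) _ (bit (UD.split (fjoin L) (flip (u , v)))) _))
      (+-mono-≤ (step≤1 X u v L ed full) (bound ((u , v) ∷ X) L (ed ∘ there) (Full-shift full)))

    -- An edge whose ends are connected by earlier edges, and whose sides are connected by later
    -- ones, is idle in both processes.
    strict : ∀ X L u v K → Edges (L ++ (u , v) ∷ K) → Full X (L ++ (u , v) ∷ K) →
      vjoin (onto X L) u ≡ vjoin (onto X L) v → fjoin K (u , v) ≡ fjoin K (v , u) →
      primal X (L ++ (u , v) ∷ K) + dual (L ++ (u , v) ∷ K) < length (L ++ (u , v) ∷ K)
    strict X [] u v K ed full p q = s≤s (≤-trans
      (≤-reflexive (cong₂ _+_ (cong (λ b → bit b + primal ((u , v) ∷ X) K) (UV.split-false {vjoin X} p)) (cong (λ b → bit b + dual K) (UD.split-false {fjoin K} q))))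
      (bound ((u , v) ∷ X) K (ed ∘ there) (Full-shift full)))
    strict X ((a , b) ∷ L) u v K ed full p q = ≤-trans
      (s≤s (≤-reflexive (swap4 (bit (UV.split (vjoin X) (a , b))) _ (bit (UD.split (fjoin (L ++ (u , v) ∷ K)) (flip (a , b)))) _)))
      (≤-trans (≤-reflexive (sym (+-suc _ _))) (+-mono-≤ (step≤1 X a b (L ++ (u , v) ∷ K) ed full) (strict ((a , b) ∷ X) L u v K (ed ∘ there) (Full-shift full) p q)))

  -- zin selects the edges of a closed curve; path says that it stays connected without its edge ab.
  module _ (zin : V → V → Bool) {a b : V} (ab : a — b) (zab : zin a b ≡ true) (zsym : ∀ u v → zin u v ≡ zin v u)
    (path : ∀ {A : Set} (f : V → A) → (∀ {u v} → u — v → zin u v ≡ true → ¬ SameEdge (u , v) (a , b) → f u ≡ f v) → f a ≡ f b) where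

    private
      lt : V → V → Bool
      lt u v = toℕ u <ᵇ toℕ v

      e₀ : V → V → Bool
      e₀ u v = ⌊ (u , v) ≟D (a , b) ⌋ ∨ ⌊ (u , v) ≟D (b , a) ⌋

      all closing path-edges others : V → V → Bool
      all u v = adj G u v ∧ lt u v
      closing u v = (all u v ∧ zin u v) ∧ e₀ u v
      path-edges u v = (all u v ∧ zin u v) ∧ not (e₀ u v)
      others u v = all u v ∧ not (zin u v)

      L₁ L₂ L₃ : List D
      L₁ = pairs path-edges
      L₂ = pairs closing
      L₃ = pairs others

      lt-total : ∀ {u v} → u ≢ v → lt u v ≡ true ⊎ lt v u ≡ true
      lt-total {u} {v} ne with <-cmp (toℕ u) (toℕ v)
      ... | tri< l _ _ = inj₁ (T-≡ .Equivalence.to (<⇒<ᵇ l))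
      ... | tri≈ _ e _ = contradiction (toℕ-injective e) ne
      ... | tri> _ _ g = inj₂ (T-≡ .Equivalence.to (<⇒<ᵇ g))

      e₀-elim : ∀ {u v} → e₀ u v ≡ true → (u , v) ≡ (a , b) ⊎ (u , v) ≡ (b , a)
      e₀-elim {u} {v} t with (u , v) ≟D (a , b) | (u , v) ≟D (b , a)
      ... | yes e | _ = inj₁ e
      ... | no _ | yes e = inj₂ e

      e₀-ab : e₀ a b ≡ true
      e₀-ab = cong (_∨ ⌊ (a , b) ≟D (b , a) ⌋) (fromWit ((a , b) ≟D (a , b)) refl)

      e₀-ba : e₀ b a ≡ true
      e₀-ba = trans (cong (⌊ (b , a) ≟D (a , b) ⌋ ∨_) (fromWit ((b , a) ≟D (b , a)) refl)) (∨-zeroʳ _)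

      e₀-false : ∀ {u v} → ¬ SameEdge (u , v) (a , b) → e₀ u v ≡ false
      e₀-false {u} {v} h = bool-false λ t → case e₀-elim {u} {v} t of λ where
        (inj₁ refl) → h (inj₁ (refl , refl))
        (inj₂ refl) → h (inj₂ (refl , refl))

      oriented : ∀ (p : V → V → Bool) {u v} → u — v → (lt u v ≡ true → p u v ≡ true) → (lt v u ≡ true → p v u ≡ true) → Listed (pairs p) (u , v)
      oriented p uv h k with lt-total (—-≢ uv)
      ... | inj₁ l = inj₁ (∈-pairs {p = p} (h l))
      ... | inj₂ l = inj₂ (∈-pairs {p = p} (k l))

      in-path : ∀ {u v} → u — v → zin u v ≡ true → ¬ SameEdge (u , v) (a , b) → Listed L₁ (u , v)
      in-path {u} {v} uv z ne = oriented path-edges uv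
        (λ l → ∧-intro (∧-intro (∧-intro uv l) z) (cong not (e₀-false {u} {v} ne)))
        (λ l → ∧-intro (∧-intro (∧-intro (—-sym uv) l) (trans (zsym v u) z)) (cong not (e₀-false {v} {u} λ where
          (inj₁ (p , q)) → ne (inj₂ (q , p))
          (inj₂ (p , q)) → ne (inj₁ (q , p)))))

      in-others : ∀ {u v} → u — v → zin u v ≡ false → Listed L₃ (u , v)
      in-others {u} {v} uv z = oriented others uv
        (λ l → ∧-intro (∧-intro uv l) (cong not z))
        (λ l → ∧-intro (∧-intro (—-sym uv) l) (cong not (trans (zsym v u) z)))

      in-closing : Listed L₂ (a , b)
      in-closing = oriented closing ab
        (λ l → ∧-intro (∧-intro (∧-intro ab l) zab) e₀-ab)
        (λ l → ∧-intro (∧-intro (∧-intro (—-sym ab) l) (trans (zsym b a) zab)) e₀-ba)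

      same-dec : ∀ u v → Dec (SameEdge (u , v) (a , b))
      same-dec u v with e₀ u v in eq
      ... | true = yes (case e₀-elim {u} {v} eq of λ { (inj₁ refl) → inj₁ (refl , refl) ; (inj₂ refl) → inj₂ (refl , refl) })
      ... | false = no λ where
        (inj₁ (refl , refl)) → true≢false (trans (sym e₀-ab) eq)
        (inj₂ (refl , refl)) → true≢false (trans (sym e₀-ba) eq)

      full : Full [] (L₁ ++ L₂ ++ L₃)
      full {w} {z} wz with zin w z in eq
      ... | false = inj₂ (Listed-⊆ (∈-++⁺ʳ L₁ ∘ ∈-++⁺ʳ L₂) (in-others wz eq))
      ... | true with same-dec w z
      ...   | no ne = inj₂ (Listed-⊆ ∈-++⁺ˡ (in-path wz eq ne))
      ...   | yes (inj₁ (refl , refl)) = inj₂ (Listed-⊆ (∈-++⁺ʳ L₁ ∘ ∈-++⁺ˡ) in-closing)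
      ...   | yes (inj₂ (refl , refl)) with in-closing
      ...     | inj₁ m = inj₂ (inj₂ (∈-++⁺ʳ L₁ (∈-++⁺ˡ m)))
      ...     | inj₂ m = inj₂ (inj₁ (∈-++⁺ʳ L₁ (∈-++⁺ˡ m)))

      edges : Edges (L₁ ++ L₂ ++ L₃)
      edges m with ∈-++⁻ L₁ m
      ... | inj₁ m₁ = proj₁ (∧-elim (proj₁ (∧-elim (proj₁ (∧-elim (∈-pairs⁻ {p = path-edges} m₁))))))
      ... | inj₂ m′ with ∈-++⁻ L₂ m′
      ...   | inj₁ m₂ = proj₁ (∧-elim (proj₁ (∧-elim (proj₁ (∧-elim (∈-pairs⁻ {p = closing} m₂))))))
      ...   | inj₂ m₃ = proj₁ (∧-elim (proj₁ (∧-elim (∈-pairs⁻ {p = others} m₃))))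

      L-length : length (L₁ ++ L₂ ++ L₃) ≡ numEdges G
      L-length = begin
        length (L₁ ++ L₂ ++ L₃)                                    ≡⟨ length-++ L₁ ⟩
        length L₁ + length (L₂ ++ L₃)                              ≡⟨ cong (length L₁ +_) (length-++ L₂) ⟩
        length L₁ + (length L₂ + length L₃)                        ≡⟨ cong₂ _+_ (pairs-length path-edges) (cong₂ _+_ (pairs-length closing) (pairs-length others)) ⟩
        count₂ path-edges + (count₂ closing + count₂ others)       ≡⟨ +-assoc (count₂ path-edges) _ _ ⟨
        (count₂ path-edges + count₂ closing) + count₂ others       ≡⟨ cong (_+ count₂ others) (+-comm (count₂ path-edges) _) ⟩
        (count₂ closing + count₂ path-edges) + count₂ others       ≡⟨ cong (_+ count₂ others) (count₂-split (λ u v → all u v ∧ zin u v) e₀) ⟨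
        count₂ (λ u v → all u v ∧ zin u v) + count₂ others         ≡⟨ count₂-split all zin ⟨
        numEdges G ∎
        where open ≡-Reasoning

      L : List D
      L = L₁ ++ L₂ ++ L₃

      in-L : ∀ {u v} → u — v → Listed L (u , v)
      in-L uv with full uv
      ... | inj₁ (inj₁ ())
      ... | inj₁ (inj₂ ())
      ... | inj₂ l = l

      reach-const : ∀ {A : Set} (f : V → A) → (∀ {u v} → u — v → f u ≡ f v) → ∀ {u v} → Reach G (λ _ → false) u v → f u ≡ f v
      reach-const f h reach-here = refl
      reach-const f h (reach-step a _ p) = trans (h a) (reach-const f h p)

      fjoin-around : ∀ {u v w} → u — v → u — w → fjoin L (u , v) ≡ fjoin L (u , w)
      fjoin-around {u} {v} uv uw = case position uv uw of λ where
          (at0 refl) → refl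
          (at1 refl) → turn uv
          (at2 refl) → trans (turn uv) (turn (r-nbr uv))
          (at3 refl) → trans (turn uv) (trans (turn (r-nbr uv)) (turn (r²-nbr uv)))
        where
        turn : ∀ {v} → u — v → fjoin L (u , v) ≡ fjoin L (u , r u v)
        turn uv = trans (fjoin-flip L (in-L uv)) (fjoin-φ L (—-sym uv))

      fjoin-const : ∀ {u v w z} → u — v → w — z → fjoin L (u , v) ≡ fjoin L (w , z)
      fjoin-const uv wz = trans (fjoin-around uv (proj₂ (some-nbr _))) (trans (reach-const (λ u → fjoin L (u , proj₁ (some-nbr u))) across (connected _ _)) (fjoin-around (proj₂ (some-nbr _)) wz))
        where
        across : ∀ {u v} → u — v → fjoin L (u , proj₁ (some-nbr u)) ≡ fjoin L (v , proj₁ (some-nbr v))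
        across uv = trans (fjoin-around (proj₂ (some-nbr _)) uv) (trans (fjoin-flip L (in-L uv)) (fjoin-around (—-sym uv) (proj₂ (some-nbr _))))

      -- In the order path, ab, edges off the curve, a failure makes ab idle in both processes. The
      -- numbers of vertices and of faces exceed the respective merges by at most one, so their sum
      -- would fall below the value in Euler's formula.
      separated : fjoin L₃ (a , b) ≢ fjoin L₃ (b , a)
      separated h = contradiction (≤-trans total (≤-reflexive (trans (cong (2 +_) L-length) (sym euler)))) (<⇒≱ (n<1+n (n + numFaces R)))
        where
        pathJ : ∀ {u v} → (u , v) ≡ (a , b) ⊎ (u , v) ≡ (b , a) → vjoin (onto [] L₁) u ≡ vjoin (onto [] L₁) v
        pathJ = λ where
            (inj₁ refl) → p
            (inj₂ refl) → sym p
          where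
          p = path (vjoin (onto [] L₁)) λ uv z ne → vjoin-edge (onto [] L₁) (Listed-⊆ (∈-onto [] L₁ ∘ inj₂) (in-path uv z ne))
        sep : ∀ K {u v} → (u , v) ≡ (a , b) ⊎ (u , v) ≡ (b , a) → fjoin (K ++ L₃) (u , v) ≡ fjoin (K ++ L₃) (v , u)
        sep K {u} {v} c = subst (λ X → UD.joins face X (u , v) ≡ UD.joins face X (v , u)) (sym (map-++ flip K L₃)) (UD.joins-suffix face (map flip K) (map flip L₃)
          (case c of λ { (inj₁ refl) → h ; (inj₂ refl) → sym h }))
        st : ∀ M → (∀ {u v} → (u , v) ∈ M → (u , v) ≡ (a , b) ⊎ (u , v) ≡ (b , a)) → Listed M (a , b) →
          Full [] (L₁ ++ M ++ L₃) → Edges (L₁ ++ M ++ L₃) → primal [] (L₁ ++ M ++ L₃) + dual (L₁ ++ M ++ L₃) < length (L₁ ++ M ++ L₃)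
        st [] el (inj₁ ()) fl ed
        st [] el (inj₂ ()) fl ed
        st ((u , v) ∷ M) el _ fl ed = strict [] L₁ u v (M ++ L₃) ed fl (pathJ (el (here refl))) (sep M (el (here refl)))
        total : suc (n + numFaces R) ≤ 2 + length L
        total = begin
          suc (n + numFaces R)                                   ≤⟨ s≤s (+-mono-≤
            (≤-trans n≤ (≤-trans (CV.merges-connected (λ i → i) (onto [] L) {a} refl λ {i} _ → reach-const (vjoin (onto [] L)) (λ uv → vjoin-edge (onto [] L) (Listed-⊆ (∈-onto [] L ∘ inj₂) (in-L uv))) (connected i a)) (≤-reflexive (cong suc (trans (merges-onto [] L) (+-identityʳ _))))))
            (≤-trans numFaces≤ (CD.merges-connected face (map flip L) {a , b} ab λ d → fjoin-const d ab))) ⟩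
          suc (suc (primal [] L) + suc (dual L))                 ≡⟨ cong (λ k → suc (suc k)) (+-suc (primal [] L) (dual L)) ⟩
          2 + suc (primal [] L + dual L)                         ≤⟨ +-monoʳ-≤ 2 (st L₂ (λ {u} {v} m → e₀-elim {u} {v} (proj₂ (∧-elim (∈-pairs⁻ {p = closing} m)))) in-closing full edges) ⟩
          2 + length L ∎
          where open ≤-Reasoning

    record Sides : Set where
      field
        side : V → V → Bool
        side-φ : ∀ {u v} → u — v → side u v ≡ side v (r v u)
        side-off : ∀ {u v} → u — v → zin u v ≡ false → side u v ≡ side v u
        side-ab : side a b ≡ true
        side-ba : side b a ≡ false

    sides : Sides
    sides = record
      { side = λ u v → ⌊ fjoin L₃ (u , v) ≟D fjoin L₃ (a , b) ⌋
      ; side-φ = λ uv → ⌊⌋-cong (_ ≟D _) (_ ≟D _) (trans (sym (fjoin-φ L₃ uv))) (trans (fjoin-φ L₃ uv))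
      ; side-off = λ uv z → ⌊⌋-cong (_ ≟D _) (_ ≟D _) (trans (sym (fjoin-flip L₃ (in-others uv z)))) (trans (fjoin-flip L₃ (in-others uv z)))
      ; side-ab = fromWit (fjoin L₃ (a , b) ≟D fjoin L₃ (a , b)) refl
      ; side-ba = fromWit¬ (fjoin L₃ (b , a) ≟D fjoin L₃ (a , b)) (separated ∘ sym)
      }

  -- Sides of a chordless closed curve

  -- Beyond plain connectedness and the presence of a vertex, 3-connectedness enters in this form
  -- only: i and o witness that deleting p and q would leave both parts nonempty.
  two-cut : (I : V → Bool) (p q : V) → (∀ {u w} → I u ≡ true → u — w → I w ≡ true ⊎ w ≡ p ⊎ w ≡ q) →
    ∀ {i o} → I i ≡ true → i ≢ p → i ≢ q → I o ≡ false → o ≢ p → o ≢ q → ⊥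
  two-cut I p q closed {i} {o} Ii i≢p i≢q Io o≢p o≢q = true≢false (trans (sym (stays (proj₂ 3-connected S few i o (out i≢p i≢q) (out o≢p o≢q)) Ii)) Io)
    where
    S : V → Bool
    S w = ⌊ w ≟ p ⌋ ∨ ⌊ w ≟ q ⌋
    S-elim : ∀ {w} → S w ≡ true → w ≡ p ⊎ w ≡ q
    S-elim {w} t with w ≟ p | w ≟ q
    ... | yes e | _ = inj₁ e
    ... | no _ | yes e = inj₂ e
    few : suc (count S) ≤ 3
    few = s≤s (count-cover (p ∷ q ∷ []) (λ i t → case S-elim t of λ { (inj₁ e) → here e ; (inj₂ e) → 2nd e }))
    out : ∀ {w} → w ≢ p → w ≢ q → S w ≡ false
    out h k = bool-false λ t → case S-elim t of λ { (inj₁ e) → h e ; (inj₂ e) → k e }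
    notS : ∀ {w} → S w ≡ false → ¬ (w ≡ p ⊎ w ≡ q)
    notS {w} f (inj₁ refl) = true≢false (trans (sym (cong (_∨ ⌊ w ≟ q ⌋) (fromWit (w ≟ w) refl))) f)
    notS {w} f (inj₂ refl) = true≢false (trans (sym (trans (cong (⌊ w ≟ p ⌋ ∨_) (fromWit (w ≟ w) refl)) (∨-zeroʳ _))) f)
    stays : ∀ {u v} → Reach G S u v → I u ≡ true → I v ≡ true
    stays reach-here Iu = Iu
    stays (reach-step a Sw p) Iu with closed Iu a
    ... | inj₁ Iw = stays p Iw
    ... | inj₂ e = contradiction e (notS Sw)

  -- Edges of the curve are recognised by their two ends, which is right only because the curve has
  -- no chords.
  record Curve (on : V → Bool) : Set where
    field
      side : V → V → Bool
      side-φ : ∀ {u v} → u — v → side u v ≡ side v (r v u)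
      side-off : ∀ {u v} → u — v → on u ∧ on v ≡ false → side u v ≡ side v u
      side-on : ∀ {u v} → u — v → on u ∧ on v ≡ true → side v u ≡ not (side u v)

    -- Meaningful off the curve, where all darts at a vertex lie on one side; hence the arbitrary
    -- neighbour.
    sd : V → Bool
    sd v = side v (proj₁ (some-nbr v))

    side-turn : ∀ {v u} → v — u → on v ∧ on u ≡ false → side v u ≡ side v (r v u)
    side-turn a f = trans (side-off a f) (side-φ (—-sym a))

    sd-off : ∀ {v u} → on v ≡ false → v — u → side v u ≡ sd v
    sd-off {v} {u} f a with position a (proj₂ (some-nbr v))
    ... | at0 e = cong (side v) (sym e)
    ... | at1 e = trans (t a) (cong (side v) (sym e))
      where
      t : ∀ {u} → v — u → side v u ≡ side v (r v u)
      t {u} a = side-turn a (cong (_∧ on u) f)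
    ... | at2 e = trans (trans (t a) (t (r-nbr a))) (cong (side v) (sym e))
      where
      t : ∀ {u} → v — u → side v u ≡ side v (r v u)
      t {u} a = side-turn a (cong (_∧ on u) f)
    ... | at3 e = trans (trans (t a) (trans (t (r-nbr a)) (t (r²-nbr a)))) (cong (side v) (sym e))
      where
      t : ∀ {u} → v — u → side v u ≡ side v (r v u)
      t {u} a = side-turn a (cong (_∧ on u) f)

    off-off : ∀ {u v} → on u ≡ false → on v ≡ false → u — v → sd u ≡ sd v
    off-off {u} {v} f g a = trans (sym (sd-off f a)) (trans (side-off a (cong (_∧ on v) f)) (sd-off g (—-sym a)))

    on-off : ∀ {u v} → on v ≡ false → u — v → side u v ≡ sd v
    on-off {u} {v} g a = trans (side-off a (trans (cong (on u ∧_) g) (∧-zeroʳ _))) (sd-off g (—-sym a))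

    -- If no vertex of the curve but p and q had a neighbour on the side of w, these two would cut
    -- that side off from z.
    attached : ∀ {w z} p q → on w ≡ false → on z ≡ true → z ≢ p → z ≢ q →
      (∀ {v u} → on v ≡ true → v ≢ p → v ≢ q → on u ≡ false → v — u → sd u ≢ sd w) → on p ≡ true → on q ≡ true → ⊥
    attached {w} {z} p q w-off z-on z≢p z≢q none p-on q-on = two-cut I p q closed
        (∧-intro (cong not w-off) (fromWit (sd w ≟B sd w) refl)) (λ e → ne p-on e) (λ e → ne q-on e)
        (cong (λ b → not b ∧ ⌊ sd z ≟B sd w ⌋) z-on) z≢p z≢q
      where
      I : V → Bool
      I v = not (on v) ∧ ⌊ sd v ≟B sd w ⌋
      ne : ∀ {p} → on p ≡ true → w ≢ p
      ne h refl = true≢false (trans (sym h) w-off)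
      not-true : ∀ {b} → not b ≡ true → b ≡ false
      not-true {false} e = refl
      closed : ∀ {u v} → I u ≡ true → u — v → I v ≡ true ⊎ v ≡ p ⊎ v ≡ q
      closed {u} {v} t a with ∧-elim {not (on u)} t
      ... | u-off , e with on v in v-on
      ...   | false = inj₁ (fromWit (sd v ≟B sd w) (trans (sym (off-off (not-true u-off) v-on a)) (toWit (sd u ≟B sd w) e)))
      ...   | true with v ≟ p | v ≟ q
      ...     | yes e₁ | _ = inj₂ (inj₁ e₁)
      ...     | no _ | yes e₂ = inj₂ (inj₂ e₂)
      ...     | no n₁ | no n₂ = contradiction (toWit (sd u ≟B sd w) e) (none v-on n₁ n₂ (not-true u-off) (—-sym a))

    inner : V → Bool
    inner v = not (on v) ∧ sd v

    ends : V → Bool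
    ends v = xsum (λ w → adj G v w ∧ inner w)

    -- Inner vertices have even degree and edges between them count twice, so an even number of
    -- edges joins the inner side to the curve.
    even-ends : xsum (λ v → on v ∧ ends v) ≡ false
    even-ends = trans (xsum-cong split-ends) (trans (xsum-xor ends (λ v → inner v ∧ ends v)) (cong₂ _xor_ total inside))
      where
      total : xsum ends ≡ false
      total = trans (xsum-swap (λ v w → adj G v w ∧ inner w)) (xsum-false λ w → row w (inner w))
        where
        row : ∀ w b → xsum (λ v → adj G v w ∧ b) ≡ false
        row w false = xsum-false {n} {λ v → adj G v w ∧ false} (λ v → ∧-zeroʳ _)
        row w true with some-nbr w
        ... | z , a = trans (xsum-cong (λ v → cong (_∧ true) (adj-sym G v w))) (xsum-nbrs a (λ _ → true))
      inside : xsum (λ v → inner v ∧ ends v) ≡ false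
      inside = trans (xsum-cong (λ v → expand v (inner v)))
        (xsum-symmetric (λ v w → inner v ∧ (adj G v w ∧ inner w)) sym′ (λ v → trans (cong (λ b → inner v ∧ (b ∧ inner v)) (irrefl G v)) (∧-zeroʳ _)))
        where
        expand : ∀ v b → b ∧ ends v ≡ xsum (λ w → b ∧ (adj G v w ∧ inner w))
        expand v false = sym (xsum-false {n} {λ _ → false} (λ _ → refl))
        expand v true  = refl
        sym′ : ∀ v w → inner v ∧ (adj G v w ∧ inner w) ≡ inner w ∧ (adj G w v ∧ inner v)
        sym′ v w rewrite adj-sym G v w with inner v | inner w | adj G w v
        ... | false | false | _ = refl
        ... | false | true | false = refl
        ... | false | true | true = refl
        ... | true | false | false = refl
        ... | true | false | true = refl
        ... | true | true | _ = refl
      split-ends : ∀ v → on v ∧ ends v ≡ ends v xor (inner v ∧ ends v)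
      split-ends v with on v in v-on | sd v in v-sd
      ... | true | _ = sym (xor-identityʳ _)
      ... | false | true = sym (xor-same (ends v))
      ... | false | false = trans (sym (xsum-false λ w → bool-false λ t →
              let a , t′ = ∧-elim {adj G v w} t
                  w-off , w-sd = ∧-elim {not (on w)} t′
              in true≢false (trans (sym w-sd) (trans (sym (off-off v-on (not-true w-off) a)) v-sd)))) (sym (xor-identityʳ _))
        where
        not-true : ∀ {b} → not b ≡ true → b ≡ false
        not-true {false} e = refl

    -- The two curve edges are consecutive at v, so none of them separates the other two edges from
    -- each other.
    turn-sd : ∀ {v p} → v — p → on v ≡ true → on p ≡ true → on (r v p) ≡ true → on (r² v p) ≡ false → on (r³ v p) ≡ false →
      sd (r² v p) ≡ side v p × sd (r³ v p) ≡ side v p × side v (r v p) ≡ not (side v p)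
    turn-sd {v} {p} a v-on p-on q-on x-off y-off = x-sd , y-sd , flip-q
      where
      flip-q : side v (r v p) ≡ not (side v p)
      flip-q = trans (sym (side-φ (—-sym a))) (side-on a (∧-intro v-on p-on))
      x-sd : sd (r² v p) ≡ side v p
      x-sd = trans (sym (on-off x-off (r²-nbr a))) (trans (sym (side-φ (—-sym (r-nbr a)))) (trans (side-on (r-nbr a) (∧-intro v-on q-on)) (trans (cong not flip-q) (not-involutive _))))
      y-sd : sd (r³ v p) ≡ side v p
      y-sd = trans (sym (on-off y-off (r³-nbr a))) (trans (sym (side-turn (r²-nbr a) (trans (cong (on v ∧_) x-off) (∧-zeroʳ _)))) (trans (on-off x-off (r²-nbr a)) x-sd))

    -- Here a curve edge lies between the other two edges.
    straight-sd : ∀ {v p} → v — p → on v ≡ true → on p ≡ true → on (r² v p) ≡ true → on (r v p) ≡ false → on (r³ v p) ≡ false →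
      sd (r³ v p) ≡ not (sd (r v p))
    straight-sd {v} {p} a v-on p-on q-on x-off y-off = begin
      sd (r³ v p)             ≡⟨ on-off y-off (r³-nbr a) ⟨
      side v (r³ v p)         ≡⟨ side-φ (—-sym (r²-nbr a)) ⟨
      side (r² v p) v         ≡⟨ side-on (r²-nbr a) (∧-intro v-on q-on) ⟩
      not (side v (r² v p))   ≡⟨ cong not (side-turn (r-nbr a) (trans (cong (on v ∧_) x-off) (∧-zeroʳ _))) ⟨
      not (side v (r v p))    ≡⟨ cong not (on-off x-off (r-nbr a)) ⟩
      not (sd (r v p))        ∎
      where open ≡-Reasoning

  -- Around v the side changes an even number of times, and only at the two curve edges; a change
  -- across one forces a change across the other.
  propagate : (on : V → Bool) (C : V → V → Bool) → (∀ {u v} → u — v → C u v ≡ C v (r v u)) →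
    (∀ {u v} → u — v → on u ∧ on v ≡ false → C u v ≡ C v u) →
    ∀ {v p q} → v — p → v — q → p ≢ q → (∀ {w} → v — w → w ≢ p → w ≢ q → on w ≡ false) →
    C p v ≡ not (C v p) → C q v ≡ not (C v q)
  propagate on C Cφ Coff {v} {p} {q} a b p≢q others flip-p = xor-true (go (position a b))
    where
    ch : V → Bool
    ch w = C v w xor C w v
    off : ∀ {w} → v — w → w ≢ p → w ≢ q → ch w ≡ false
    off {w} c n₁ n₂ = trans (cong (C v w xor_) (sym (Coff c (trans (cong (on v ∧_) (others c n₁ n₂)) (∧-zeroʳ _))))) (xor-same (C v w))
    total : ch p xor (ch (r v p) xor (ch (r² v p) xor ch (r³ v p))) ≡ false
    total = trans (sym (xsum-nbrs a ch)) (even-changes C Cφ v)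
    p-true : ch p ≡ true
    p-true = trans (cong (C v p xor_) flip-p) (xor-not (C v p))
      where
      xor-not : ∀ b → b xor not b ≡ true
      xor-not false = refl
      xor-not true = refl
    one : ∀ {b} → true xor b ≡ false → b ≡ true
    one {true} e = refl
    total′ : ch (r v p) xor (ch (r² v p) xor ch (r³ v p)) ≡ true
    total′ = one (trans (cong (_xor (ch (r v p) xor (ch (r² v p) xor ch (r³ v p)))) (sym p-true)) total)
    go : Position v p q → ch q ≡ true
    go (at0 e) = contradiction (sym e) p≢q
    go (at1 refl) = trans (sym (xor-identityʳ _)) (trans (cong (ch (r v p) xor_) (sym (cong₂ _xor_ (off (r²-nbr a) (r²≢ a) (r≢ (r-nbr a))) (off (r³-nbr a) (r³≢ a) (r²≢ (r-nbr a)))))) total′)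
    go (at2 refl) = trans (sym (xor-identityʳ _)) (trans (sym (cong₂ (λ x y → x xor (ch (r² v p) xor y)) (off (r-nbr a) (r≢ a) (r≢ (r-nbr a) ∘ sym)) (off (r³-nbr a) (r³≢ a) (r≢ (r²-nbr a))))) total′)
    go (at3 refl) = trans (sym (cong₂ (λ x y → x xor (y xor ch (r³ v p))) (off (r-nbr a) (r≢ a) (r²≢ (r-nbr a) ∘ sym)) (off (r²-nbr a) (r²≢ a) (r≢ (r²-nbr a) ∘ sym)))) total′

  open DecMembership (_≟_ {n}) using (_∈?_) public

  abstract
    On : List V → V → Bool
    On L w = ⌊ w ∈? L ⌋

    on-in : ∀ {L w} → w ∈ L → On L w ≡ true
    on-in {L} {w} = fromWit (w ∈? L)

    on-out : ∀ {L w} → ¬ w ∈ L → On L w ≡ false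
    on-out {L} {w} = fromWit¬ (w ∈? L)

    in-on : ∀ {L w} → On L w ≡ true → w ∈ L
    in-on {L} {w} = toWit (w ∈? L)

    out-on : ∀ {L w} → On L w ≡ false → ¬ w ∈ L
    out-on f m = true≢false (trans (sym (on-in m)) f)

  xsum-On : ∀ {L} → Unique L → (f : V → Bool) → xsum (λ v → On L v ∧ f v) ≡ foldr (λ v b → f v xor b) false L
  xsum-On {[]} _ f = xsum-false {n} {λ v → On [] v ∧ f v} (λ v → cong (_∧ f v) (on-out {[]} {v} λ ()))
  xsum-On {x ∷ L} (x∉ ∷ u) f = trans (xsum-∖ g x) (cong₂ _xor_ (cong (_∧ f x) (on-in (here refl))) (trans (xsum-cong rest) (xsum-On u f)))
    where
    g : V → Bool
    g v = On (x ∷ L) v ∧ f v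
    rest : ∀ v → (g ∖ x) v ≡ On L v ∧ f v
    rest v with v ≟ x
    ... | yes refl = trans (∖-same g v) (cong (_∧ f v) (sym (on-out λ m → All.lookup x∉ m refl)))
    ... | no v≢x = trans (∖-other g v≢x) (cong (_∧ f v) (bool-eq (λ t → case in-on t of λ { (here e) → contradiction e v≢x ; (there m) → on-in m }) (on-in ∘ there ∘ in-on)))

  not-flip : ∀ {x y : Bool} → x ≡ not y → y ≡ not x
  not-flip e = trans (sym (not-involutive _)) (cong not (sym e))

  module Kinds {on : V → Bool} (c : Curve on) where
    open Curve c

    -- `even` here and `odd` in `Straight` are the contributions to `even-ends`: two further edges
    -- on one side, against one on each.
    record Turned (v p q : V) (s : Bool) : Set where
      constructor turned
      field
        orient : (q ≡ r v p × side v p ≡ s × side v q ≡ not s) ⊎ (p ≡ r v q × side v q ≡ s × side v p ≡ not s)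
        out    : ∀ {w} → v — w → on w ≡ false → sd w ≡ s
        wit    : ∃[ x ] (on x ≡ false × sd x ≡ s)
        even   : ends v ≡ false

    record Straight (v p q : V) : Set where
      constructor straight
      field
        opp      : q ≡ r² v p
        x-off    : on (r v p) ≡ false
        y-off    : on (r³ v p) ≡ false
        opposite : sd (r³ v p) ≡ not (sd (r v p))
        odd      : ends v ≡ true

    Kind : V → V → V → Set
    Kind v p q = (∃[ s ] Turned v p q s) ⊎ Straight v p q

    private
      inner-on : ∀ {w} → on w ≡ true → inner w ≡ false
      inner-on {w} e = cong (λ b → not b ∧ sd w) e
      inner-off : ∀ {w} → on w ≡ false → inner w ≡ sd w
      inner-off {w} e = cong (λ b → not b ∧ sd w) e

      turn-kind : ∀ {v p q} → v — p → v — q → on v ≡ true → on p ≡ true → on q ≡ true →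
        (∀ {w} → v — w → w ≢ p → w ≢ q → on w ≡ false) → q ≡ r v p →
        side v q ≡ not (side v p) × (∀ {w} → v — w → on w ≡ false → sd w ≡ side v p) × (∃[ x ] (on x ≡ false × sd x ≡ side v p)) × ends v ≡ false
      turn-kind {v} {p} vp vq v-on p-on q-on others refl = proj₂ (proj₂ ts) , out , (r² v p , x-off , proj₁ ts) ,
          trans (xsum-nbrs vp inner) (cong₂ _xor_ (inner-on p-on) (cong₂ _xor_ (inner-on q-on) (trans (cong₂ _xor_ (trans (inner-off x-off) (proj₁ ts)) (trans (inner-off y-off) (proj₁ (proj₂ ts)))) (xor-same (side v p)))))
        where
        x-off = others (r²-nbr vp) (r²≢ vp) (r≢ (r-nbr vp))
        y-off = others (r³-nbr vp) (r³≢ vp) (r²≢ (r-nbr vp))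
        ts = turn-sd vp v-on p-on q-on x-off y-off
        out : ∀ {w} → v — w → on w ≡ false → sd w ≡ side v p
        out vw f with position vp vw
        ... | at0 refl = contradiction (trans (sym p-on) f) true≢false
        ... | at1 refl = contradiction (trans (sym q-on) f) true≢false
        ... | at2 refl = proj₁ ts
        ... | at3 refl = proj₁ (proj₂ ts)

    kind : ∀ {v p q} → v — p → v — q → p ≢ q → on v ≡ true → on p ≡ true → on q ≡ true →
      (∀ {w} → v — w → w ≢ p → w ≢ q → on w ≡ false) → Kind v p q
    kind {v} {p} {q} vp vq p≢q v-on p-on q-on others with position vp vq
    ... | at0 e = contradiction (sym e) p≢q
    ... | at1 e = let f , o , w , ev = turn-kind vp vq v-on p-on q-on others e in inj₁ (side v p , turned (inj₁ (e , refl , f)) o w ev)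
    ... | at2 refl = inj₂ (straight refl x-off y-off opp′
          (trans (xsum-nbrs vp inner) (cong₂ _xor_ (inner-on p-on) (trans (cong₂ _xor_ (inner-off x-off) (cong₂ _xor_ (inner-on q-on) (trans (inner-off y-off) opp′))) (xor-not (sd (r v p)))))))
      where
      x-off = others (r-nbr vp) (r≢ vp) (r≢ (r-nbr vp) ∘ sym)
      y-off = others (r³-nbr vp) (r³≢ vp) (r≢ (r²-nbr vp))
      opp′ = straight-sd vp v-on p-on q-on x-off y-off
      xor-not : ∀ b → b xor not b ≡ true
      xor-not false = refl
      xor-not true = refl
    ... | at3 refl = let f , o , w , ev = turn-kind vq vp v-on q-on p-on (λ vw n₁ n₂ → others vw n₂ n₁) (sym (r⁴ vp)) in inj₁ (side v q , turned (inj₂ (sym (r⁴ vp) , refl , f)) o w ev)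

    Uniform : Bool → Set
    Uniform s = ∀ {w} → on w ≡ false → sd w ≡ s

    -- A vertex on the side other than s would be cut off by p and q, since no other curve vertex
    -- leads there.
    uniform : ∀ {s z} p q → on p ≡ true → on q ≡ true → on z ≡ true → z ≢ p → z ≢ q →
      (∀ {v u} → on v ≡ true → v ≢ p → v ≢ q → v — u → on u ≡ false → sd u ≡ s) → Uniform s
    uniform {s} p q p-on q-on z-on z≢p z≢q h {w} f with sd w ≟B s
    ... | yes e = e
    ... | no ne = ⊥-elim (attached p q f z-on z≢p z≢q (λ v-on n₁ n₂ u-off vu e → ne (trans (sym e) (h v-on n₁ n₂ vu u-off))) p-on q-on)

    not-straight : ∀ {s v p q} → Uniform s → ¬ Straight v p q
    not-straight u k = not-≢ (trans (sym (Straight.opposite k)) (trans (u (Straight.y-off k)) (sym (u (Straight.x-off k)))))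

    bool-contra : ∀ {b c : Bool} → b ≡ c → b ≡ not c → ⊥
    bool-contra e f = not-≢ (trans (sym f) e)

    -- When a single side is inhabited, every vertex turns away from the empty one, and the
    -- direction in which the face runs is handed on from vertex to vertex.
    keep⁺ : ∀ {s v p q} → Uniform s → Kind v p q → side v p ≡ s → q ≡ r v p × side v q ≡ not s
    keep⁺ u (inj₂ k) e = ⊥-elim (not-straight u k)
    keep⁺ u (inj₁ (t , turned o out (x , f , x-sd) _)) e with trans (sym x-sd) (u f)
    keep⁺ u (inj₁ (t , turned (inj₁ (a , b , c)) out _ _)) e | refl = a , c
    keep⁺ u (inj₁ (t , turned (inj₂ (a , b , c)) out _ _)) e | refl = ⊥-elim (bool-contra e c)

    keep⁻ : ∀ {s v p q} → Uniform s → Kind v p q → side v p ≡ not s → p ≡ r v q × side v q ≡ s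
    keep⁻ u (inj₂ k) e = ⊥-elim (not-straight u k)
    keep⁻ u (inj₁ (t , turned o out (x , f , x-sd) _)) e with trans (sym x-sd) (u f)
    keep⁻ u (inj₁ (t , turned (inj₁ (a , b , c)) out _ _)) e | refl = ⊥-elim (bool-contra b e)
    keep⁻ u (inj₁ (t , turned (inj₂ (a , b , c)) out _ _)) e | refl = a , b

  -- Triangles are faces

  Flips : (V → V → Bool) → V → V → Set
  Flips C u v = C v u ≡ not (C u v)

  module Triangle {a b c : V} (ab : a — b) (bc : b — c) (ca : c — a) where

    private
      L : List V
      L = a ∷ b ∷ c ∷ []
      on = On L

      a≢b = —-≢ ab
      b≢c = —-≢ bc
      c≢a = —-≢ ca

      a∈ : on a ≡ true
      a∈ = on-in (here refl)
      b∈ : on b ≡ true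
      b∈ = on-in (2nd refl)
      c∈ : on c ≡ true
      c∈ = on-in (3rd refl)

      off₃ : ∀ {w} → w ≢ a → w ≢ b → w ≢ c → on w ≡ false
      off₃ x y z = on-out λ { (here e) → x e ; (2nd e) → y e ; (3rd e) → z e }

      S = sides (λ u v → on u ∧ on v) ab (∧-intro a∈ b∈) (λ u v → ∧-comm (on u) (on v))
            (λ f h → trans (h (—-sym ca) (∧-intro a∈ c∈) λ { (inj₁ (_ , e)) → b≢c (sym e) ; (inj₂ (e , _)) → a≢b e })
                           (h (—-sym bc) (∧-intro c∈ b∈) λ { (inj₁ (e , _)) → c≢a e ; (inj₂ (e , _)) → b≢c (sym e) }))
      open Sides S using (side; side-φ; side-off; side-ab; side-ba)

      fab : Flips side a b
      fab = trans side-ba (cong not (sym side-ab))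

      fbc : Flips side c b
      fbc = not-flip (propagate on side side-φ side-off (—-sym ab) bc (c≢a ∘ sym) (λ vw p q → off₃ p (—-≢ vw ∘ sym) q) (not-flip fab))

      fca : Flips side c a
      fca = not-flip (propagate on side side-φ side-off ab (—-sym ca) b≢c (λ vw p q → off₃ (—-≢ vw ∘ sym) p q) fab)

      side-on : ∀ {u v} → u — v → on u ∧ on v ≡ true → side v u ≡ not (side u v)
      side-on {u} {v} uv t with in-on (proj₁ (∧-elim {on u} t)) | in-on (proj₂ (∧-elim {on u} t))
      ... | here refl | here refl = contradiction refl (—-≢ uv)
      ... | here refl | 2nd refl = fab
      ... | here refl | 3rd refl = not-flip fca
      ... | 2nd refl | here refl = not-flip fab
      ... | 2nd refl | 2nd refl = contradiction refl (—-≢ uv)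
      ... | 2nd refl | 3rd refl = not-flip fbc
      ... | 3rd refl | here refl = fca
      ... | 3rd refl | 2nd refl = fbc
      ... | 3rd refl | 3rd refl = contradiction refl (—-≢ uv)

      curve : Curve on
      curve = record { side = side ; side-φ = side-φ ; side-off = side-off ; side-on = side-on }

      open Curve curve using (sd; even-ends; ends)
      open Kinds curve

      ka : Kind a c b
      ka = kind (—-sym ca) ab (b≢c ∘ sym) a∈ c∈ b∈ (λ vw p q → off₃ (—-≢ vw ∘ sym) q p)
      kb : Kind b a c
      kb = kind (—-sym ab) bc (c≢a ∘ sym) b∈ a∈ c∈ (λ vw p q → off₃ p (—-≢ vw ∘ sym) q)
      kc : Kind c b a
      kc = kind (—-sym bc) ca (a≢b ∘ sym) c∈ b∈ a∈ (λ vw p q → off₃ q p (—-≢ vw ∘ sym))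

      Facial : Set
      Facial = (r b a ≡ c × r c b ≡ a × r a c ≡ b) ⊎ (r b c ≡ a × r c a ≡ b × r a b ≡ c)

      facial : ∀ {s} → Uniform s → Facial
      facial {s} u with side b a ≟B s
      ... | yes e = let b₁ , b₂ = keep⁺ u kb e
                        c₁ , c₂ = keep⁺ u kc (trans (not-flip fbc) (trans (cong not b₂) (not-involutive s)))
                        a₁ , a₂ = keep⁺ u ka (trans fca (trans (cong not c₂) (not-involutive s)))
                    in inj₁ (sym b₁ , sym c₁ , sym a₁)
      ... | no ne = let b₁ , b₂ = keep⁻ u kb (bool-not ne)
                        c₁ , c₂ = keep⁻ u kc (trans (not-flip fbc) (cong not b₂))
                        a₁ , a₂ = keep⁻ u ka (trans fca (cong not c₂))
                    in inj₂ (sym b₁ , sym c₁ , sym a₁)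

      from-turned : ∀ {v p q s} → Turned v p q s → on p ≡ true → on q ≡ true → on v ≡ true → v ≢ p → v ≢ q →
        (∀ {w} → on w ≡ true → w ≢ p → w ≢ q → w ≡ v) → Uniform s
      from-turned t p-on q-on v-on v≢p v≢q only = uniform _ _ p-on q-on v-on v≢p v≢q λ u-on n₁ n₂ ux x-off →
        Turned.out t (subst (_— _) (only u-on n₁ n₂) ux) x-off

      on₃ : ∀ {w} → on w ≡ true → w ≡ a ⊎ w ≡ b ⊎ w ≡ c
      on₃ t with in-on t
      ... | here e = inj₁ e
      ... | 2nd e = inj₂ (inj₁ e)
      ... | 3rd e = inj₂ (inj₂ e)

      odd-ends : ends a ≡ true → ends b ≡ true → ends c ≡ true → ⊥
      odd-ends x y z = true≢false (trans (sym (cong₂ _xor_ x (cong₂ _xor_ y (cong (_xor false) z)))) (trans (sym (xsum-On {L} ((a≢b ∷ (c≢a ∘ sym) ∷ []) ∷ (b≢c ∷ []) ∷ [] ∷ []) ends)) even-ends))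

    -- Three straight vertices would send an odd number of edges to the inner side. A turned vertex
    -- leaves the side without its edges attached at the other two vertices only, so that side is
    -- empty.
    triangle-facial : (r b a ≡ c × r c b ≡ a × r a c ≡ b) ⊎ (r b c ≡ a × r c a ≡ b × r a b ≡ c)
    triangle-facial with ka | kb | kc
    ... | inj₁ (_ , t) | _ | _ = facial (from-turned t c∈ b∈ a∈ (c≢a ∘ sym) a≢b λ w-on n₁ n₂ → case on₃ w-on of λ { (inj₁ e) → e ; (inj₂ (inj₁ e)) → contradiction e n₂ ; (inj₂ (inj₂ e)) → contradiction e n₁ })
    ... | inj₂ _ | inj₁ (_ , t) | _ = facial (from-turned t a∈ c∈ b∈ (a≢b ∘ sym) b≢c λ w-on n₁ n₂ → case on₃ w-on of λ { (inj₁ e) → contradiction e n₁ ; (inj₂ (inj₁ e)) → e ; (inj₂ (inj₂ e)) → contradiction e n₂ })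
    ... | inj₂ _ | inj₂ _ | inj₁ (_ , t) = facial (from-turned t b∈ a∈ c∈ (b≢c ∘ sym) c≢a λ w-on n₁ n₂ → case on₃ w-on of λ { (inj₁ e) → contradiction e n₂ ; (inj₂ (inj₁ e)) → contradiction e n₁ ; (inj₂ (inj₂ e)) → e })
    ... | inj₂ x | inj₂ y | inj₂ z = ⊥-elim (odd-ends (Straight.odd x) (Straight.odd y) (Straight.odd z))

  -- Four-cycles without chords

  FacialQuad : V → V → V → V → Set
  FacialQuad a b c d = (r b a ≡ c × r c b ≡ d × r d c ≡ a × r a d ≡ b) ⊎ (r b c ≡ a × r c d ≡ b × r d a ≡ c × r a b ≡ d)

  -- The two sides of a chordless closed curve of length four that is not a face.
  record Split (a b c d : V) : Set where
    field
      sd : V → Bool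

    Off : V → Set
    Off w = w ≢ a × w ≢ b × w ≢ c × w ≢ d

    field
      same : ∀ {u v} → u — v → Off u → Off v → sd u ≡ sd v

    Tip : V → V → V → Bool → Set
    Tip v p q s = (q ≡ r v p ⊎ p ≡ r v q) × (∀ {w} → v — w → Off w → sd w ≡ s)

    Cross : V → V → V → Set
    Cross v p q = q ≡ r² v p × Off (r v p) × Off (r³ v p) × sd (r³ v p) ≡ not (sd (r v p))

  data Shape (a b c d : V) : Set where
    facial  : FacialQuad a b c d → Shape a b c d
    tips-ac : (S : Split a b c d) → (∃[ s ] (Split.Tip S a d b s × Split.Tip S c b d (not s))) → Split.Cross S b a c → Split.Cross S d c a → Shape a b c d
    tips-ab : (S : Split a b c d) → (∃[ s ] (Split.Tip S a d b s × Split.Tip S b a c (not s))) → Split.Cross S c b d → Split.Cross S d c a → Shape a b c d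
    tips-ad : (S : Split a b c d) → (∃[ s ] (Split.Tip S a d b s × Split.Tip S d c a (not s))) → Split.Cross S b a c → Split.Cross S c b d → Shape a b c d

  module Quad {a b c d : V} (ab : a — b) (bc : b — c) (cd : c — d) (da : d — a) (a≢c : a ≢ c) (b≢d : b ≢ d)
    (no-ac : ¬ a — c) (no-bd : ¬ b — d) where

    private
      L : List V
      L = a ∷ b ∷ c ∷ d ∷ []
      on = On L

      a≢b = —-≢ ab
      b≢c = —-≢ bc
      c≢d = —-≢ cd
      d≢a = —-≢ da

      a∈ : on a ≡ true
      a∈ = on-in (here refl)
      b∈ : on b ≡ true
      b∈ = on-in (2nd refl)
      c∈ : on c ≡ true
      c∈ = on-in (3rd refl)
      d∈ : on d ≡ true
      d∈ = on-in (4th refl)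

      off₄ : ∀ {w} → w ≢ a → w ≢ b → w ≢ c → w ≢ d → on w ≡ false
      off₄ x y z t = on-out λ { (here e) → x e ; (2nd e) → y e ; (3rd e) → z e ; (4th e) → t e }

      off⁻ : ∀ {w} → on w ≡ false → w ≢ a × w ≢ b × w ≢ c × w ≢ d
      off⁻ f = (λ { refl → true≢false (trans (sym a∈) f) }) , (λ { refl → true≢false (trans (sym b∈) f) }) , (λ { refl → true≢false (trans (sym c∈) f) }) , (λ { refl → true≢false (trans (sym d∈) f) })

      on₄ : ∀ {w} → on w ≡ true → w ≡ a ⊎ w ≡ b ⊎ w ≡ c ⊎ w ≡ d
      on₄ t with in-on t
      ... | here e = inj₁ e
      ... | 2nd e = inj₂ (inj₁ e)
      ... | 3rd e = inj₂ (inj₂ (inj₁ e))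
      ... | 4th e = inj₂ (inj₂ (inj₂ e))

      oa : ∀ {w} → a — w → w ≢ d → w ≢ b → on w ≡ false
      oa vw p q = off₄ (—-≢ vw ∘ sym) q (λ { refl → no-ac vw }) p
      ob : ∀ {w} → b — w → w ≢ a → w ≢ c → on w ≡ false
      ob vw p q = off₄ p (—-≢ vw ∘ sym) q (λ { refl → no-bd vw })
      oc : ∀ {w} → c — w → w ≢ b → w ≢ d → on w ≡ false
      oc vw p q = off₄ (λ { refl → no-ac (—-sym vw) }) p (—-≢ vw ∘ sym) q
      od : ∀ {w} → d — w → w ≢ c → w ≢ a → on w ≡ false
      od vw p q = off₄ q (λ { refl → no-bd (—-sym vw) }) p (—-≢ vw ∘ sym)

      S = sides (λ u v → on u ∧ on v) ab (∧-intro a∈ b∈) (λ u v → ∧-comm (on u) (on v))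
            (λ f h → trans (h (—-sym da) (∧-intro a∈ d∈) λ { (inj₁ (_ , e)) → b≢d (sym e) ; (inj₂ (e , _)) → a≢b e })
                    (trans (h (—-sym cd) (∧-intro d∈ c∈) λ { (inj₁ (e , _)) → d≢a e ; (inj₂ (_ , e)) → a≢c (sym e) })
                           (h (—-sym bc) (∧-intro c∈ b∈) λ { (inj₁ (e , _)) → a≢c (sym e) ; (inj₂ (e , _)) → b≢c (sym e) })))
      open Sides S using (side; side-φ; side-off; side-ab; side-ba)

      fab : side b a ≡ not (side a b)
      fab = trans side-ba (cong not (sym side-ab))

      fbc : side c b ≡ not (side b c)
      fbc = propagate on side side-φ side-off (—-sym ab) bc a≢c ob (not-flip fab)

      fcd : side d c ≡ not (side c d)
      fcd = propagate on side side-φ side-off (—-sym bc) cd b≢d oc (not-flip fbc)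

      fda : side a d ≡ not (side d a)
      fda = not-flip (propagate on side side-φ side-off ab (—-sym da) b≢d (λ vw p q → oa vw q p) fab)

      side-on : ∀ {u v} → u — v → on u ∧ on v ≡ true → side v u ≡ not (side u v)
      side-on {u} {v} uv t with on₄ (proj₁ (∧-elim {on u} t)) | on₄ (proj₂ (∧-elim {on u} t))
      ... | inj₁ refl | inj₁ refl = contradiction refl (—-≢ uv)
      ... | inj₁ refl | inj₂ (inj₁ refl) = fab
      ... | inj₁ refl | inj₂ (inj₂ (inj₁ refl)) = contradiction uv no-ac
      ... | inj₁ refl | inj₂ (inj₂ (inj₂ refl)) = not-flip fda
      ... | inj₂ (inj₁ refl) | inj₁ refl = not-flip fab
      ... | inj₂ (inj₁ refl) | inj₂ (inj₁ refl) = contradiction refl (—-≢ uv)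
      ... | inj₂ (inj₁ refl) | inj₂ (inj₂ (inj₁ refl)) = fbc
      ... | inj₂ (inj₁ refl) | inj₂ (inj₂ (inj₂ refl)) = contradiction uv no-bd
      ... | inj₂ (inj₂ (inj₁ refl)) | inj₁ refl = contradiction (—-sym uv) no-ac
      ... | inj₂ (inj₂ (inj₁ refl)) | inj₂ (inj₁ refl) = not-flip fbc
      ... | inj₂ (inj₂ (inj₁ refl)) | inj₂ (inj₂ (inj₁ refl)) = contradiction refl (—-≢ uv)
      ... | inj₂ (inj₂ (inj₁ refl)) | inj₂ (inj₂ (inj₂ refl)) = fcd
      ... | inj₂ (inj₂ (inj₂ refl)) | inj₁ refl = fda
      ... | inj₂ (inj₂ (inj₂ refl)) | inj₂ (inj₁ refl) = contradiction (—-sym uv) no-bd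
      ... | inj₂ (inj₂ (inj₂ refl)) | inj₂ (inj₂ (inj₁ refl)) = not-flip fcd
      ... | inj₂ (inj₂ (inj₂ refl)) | inj₂ (inj₂ (inj₂ refl)) = contradiction refl (—-≢ uv)

      curve : Curve on
      curve = record { side = side ; side-φ = side-φ ; side-off = side-off ; side-on = side-on }

      open Curve curve using (sd; even-ends; ends; off-off)
      open Kinds curve

      ka : Kind a d b
      ka = kind (—-sym da) ab (b≢d ∘ sym) a∈ d∈ b∈ oa
      kb : Kind b a c
      kb = kind (—-sym ab) bc a≢c b∈ a∈ c∈ ob
      kc : Kind c b d
      kc = kind (—-sym bc) cd b≢d c∈ b∈ d∈ oc
      kd : Kind d c a
      kd = kind (—-sym cd) da (a≢c ∘ sym) d∈ c∈ a∈ od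

      facial′ : ∀ {s} → Uniform s → FacialQuad a b c d
      facial′ {s} u with side b a ≟B s
      ... | yes e = let b₁ , b₂ = keep⁺ u kb e
                        c₁ , c₂ = keep⁺ u kc (trans fbc (trans (cong not b₂) (not-involutive s)))
                        d₁ , d₂ = keep⁺ u kd (trans fcd (trans (cong not c₂) (not-involutive s)))
                        a₁ , a₂ = keep⁺ u ka (trans fda (trans (cong not d₂) (not-involutive s)))
                    in inj₁ (sym b₁ , sym c₁ , sym d₁ , sym a₁)
      ... | no ne = let b₁ , b₂ = keep⁻ u kb (bool-not ne)
                        c₁ , c₂ = keep⁻ u kc (trans fbc (cong not b₂))
                        d₁ , d₂ = keep⁻ u kd (trans fcd (cong not c₂))
                        a₁ , a₂ = keep⁻ u ka (trans fda (cong not d₂))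
                    in inj₂ (sym b₁ , sym c₁ , sym d₁ , sym a₁)

      -- The side opposite to s could be attached at the remaining vertices x and y only, so it is
      -- empty.
      two-turned : ∀ {u v s pu qu pv qv} x y → Turned u pu qu s → Turned v pv qv s → on u ≡ true → on x ≡ true → on y ≡ true → u ≢ x → u ≢ y →
        (∀ {w} → on w ≡ true → w ≢ x → w ≢ y → w ≡ u ⊎ w ≡ v) → FacialQuad a b c d
      two-turned x y tu tv u∈ x∈ y∈ u≢x u≢y only = facial′ (uniform x y x∈ y∈ u∈ u≢x u≢y λ w∈ n₁ n₂ wz z-off → case only w∈ n₁ n₂ of λ where
        (inj₁ refl) → Turned.out tu wz z-off
        (inj₂ refl) → Turned.out tv wz z-off)

      parity : ends a xor (ends b xor (ends c xor ends d)) ≡ false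
      parity = trans (cong (λ z → ends a xor (ends b xor (ends c xor z))) (sym (xor-identityʳ _)))
        (trans (sym (xsum-On {L} ((a≢b ∷ a≢c ∷ (d≢a ∘ sym) ∷ []) ∷ (b≢c ∷ b≢d ∷ []) ∷ (c≢d ∷ []) ∷ [] ∷ []) ends)) even-ends)

      fab-f : ∀ {s t} → Turned a d b s → Turned b a c t → s ≡ t → FacialQuad a b c d
      fab-f x y refl = two-turned c d x y a∈ c∈ d∈ a≢c (d≢a ∘ sym) λ w∈ n₁ n₂ → case on₄ w∈ of λ { (inj₁ e) → inj₁ e ; (inj₂ (inj₁ e)) → inj₂ e ; (inj₂ (inj₂ (inj₁ e))) → contradiction e n₁ ; (inj₂ (inj₂ (inj₂ e))) → contradiction e n₂ }
      fac-f : ∀ {s t} → Turned a d b s → Turned c b d t → s ≡ t → FacialQuad a b c d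
      fac-f x y refl = two-turned b d x y a∈ b∈ d∈ a≢b (d≢a ∘ sym) λ w∈ n₁ n₂ → case on₄ w∈ of λ { (inj₁ e) → inj₁ e ; (inj₂ (inj₁ e)) → contradiction e n₁ ; (inj₂ (inj₂ (inj₁ e))) → inj₂ e ; (inj₂ (inj₂ (inj₂ e))) → contradiction e n₂ }
      fad-f : ∀ {s t} → Turned a d b s → Turned d c a t → s ≡ t → FacialQuad a b c d
      fad-f x y refl = two-turned b c x y a∈ b∈ c∈ a≢b a≢c λ w∈ n₁ n₂ → case on₄ w∈ of λ { (inj₁ e) → inj₁ e ; (inj₂ (inj₁ e)) → contradiction e n₁ ; (inj₂ (inj₂ (inj₁ e))) → contradiction e n₂ ; (inj₂ (inj₂ (inj₂ e))) → inj₂ e }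
      fbc-f : ∀ {s t} → Turned b a c s → Turned c b d t → s ≡ t → FacialQuad a b c d
      fbc-f x y refl = two-turned a d x y b∈ a∈ d∈ (a≢b ∘ sym) b≢d λ w∈ n₁ n₂ → case on₄ w∈ of λ { (inj₁ e) → contradiction e n₁ ; (inj₂ (inj₁ e)) → inj₁ e ; (inj₂ (inj₂ (inj₁ e))) → inj₂ e ; (inj₂ (inj₂ (inj₂ e))) → contradiction e n₂ }
      fbd-f : ∀ {s t} → Turned b a c s → Turned d c a t → s ≡ t → FacialQuad a b c d
      fbd-f x y refl = two-turned a c x y b∈ a∈ c∈ (a≢b ∘ sym) b≢c λ w∈ n₁ n₂ → case on₄ w∈ of λ { (inj₁ e) → contradiction e n₁ ; (inj₂ (inj₁ e)) → inj₁ e ; (inj₂ (inj₂ (inj₁ e))) → contradiction e n₂ ; (inj₂ (inj₂ (inj₂ e))) → inj₂ e }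
      fcd-f : ∀ {s t} → Turned c b d s → Turned d c a t → s ≡ t → FacialQuad a b c d
      fcd-f x y refl = two-turned a b x y c∈ a∈ b∈ (a≢c ∘ sym) (b≢c ∘ sym) λ w∈ n₁ n₂ → case on₄ w∈ of λ { (inj₁ e) → contradiction e n₁ ; (inj₂ (inj₁ e)) → contradiction e n₂ ; (inj₂ (inj₂ (inj₁ e))) → inj₁ e ; (inj₂ (inj₂ (inj₂ e))) → inj₂ e }

      split : Split a b c d
      split = record { sd = sd ; same = λ uv (p₁ , p₂ , p₃ , p₄) (q₁ , q₂ , q₃ , q₄) → off-off (off₄ p₁ p₂ p₃ p₄) (off₄ q₁ q₂ q₃ q₄) uv }

      tip : ∀ {v p q s} → Turned v p q s → Split.Tip split v p q s
      tip (turned o out _ _) = (case o of λ { (inj₁ (e , _)) → inj₁ e ; (inj₂ (e , _)) → inj₂ e }) , λ vw (p₁ , p₂ , p₃ , p₄) → out vw (off₄ p₁ p₂ p₃ p₄)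

      cross : ∀ {v p q} → Straight v p q → Split.Cross split v p q
      cross (straight e x y o _) = e , off⁻ x , off⁻ y , o

      neg : ∀ {v p q s t} → s ≢ t → Turned v p q t → Turned v p q (not s)
      neg {s = s} {t} ne k = subst (Turned _ _ _) (bool-not (ne ∘ sym)) k

      third : ∀ {s t : Bool} → s ≢ t → ∀ u → u ≡ s ⊎ u ≡ t
      third {false} {false} ne u = contradiction refl ne
      third {false} {true} ne false = inj₁ refl
      third {false} {true} ne true = inj₂ refl
      third {true} {false} ne false = inj₂ refl
      third {true} {false} ne true = inj₁ refl
      third {true} {true} ne u = contradiction refl ne

    -- By parity the number of turned vertices is even, and two turned to the same side make the
    -- cycle a face. Among three or four turned ones two must agree, so otherwise exactly two are
    -- turned, to opposite sides.
    shape : b ≢ r² a d → Shape a b c d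
    shape ns with ka | kb | kc | kd
    ... | inj₂ k | _ | _ | _ = contradiction (Straight.opp k) ns
    ... | inj₁ (s , x) | inj₂ y | inj₂ z | inj₂ w = contradiction (trans (sym (cong₂ _xor_ (Turned.even x) (cong₂ _xor_ (Straight.odd y) (cong₂ _xor_ (Straight.odd z) (Straight.odd w))))) parity) true≢false
    ... | inj₁ (s , x) | inj₁ (t , y) | kc′ | kd′ with s ≟B t
    ...   | yes e = facial (fab-f x y e)
    ...   | no ne with kc′ | kd′
    ...     | inj₂ z | inj₂ w = tips-ab split (s , tip x , tip (neg ne y)) (cross z) (cross w)
    ...     | inj₁ (u , z) | _ = case third ne u of λ { (inj₁ e) → facial (fac-f x z (sym e)) ; (inj₂ e) → facial (fbc-f y z (sym e)) }
    ...     | inj₂ z | inj₁ (u , w) = case third ne u of λ { (inj₁ e) → facial (fad-f x w (sym e)) ; (inj₂ e) → facial (fbd-f y w (sym e)) }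
    shape ns | inj₁ (s , x) | inj₂ y | inj₁ (t , z) | kd′ with s ≟B t
    ...   | yes e = facial (fac-f x z e)
    ...   | no ne with kd′
    ...     | inj₂ w = tips-ac split (s , tip x , tip (neg ne z)) (cross y) (cross w)
    ...     | inj₁ (u , w) = case third ne u of λ { (inj₁ e) → facial (fad-f x w (sym e)) ; (inj₂ e) → facial (fcd-f z w (sym e)) }
    shape ns | inj₁ (s , x) | inj₂ y | inj₂ z | inj₁ (t , w) with s ≟B t
    ...   | yes e = facial (fad-f x w e)
    ...   | no ne = tips-ad split (s , tip x , tip (neg ne w)) (cross y) (cross z)

    private
      not-turned : ∀ {v p q s} → Turned v p q s → v — p → v — q → q ≢ r² v p
      not-turned t vp vq refl = case Turned.orient t of λ { (inj₁ (e , _)) → r≢ (r-nbr vp) e ; (inj₂ (e , _)) → r³≢ vp (sym e) }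

    -- By parity the fourth vertex cannot be turned when three are straight.
    ring-split : b ≡ r² a d → c ≡ r² b a → d ≡ r² c b → Σ (Split a b c d) λ S → Split.Cross S a d b × Split.Cross S b a c × Split.Cross S c b d × Split.Cross S d c a
    ring-split ea eb ec with ka | kb | kc | kd
    ... | inj₂ x | inj₂ y | inj₂ z | inj₂ w = split , cross x , cross y , cross z , cross w
    ... | inj₂ x | inj₂ y | inj₂ z | inj₁ (_ , w) = contradiction (trans (sym (cong₂ _xor_ (Straight.odd x) (cong₂ _xor_ (Straight.odd y) (cong₂ _xor_ (Straight.odd z) (Turned.even w))))) parity) true≢false
    ... | inj₁ (_ , t) | _ | _ | _ = ⊥-elim (not-turned t (—-sym da) ab ea)
    ... | inj₂ _ | inj₁ (_ , t) | _ | _ = ⊥-elim (not-turned t (—-sym ab) bc eb)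
    ... | inj₂ _ | inj₂ _ | inj₁ (_ , t) | _ = ⊥-elim (not-turned t (—-sym bc) cd ec)

  -- Consecutive and opposite neighbours, corners of four-cycles

  r²-sym : ∀ {v p q} → v — p → q ≡ r² v p → p ≡ r² v q
  r²-sym vp refl = sym (r⁴ vp)

  r-r² : ∀ {v p} → v — p → r v p ≢ r² v p
  r-r² vp e = r≢ (r-nbr vp) (sym e)

  Next : V → V → V → Set
  Next v p q = q ≡ r v p ⊎ p ≡ r v q

  Next-sym : ∀ {v p q} → Next v p q → Next v q p
  Next-sym (inj₁ e) = inj₂ e
  Next-sym (inj₂ e) = inj₁ e

  Next-¬opp : ∀ {v p q} → v — p → v — q → Next v p q → q ≢ r² v p
  Next-¬opp vp vq (inj₁ e) f = r-r² vp (trans (sym e) f)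
  Next-¬opp vp vq (inj₂ refl) f = r³≢ vq (sym f)

  ¬opp-Next : ∀ {v p q} → v — p → v — q → p ≢ q → q ≢ r² v p → Next v p q
  ¬opp-Next vp vq p≢q h with position vp vq
  ... | at0 e = contradiction (sym e) p≢q
  ... | at1 e = inj₁ e
  ... | at2 e = contradiction e h
  ... | at3 refl = inj₂ (sym (r⁴ vp))

  Next-Next : ∀ {v p q s} → v — p → v — q → v — s → Next v p q → Next v q s → p ≢ s → s ≡ r² v p
  Next-Next vp vq vs (inj₁ refl) (inj₁ e) n = e
  Next-Next vp vq vs (inj₁ e) (inj₂ f) n = contradiction (r-inj vp vs (trans (sym e) f)) n
  Next-Next vp vq vs (inj₂ e) (inj₁ f) n = contradiction (trans e (sym f)) n
  Next-Next vp vq vs (inj₂ refl) (inj₂ refl) n = r²-sym vs refl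

  triangle-next : ∀ {a b c} → a — b → b — c → c — a → Next b a c
  triangle-next ab bc ca with Triangle.triangle-facial ab bc ca
  ... | inj₁ (e , _) = inj₁ (sym e)
  ... | inj₂ (e , _) = inj₂ (sym e)

  -- The two triangles on the chord uw are faces, so at u both x and y are consecutive to w, one on
  -- either side of it.
  diamond-opp : ∀ {x u y w} → x — u → u — y → y — w → w — x → x ≢ y → u — w → y ≡ r² u x
  diamond-opp xu uy yw wx x≢y uw = Next-Next (—-sym xu) uw uy (triangle-next xu uw wx) (triangle-next (—-sym uw) uy yw) x≢y

  -- Four-cycles x u y w turning at x
  data TipShape (x u y w : V) : Set where
    facial  : FacialQuad x u y w → TipShape x u y w
    diamond : u — w → y ≡ r² u x → y ≡ r² w x → TipShape x u y w
    tips-xy : ¬ x — y → ¬ u — w → (S : Split x u y w) → (∃[ s ] (Split.Tip S x w u s × Split.Tip S y u w (not s))) → Split.Cross S u x y → Split.Cross S w y x → TipShape x u y w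
    tips-xu : ¬ x — y → ¬ u — w → (S : Split x u y w) → (∃[ s ] (Split.Tip S x w u s × Split.Tip S u x y (not s))) → Split.Cross S y u w → Split.Cross S w y x → TipShape x u y w
    tips-xw : ¬ x — y → ¬ u — w → (S : Split x u y w) → (∃[ s ] (Split.Tip S x w u s × Split.Tip S w y x (not s))) → Split.Cross S u x y → Split.Cross S y u w → TipShape x u y w

  adj? : ∀ u v → Dec (u — v)
  adj? u v = adj G u v ≟B true

  -- A chord xy would, by `diamond-opp`, make u and w opposite at x. A chord uw gives the diamond,
  -- and without chords `Quad.shape` applies.
  tip-shape : ∀ {x u y w} → x — u → u — y → y — w → w — x → x ≢ y → u ≢ w → Next x u w → TipShape x u y w
  tip-shape {x} {u} {y} {w} xu uy yw wx x≢y u≢w nx with adj? u w | adj? x y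
  ... | yes uw | _ = diamond uw (diamond-opp xu uy yw wx x≢y uw) (diamond-opp (—-sym wx) (—-sym yw) (—-sym uy) (—-sym xu) x≢y (—-sym uw))
  ... | no _ | yes xy = contradiction (diamond-opp (—-sym xu) (—-sym wx) (—-sym yw) (—-sym uy) u≢w xy) (Next-¬opp xu (—-sym wx) nx)
  ... | no no-uw | no no-xy with Quad.shape xu uy yw wx x≢y u≢w no-xy no-uw (Next-¬opp (—-sym wx) xu (Next-sym nx))
  ...   | facial f = facial f
  ...   | tips-ac S t p q = tips-xy no-xy no-uw S t p q
  ...   | tips-ab S t p q = tips-xu no-xy no-uw S t p q
  ...   | tips-ad S t p q = tips-xw no-xy no-uw S t p q

  -- Transition systems and their trails

  -- A vertex is either passed straight (nothing) or turned: just a pairs a with its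
  -- successor in the rotation, and the two remaining neighbours.
  State : Set
  State = V → Maybe V

  Valid : State → Set
  Valid σ = ∀ {v a} → σ v ≡ just a → v — a

  -- The two vertices a and r² v a name the same turn.
  pair : V → Maybe V → V → V
  pair v nothing u = r² v u
  pair v (just a) u = if ⌊ u ≟ a ⌋ ∨ ⌊ u ≟ r² v a ⌋ then r v u else r³ v u

  τ : State → V → V → V
  τ σ v = pair v (σ v)

  pair-a : ∀ {v} a → pair v (just a) a ≡ r v a
  pair-a {v} a rewrite fromWit (a ≟ a) refl = refl

  pair-r² : ∀ {v} a → pair v (just a) (r² v a) ≡ r³ v a
  pair-r² {v} a rewrite fromWit (r² v a ≟ r² v a) refl | ∨-zeroʳ ⌊ r² v a ≟ a ⌋ = refl

  pair-r : ∀ {v a} → v — a → pair v (just a) (r v a) ≡ a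
  pair-r {v} {a} va rewrite fromWit¬ (r v a ≟ a) (r≢ va) | fromWit¬ (r v a ≟ r² v a) (r-r² va) = r⁴ va

  pair-r³ : ∀ {v a} → v — a → pair v (just a) (r³ v a) ≡ r² v a
  pair-r³ {v} {a} va rewrite fromWit¬ (r³ v a ≟ a) (r³≢ va) | fromWit¬ (r³ v a ≟ r² v a) (r≢ (r²-nbr va)) = r⁴ (r²-nbr va)

  data TurnAt (v a u : V) : Set where
    t0 : u ≡ a → pair v (just a) u ≡ r v a → TurnAt v a u
    t1 : u ≡ r v a → pair v (just a) u ≡ a → TurnAt v a u
    t2 : u ≡ r² v a → pair v (just a) u ≡ r³ v a → TurnAt v a u
    t3 : u ≡ r³ v a → pair v (just a) u ≡ r² v a → TurnAt v a u

  turnAt : ∀ {v a u} → v — a → v — u → TurnAt v a u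
  turnAt {v} {a} va vu with position va vu
  ... | at0 refl = t0 refl (pair-a a)
  ... | at1 refl = t1 refl (pair-r va)
  ... | at2 refl = t2 refl (pair-r² a)
  ... | at3 refl = t3 refl (pair-r³ va)

  pair-next : ∀ {v a u} → v — a → v — u → Next v u (pair v (just a) u)
  pair-next {v} {a} {u} va vu with turnAt va vu
  ... | t0 refl e = inj₁ e
  ... | t1 refl e = inj₂ (cong (r v) (sym e))
  ... | t2 refl e = inj₁ e
  ... | t3 refl e = inj₂ (cong (r v) (sym e))

  τ-nbr : ∀ {σ} → Valid σ → ∀ {v u} → v — u → v — τ σ v u
  τ-nbr {σ} ok {v} {u} vu with σ v in eq
  ... | nothing = r²-nbr vu
  ... | just a with turnAt (ok eq) vu
  ...   | t0 _ e = subst (v —_) (sym e) (r-nbr (ok eq))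
  ...   | t1 _ e = subst (v —_) (sym e) (ok eq)
  ...   | t2 _ e = subst (v —_) (sym e) (r³-nbr (ok eq))
  ...   | t3 _ e = subst (v —_) (sym e) (r²-nbr (ok eq))

  τ-inv : ∀ {σ} → Valid σ → ∀ {v u} → v — u → τ σ v (τ σ v u) ≡ u
  τ-inv {σ} ok {v} {u} vu with σ v in eq
  ... | nothing = r⁴ vu
  ... | just a with turnAt (ok eq) vu
  ...   | t0 refl e = trans (cong (pair v (just a)) e) (pair-r (ok eq))
  ...   | t1 refl e = trans (cong (pair v (just a)) e) (pair-a a)
  ...   | t2 refl e = trans (cong (pair v (just a)) e) (pair-r³ (ok eq))
  ...   | t3 refl e = trans (cong (pair v (just a)) e) (pair-r² a)

  τ-≢ : ∀ {σ} → Valid σ → ∀ {v u} → v — u → τ σ v u ≢ u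
  τ-≢ {σ} ok {v} {u} vu with σ v in eq
  ... | nothing = r²≢ vu
  ... | just a with turnAt (ok eq) vu
  ...   | t0 refl e = λ h → r≢ (ok eq) (trans (sym e) h)
  ...   | t1 refl e = λ h → r≢ (ok eq) (sym (trans (sym e) h))
  ...   | t2 refl e = λ h → r≢ (r²-nbr (ok eq)) (trans (sym e) h)
  ...   | t3 refl e = λ h → r≢ (r²-nbr (ok eq)) (sym (trans (sym e) h))

  τ-straight : ∀ {σ v} → σ v ≡ nothing → ∀ u → τ σ v u ≡ r² v u
  τ-straight {σ} {v} e u rewrite e = refl

  -- The components of a transition system, or of the part of it that only
  -- passes through the vertices selected by act.

  links : (V → Bool) → State → List (D × D)
  links act σ = map flip (pairs (adj G)) ++ map (λ (v , u) → (v , u) , (v , τ σ v u)) (pairs (λ v u → act v ∧ adj G v u))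

  rep : (V → Bool) → State → D → D
  rep act σ = UD.joins (λ d → d) (links act σ)

  rep-flip : ∀ act σ {u v} → u — v → rep act σ (u , v) ≡ rep act σ (v , u)
  rep-flip act σ uv = UD.joins-glue (λ d → d) (links act σ) (∈-++⁺ˡ (∈-map⁺ flip (∈-pairs {p = adj G} uv)))

  rep-link : ∀ act σ {v u} → act v ≡ true → v — u → rep act σ (v , u) ≡ rep act σ (v , τ σ v u)
  rep-link act σ a vu = UD.joins-glue (λ d → d) (links act σ) (∈-++⁺ʳ (map flip (pairs (adj G))) (∈-map⁺ (λ (v , u) → (v , u) , (v , τ σ v u)) (∈-pairs {p = λ v u → act v ∧ adj G v u} (∧-intro a vu))))

  rep-across : ∀ act σ {u v w} → act v ≡ true → σ v ≡ nothing → u — v → v — w → w ≡ r² v u → rep act σ (u , v) ≡ rep act σ (w , v)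
  rep-across act σ {v = v} a s uv vw h = trans (rep-flip act σ uv) (trans (rep-link act σ a (—-sym uv))
    (trans (cong (λ k → rep act σ (v , k)) (trans (τ-straight {σ} s _) (sym h))) (rep-flip act σ vw)))

  -- The universal property of the classes: whatever is invariant under reversing darts and under
  -- the active transitions is constant on trails.
  rep-elim : ∀ act σ {B : Set} (f : D → B) → (∀ {u v} → u — v → f (u , v) ≡ f (v , u)) →
    (∀ {v u} → act v ≡ true → v — u → f (v , u) ≡ f (v , τ σ v u)) →
    ∀ {d e} → rep act σ d ≡ rep act σ e → f d ≡ f e
  rep-elim act σ f hf hl {d} {e} eq = trans (sym (resp d)) (trans (cong f eq) (resp e))
    where
    member : ∀ {d e} → (d , e) ∈ links act σ → f d ≡ f e
    member m with ∈-++⁻ (map flip (pairs (adj G))) m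
    ... | inj₁ m₁ with ∈-map⁻ flip m₁
    ...   | (u , v) , k , refl = hf (∈-pairs⁻ {p = adj G} k)
    member m | inj₂ m₂ with ∈-map⁻ (λ (v , u) → (v , u) , (v , τ σ v u)) m₂
    ...   | (v , u) , k , refl = let a , vu = ∧-elim (∈-pairs⁻ {p = λ v u → act v ∧ adj G v u} k) in hl a vu
    resp : UD.Respects f (rep act σ)
    resp = UD.joins-respects (links act σ) member (λ _ → refl)

  every : V → Bool
  every _ = true

  infix 4 _⊢_≈_
  _⊢_≈_ : State → D → D → Set
  σ ⊢ d ≈ e = rep every σ d ≡ rep every σ e

  ≈? : ∀ σ d e → Dec (σ ⊢ d ≈ e)
  ≈? σ d e = rep every σ d ≟D rep every σ e

  Mono : State → V → Set
  Mono σ v = ∀ {u w} → v — u → v — w → σ ⊢ (v , u) ≈ (v , w)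

  rep-weaken : ∀ act σ {d e} → rep act σ d ≡ rep act σ e → σ ⊢ d ≈ e
  rep-weaken act σ = rep-elim act σ (rep every σ) (rep-flip every σ) (λ _ → rep-link every σ refl)

  -- Changing transitions at vertices all of whose edges end up in one component
  -- can only merge components.
  patch : ∀ (X : V → Bool) σ σ′ → (∀ {v} → X v ≡ false → σ′ v ≡ σ v) →
    (∀ {v u} → X v ≡ true → v — u → σ′ ⊢ (v , u) ≈ (v , τ σ v u)) →
    ∀ {d e} → σ ⊢ d ≈ e → σ′ ⊢ d ≈ e
  patch X σ σ′ agree glue = rep-elim every σ (rep every σ′) (rep-flip every σ′) link
    where
    link : ∀ {v u} → true ≡ true → v — u → σ′ ⊢ (v , u) ≈ (v , τ σ v u)
    link {v} {u} _ vu with X v in eq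
    ... | true = glue eq vu
    ... | false = trans (rep-link every σ′ refl vu) (cong (λ w → rep every σ′ (v , w)) (cong (λ s → pair v s u) (agree eq)))

  -- Pieces of trail that use no transition at X survive any change made there.
  partial : ∀ (X : V → Bool) σ σ′ → (∀ {v} → X v ≡ false → σ′ v ≡ σ v) →
    ∀ {d e} → rep (not ∘ X) σ d ≡ rep (not ∘ X) σ e → σ′ ⊢ d ≈ e
  partial X σ σ′ agree = rep-elim (not ∘ X) σ (rep every σ′) (rep-flip every σ′) link
    where
    link : ∀ {v u} → not (X v) ≡ true → v — u → σ′ ⊢ (v , u) ≈ (v , τ σ v u)
    link {v} {u} a vu with X v in eq
    ... | false = trans (rep-link every σ′ refl vu) (cong (λ w → rep every σ′ (v , w)) (cong (λ s → pair v s u) (agree eq)))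

  -- The number of edge ends of a class at the vertices of X is even.
  module Ends (X : V → Bool) (σ : State) (ok : Valid σ) (d : D) where

    K : V → V → Bool
    K v u = ⌊ rep (not ∘ X) σ (v , u) ≟D rep (not ∘ X) σ d ⌋

    K-true : ∀ {v u} → K v u ≡ true → rep (not ∘ X) σ (v , u) ≡ rep (not ∘ X) σ d
    K-true {v} {u} = toWit (rep (not ∘ X) σ (v , u) ≟D rep (not ∘ X) σ d)

    K-cong : ∀ {v u v′ u′} → rep (not ∘ X) σ (v , u) ≡ rep (not ∘ X) σ (v′ , u′) → K v u ≡ K v′ u′
    K-cong e = ⌊⌋-cong (_ ≟D _) (_ ≟D _) (trans (sym e)) (trans e)

    row : V → Bool
    row v = xsum (λ u → adj G v u ∧ K v u)

    row-at : ∀ {v u} → v — u → row v ≡ K v u xor (K v (r v u) xor (K v (r² v u) xor K v (r³ v u)))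
    row-at {v} vu = xsum-nbrs vu (K v)

    private
      total : xsum row ≡ false
      total = xsum-symmetric (λ v u → adj G v u ∧ K v u) s (λ v → cong (_∧ K v v) (irrefl G v))
        where
        s : ∀ u v → adj G u v ∧ K u v ≡ adj G v u ∧ K v u
        s u v with adj G u v in eq
        ... | false = sym (cong (_∧ K v u) (trans (adj-sym G v u) eq))
        ... | true = trans (K-cong (rep-flip (not ∘ X) σ eq)) (sym (cong (_∧ K v u) (trans (adj-sym G v u) eq)))

      active : ∀ {v} → X v ≡ false → row v ≡ false
      active {v} Xv = go (σ v) refl
        where
        link : ∀ {w} → v — w → K v w ≡ K v (τ σ v w)
        link vw = K-cong (rep-link (not ∘ X) σ (cong not Xv) vw)
        two : ∀ {x y z w} → x ≡ z → y ≡ w → x xor (y xor (z xor w)) ≡ false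
        two {x} {y} refl refl = trans (cong (x xor_) (trans (cong (y xor_) (xor-comm x y)) (trans (sym (xor-assoc y y x)) (cong (_xor x) (xor-same y))))) (xor-same x)
        adjacent : ∀ {x y z w} → x ≡ y → z ≡ w → x xor (y xor (z xor w)) ≡ false
        adjacent {x} {z = z} refl refl = trans (sym (xor-assoc x x _)) (trans (cong (_xor (z xor z)) (xor-same x)) (xor-same z))
        at : ∀ {w z s} → σ v ≡ s → v — w → pair v s w ≡ z → K v w ≡ K v z
        at {w} refl vw e = trans (link vw) (cong (K v) e)
        go : ∀ s → σ v ≡ s → row v ≡ false
        go nothing e = let u , a = some-nbr v in trans (row-at a) (two (at e a refl) (at e (r-nbr a) refl))
        go (just b) e = trans (row-at (ok e)) (adjacent (at e (ok e) (pair-a b)) (at e (r²-nbr (ok e)) (pair-r² b)))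

    -- Every edge has two ends, and off X the transitions pair the ends of the class; so the ends at
    -- X are even in number.
    even-rows : ∀ {L} → Unique L → (∀ {v} → X v ≡ true → v ∈ L) → foldr (λ v b → row v xor b) false L ≡ false
    even-rows {L} uL cover = trans (sym (xsum-On uL row)) (trans (xsum-cong same) total)
      where
      same : ∀ v → On L v ∧ row v ≡ row v
      same v with On L v in eq
      ... | true = refl
      ... | false = sym (active (bool-false λ t → out-on eq (cover t)))

  _[_≔_] : State → V → V → State
  (σ [ x ≔ a ]) v = if ⌊ v ≟ x ⌋ then just a else σ v

  ≔-at : ∀ {σ x a} → (σ [ x ≔ a ]) x ≡ just a
  ≔-at {x = x} rewrite fromWit (x ≟ x) refl = refl

  ≔-other : ∀ {σ x a v} → v ≢ x → (σ [ x ≔ a ]) v ≡ σ v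
  ≔-other {x = x} {v = v} h rewrite fromWit¬ (v ≟ x) h = refl

  ≔-valid : ∀ {σ x a} → Valid σ → x — a → Valid (σ [ x ≔ a ])
  ≔-valid {σ} {x} ok xa {v} e with v ≟ x
  ... | yes refl = subst (x —_) (just-injective e) xa
  ... | no _ = ok e

  -- Short closed subtrails

  Bad₃ : State → V → V → V → Set
  Bad₃ σ a b c = (a — b × b — c × c — a) × τ σ a c ≡ b × τ σ b a ≡ c

  -- As in `Bad₃`, the transition at the last vertex is left open, because the subtrail starts and
  -- ends there.
  Bad₄ : State → V → V → V → V → Set
  Bad₄ σ a b c d = (a — b × b — c × c — d × d — a × a ≢ c × b ≢ d) × τ σ a d ≡ b × τ σ b a ≡ c × τ σ c b ≡ d

  record Good (σ : State) : Set where
    field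
      good₃ : ∀ {a b c} → ¬ Bad₃ σ a b c
      good₄ : ∀ {a b c d} → ¬ Bad₄ σ a b c d

  -- A corner u x w whose use at x would close a short subtrail
  data Blocked (σ : State) (x u w : V) : Set where
    b₃   : u — w → τ σ u x ≡ w ⊎ τ σ w x ≡ u → Blocked σ x u w
    b-uy : ∀ y → u — y → y — w → y ≢ x → τ σ u x ≡ y → τ σ y u ≡ w → Blocked σ x u w
    b-yw : ∀ y → u — y → y — w → y ≢ x → τ σ w x ≡ y → τ σ y w ≡ u → Blocked σ x u w
    b-uw : ∀ y → u — y → y — w → y ≢ x → τ σ u x ≡ y → τ σ w x ≡ y → Blocked σ x u w

  Blocked-sym : ∀ {σ x u w} → Blocked σ x u w → Blocked σ x w u
  Blocked-sym (b₃ uw (inj₁ e)) = b₃ (—-sym uw) (inj₂ e)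
  Blocked-sym (b₃ uw (inj₂ e)) = b₃ (—-sym uw) (inj₁ e)
  Blocked-sym (b-uy y uy yw n e f) = b-yw y (—-sym yw) (—-sym uy) n e f
  Blocked-sym (b-yw y uy yw n e f) = b-uy y (—-sym yw) (—-sym uy) n e f
  Blocked-sym (b-uw y uy yw n e f) = b-uw y (—-sym yw) (—-sym uy) n f e

  τ-swap : ∀ {σ} → Valid σ → ∀ {v u w} → v — u → τ σ v u ≡ w → τ σ v w ≡ u
  τ-swap {σ} ok {v} vu refl = τ-inv ok vu

  Unblocked : State → V → Set
  Unblocked σ v = ∀ {u} → v — u → ¬ Blocked σ v u (τ σ v u)

  -- A new short subtrail would pass through a changed vertex, and the rest of it would block that
  -- corner. The vertex where it starts may change freely.
  bad₃-unchanged : ∀ {σ σ′} → Valid σ′ → (∀ v → σ′ v ≡ σ v ⊎ Unblocked σ′ v) → ∀ {a b c} → Bad₃ σ′ a b c → Bad₃ σ a b c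
  bad₃-unchanged {σ} {σ′} ok h {a} {b} {c} (adj@(ab , bc , ca) , e , f) with h a | h b
  ... | inj₂ u | _ = contradiction (subst (Blocked σ′ a c) (sym e) (b₃ (—-sym bc) (inj₂ f))) (u (—-sym ca))
  ... | inj₁ _ | inj₂ u = contradiction (subst (Blocked σ′ b a) (sym f) (b₃ (—-sym ca) (inj₁ (τ-swap ok (—-sym ca) e)))) (u (—-sym ab))
  ... | inj₁ p | inj₁ q = adj , trans (cong (λ s → pair a s c) (sym p)) e , trans (cong (λ s → pair b s a) (sym q)) f

  -- The equations at the three inner vertices serve later, when a surviving subtrail has to be
  -- recognised as a ring.
  bad₄-unchanged : ∀ {σ σ′} → Valid σ′ → (∀ v → σ′ v ≡ σ v ⊎ Unblocked σ′ v) → ∀ {a b c d} → Bad₄ σ′ a b c d →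
    Bad₄ σ a b c d × σ′ a ≡ σ a × σ′ b ≡ σ b × σ′ c ≡ σ c
  bad₄-unchanged {σ} {σ′} ok h {a} {b} {c} {d} (adj@(ab , bc , cd , da , a≢c , b≢d) , e , f , g) with h a | h b | h c
  ... | inj₂ u | _ | _ = contradiction (subst (Blocked σ′ a d) (sym e) (b-yw c (—-sym cd) (—-sym bc) (a≢c ∘ sym) f g)) (u (—-sym da))
  ... | inj₁ _ | inj₂ u | _ = contradiction (subst (Blocked σ′ b a) (sym f) (b-uw d (—-sym da) (—-sym cd) (b≢d ∘ sym) (τ-swap ok (—-sym da) e) g)) (u (—-sym ab))
  ... | inj₁ _ | inj₁ _ | inj₂ u = contradiction (subst (Blocked σ′ c b) (sym g) (b-uy a (—-sym ab) (—-sym da) a≢c (τ-swap ok (—-sym ab) f) (τ-swap ok (—-sym da) e))) (u (—-sym bc))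
  ... | inj₁ p | inj₁ q | inj₁ s = (adj , trans (cong (λ s → pair a s d) (sym p)) e , trans (cong (λ s → pair b s a) (sym q)) f , trans (cong (λ z → pair c z b) (sym s)) g) , p , q , s

  module _ {σ : State} {x a : V} where

    private
      σ′ = σ [ x ≔ a ]

    τ-other : ∀ {v u} → v ≢ x → τ σ′ v u ≡ τ σ v u
    τ-other {v} {u} h = cong (λ s → pair v s u) (≔-other {σ} {x} {a} h)

    τ-at : ∀ {u} → τ σ′ x u ≡ pair x (just a) u
    τ-at {u} = cong (λ s → pair x s u) (≔-at {σ} {x} {a})

    Blocked-other : ∀ {u w} → x — u → x — w → Blocked σ′ x u w → Blocked σ x u w
    Blocked-other {u} {w} xu xw = go
      where
      at : ∀ {v u z} → v ≢ x → τ σ′ v u ≡ z → τ σ v u ≡ z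
      at h e = trans (sym (τ-other h)) e
      nu = —-≢ xu ∘ sym
      nw = —-≢ xw ∘ sym
      go : Blocked σ′ x u w → Blocked σ x u w
      go (b₃ p (inj₁ e)) = b₃ p (inj₁ (at nu e))
      go (b₃ p (inj₂ e)) = b₃ p (inj₂ (at nw e))
      go (b-uy y p q h e f) = b-uy y p q h (at nu e) (at h f)
      go (b-yw y p q h e f) = b-yw y p q h (at nw e) (at h f)
      go (b-uw y p q h e f) = b-uw y p q h (at nu e) (at nw f)

    turn-unblocked : x — a → ¬ Blocked σ x a (r x a) → ¬ Blocked σ x (r² x a) (r³ x a) → Unblocked σ′ x
    turn-unblocked xa h k {u} xu b = go (turnAt xa xu) (Blocked-other xu (subst (x —_) (sym τ-at) (pair-nbr (turnAt xa xu))) b)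
      where
      pair-nbr : TurnAt x a u → x — pair x (just a) u
      pair-nbr (t0 _ e) = subst (x —_) (sym e) (r-nbr xa)
      pair-nbr (t1 _ e) = subst (x —_) (sym e) xa
      pair-nbr (t2 _ e) = subst (x —_) (sym e) (r³-nbr xa)
      pair-nbr (t3 _ e) = subst (x —_) (sym e) (r²-nbr xa)
      go : TurnAt x a u → ¬ Blocked σ x u (τ σ′ x u)
      go (t0 refl e) b = h (subst (Blocked σ x a) (trans τ-at e) b)
      go (t1 refl e) b = h (Blocked-sym (subst (Blocked σ x (r x a)) (trans τ-at e) b))
      go (t2 refl e) b = k (subst (Blocked σ x (r² x a)) (trans τ-at e) b)
      go (t3 refl e) b = k (Blocked-sym (subst (Blocked σ x (r³ x a)) (trans τ-at e) b))

    turn-good : Valid σ → Good σ → x — a → Unblocked σ′ x → Good σ′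
    turn-good ok g xa h = record
      { good₃ = λ b → Good.good₃ g (bad₃-unchanged (≔-valid ok xa) at b)
      ; good₄ = λ b → Good.good₄ g (proj₁ (bad₄-unchanged (≔-valid ok xa) at b)) }
      where
      at : ∀ v → σ′ v ≡ σ v ⊎ Unblocked σ′ v
      at v = case v ≟ x of λ where
        (yes refl) → inj₂ (λ {u} → h {u})
        (no v≢x)   → inj₁ (≔-other {σ} {x} {a} v≢x)

  -- Merging two trails at a straight vertex

  -- A straight vertex where two components meet
  Meets : State → V → Set
  Meets σ x = σ x ≡ nothing × (∀ {u} → x — u → ¬ σ ⊢ (x , u) ≈ (x , r x u))

  opposite-≈ : ∀ {σ x u} → σ x ≡ nothing → x — u → σ ⊢ (x , u) ≈ (x , r² x u)
  opposite-≈ {σ} {x} {u} e xu = subst (λ w → σ ⊢ (x , u) ≈ (x , w)) (τ-straight {σ} e u) (rep-link every σ refl xu)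

  -- Opposite edges at a straight vertex share a trail, so comparing one consecutive pair decides.
  mono-or-meets : ∀ {σ x} → σ x ≡ nothing → Mono σ x ⊎ Meets σ x
  mono-or-meets {σ} {x} s with ≈? σ (x , proj₁ (some-nbr x)) (x , r x (proj₁ (some-nbr x)))
  ... | yes e = inj₁ λ u w → trans (to u) (sym (to w))
    where
    a = proj₁ (some-nbr x)
    xa = proj₂ (some-nbr x)
    to : ∀ {u} → x — u → σ ⊢ (x , u) ≈ (x , a)
    to xu with position xa xu
    ... | at0 refl = refl
    ... | at1 refl = sym e
    ... | at2 refl = sym (opposite-≈ {σ} s xa)
    ... | at3 refl = sym (trans e (opposite-≈ {σ} s (r-nbr xa)))
  ... | no ne = inj₂ (s , differ)
    where
    a = proj₁ (some-nbr x)
    xa = proj₂ (some-nbr x)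
    differ : ∀ {u} → x — u → ¬ σ ⊢ (x , u) ≈ (x , r x u)
    differ xu e with position xa xu
    ... | at0 refl = ne e
    ... | at1 refl = ne (trans (opposite-≈ {σ} s xa) (sym e))
    ... | at2 refl = ne (trans (opposite-≈ {σ} s xa) (trans e (sym (opposite-≈ {σ} s (r-nbr xa)))))
    ... | at3 refl = ne (sym (trans (opposite-≈ {σ} s (r-nbr xa)) (trans e (cong (λ w → rep every σ (x , w)) (r⁴ xa)))))

  module Merge {σ : State} (ok : Valid σ) {x a : V} (xa : x — a) (meets : Meets σ x) where

    private
      σ′ = σ [ x ≔ a ]
      X : V → Bool
      X v = ⌊ v ≟ x ⌋
      agree : ∀ {v} → X v ≡ false → σ′ v ≡ σ v
      agree {v} f with v ≟ x
      ... | no _ = refl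
      s = proj₁ meets
      differ = proj₂ meets

    -- With x cut open, the class of xu has evenly many ends at x. The two edges next to it belong
    -- to the other trail, so it returns through the opposite edge, whichever turn replaces the
    -- crossing.
    opposite′ : ∀ {u} → x — u → σ′ ⊢ (x , u) ≈ (x , r² x u)
    opposite′ {u} xu = sym (partial X σ σ′ agree (K-true second))
      where
      open Ends X σ ok (x , u)
      no₁ : K x (r x u) ≡ false
      no₁ = bool-false λ t → differ xu (sym (rep-weaken (not ∘ X) σ (K-true t)))
      no₃ : K x (r³ x u) ≡ false
      no₃ = bool-false λ t → differ xu (sym (trans (opposite-≈ {σ} s (r-nbr xu)) (rep-weaken (not ∘ X) σ (K-true t))))
      zero-row : K x u xor (K x (r x u) xor (K x (r² x u) xor K x (r³ x u))) ≡ false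
      zero-row = trans (sym (row-at xu)) (trans (sym (xor-identityʳ _)) (even-rows ([] ∷ []) (λ {v} t → here (toWit (v ≟ x) t))))
      first : K x u ≡ true
      first = fromWit (rep (not ∘ X) σ (x , u) ≟D rep (not ∘ X) σ (x , u)) refl
      second : K x (r² x u) ≡ true
      second = sym (xor-false (trans (sym (cong₂ _xor_ first (cong₂ _xor_ no₁ (trans (cong (K x (r² x u) xor_) no₃) (xor-identityʳ _))))) zero-row))

    merged : Mono σ′ x
    merged xu xw = trans (to xu) (sym (to xw))
      where
      link : σ′ ⊢ (x , a) ≈ (x , r x a)
      link = subst (λ w → σ′ ⊢ (x , a) ≈ (x , w)) (trans (τ-at {σ} {x} {a}) (pair-a a)) (rep-link every σ′ refl xa)
      to : ∀ {u} → x — u → σ′ ⊢ (x , u) ≈ (x , a)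
      to xu with position xa xu
      ... | at0 refl = refl
      ... | at1 refl = sym link
      ... | at2 refl = sym (opposite′ xa)
      ... | at3 refl = sym (trans link (opposite′ (r-nbr xa)))

    coarser : ∀ {d e} → σ ⊢ d ≈ e → σ′ ⊢ d ≈ e
    coarser = patch X σ σ′ agree glue
      where
      glue : ∀ {v u} → X v ≡ true → v — u → σ′ ⊢ (v , u) ≈ (v , τ σ v u)
      glue {v} t vu with v ≟ x
      ... | yes refl = merged vu (τ-nbr ok vu)

  -- The invariant of the merging phase. `mono` survives later turns because these only merge trails
  -- (`Merge.coarser`).
  record Stable (σ : State) : Set where
    field
      ok   : Valid σ
      good : Good σ
      mono : ∀ {v} → σ v ≢ nothing → Mono σ v

  -- Reasons for a corner to be blocked

  module Local {σ : State} (st : Stable σ) where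

    open Stable st

    infix 4 _≈_
    _≈_ : D → D → Set
    d ≈ e = σ ⊢ d ≈ e

    ≈-flip : ∀ {u v} → u — v → (u , v) ≈ (v , u)
    ≈-flip = rep-flip every σ

    ≈-via : ∀ {v u w} → v — u → τ σ v u ≡ w → (u , v) ≈ (v , w)
    ≈-via {v} vu refl = trans (≈-flip (—-sym vu)) (rep-link every σ refl vu)

    τ-sym : ∀ {v u w} → v — u → τ σ v u ≡ w → τ σ v w ≡ u
    τ-sym = τ-swap {σ} ok

    is-straight : ∀ {v p} → v — p → τ σ v p ≡ r² v p → σ v ≡ nothing
    is-straight {v} {p} vp e with σ v in eq
    ... | nothing = refl
    ... | just a = contradiction e (Next-¬opp vp (subst (v —_) (sym e) (r²-nbr vp)) (pair-next (ok eq) vp))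

    is-turned : ∀ {v p q} → v — p → v — q → τ σ v p ≡ q → Next v p q → σ v ≢ nothing
    is-turned vp vq e nx s = Next-¬opp vp vq nx (trans (sym e) (τ-straight {σ} s _))

    meets : ∀ {v p q} → v — p → v — q → ¬ (v , p) ≈ (v , q) → Meets σ v
    meets {v} vp vq ne with σ v in eq
    ... | just a = contradiction (mono (λ e → case trans (sym eq) e of λ ()) vp vq) ne
    ... | nothing with mono-or-meets {σ} eq
    ...   | inj₁ m = contradiction (m vp vq) ne
    ...   | inj₂ m = refl , proj₂ m

    meets-next : ∀ {v p q} → Meets σ v → v — p → v — q → Next v p q → ¬ (v , p) ≈ (v , q)
    meets-next m vp vq (inj₁ refl) e = proj₂ m vp e
    meets-next m vp vq (inj₂ refl) e = proj₂ m vq (sym e)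

    straight-τ : ∀ {v p q} → σ v ≡ nothing → τ σ v p ≡ q → q ≡ r² v p
    straight-τ s e = trans (sym e) (τ-straight {σ} s _)

    -- The face at the corner u x w is used at u, and the subtrail through u leaves
    -- it along the edge z w at the vertex w.
    record Using (x u w : V) : Set where
      field
        meets-w : Meets σ w
        z       : V
        wz      : w — z
        along   : (w , z) ≈ (x , u)
        z-at-w  : (w ≡ r x u → z ≡ r w x) × (u ≡ r x w → x ≡ r w z)
        τ-at-z  : (w ≡ r x u → τ σ z w ≡ r z w) × (u ≡ r x w → w ≡ r z (τ σ z w))
        z-bent  : σ z ≢ nothing
        u-bent  : σ u ≢ nothing
        path    : (z ≡ u × τ σ u x ≡ w) ⊎ (u — z × τ σ u x ≡ z × τ σ z u ≡ w × z ≢ x)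

    -- The face at the corner x is used at its vertex w.
    record Uses (x w u : V) : Set where
      field
        bent : σ w ≢ nothing
        side : (u ≡ r x w → x ≡ r w (τ σ w x)) × (w ≡ r x u → τ σ w x ≡ r w x)

    -- The blocking subtrail starts at y, reached straight from x through u and through w. `lens` is
    -- either the chord uw or a four-cycle with tips x and y.
    record Two (x u w : V) : Set where
      field
        y : V
        uy : u — y
        yw : y — w
        x≢y : x ≢ y
        τu : τ σ u x ≡ y
        τw : τ σ w x ≡ y
        straight-u : σ u ≡ nothing
        straight-w : σ w ≡ nothing
        meets-y : Meets σ y
        y-next : Next y u w
        lens : u — w ⊎ (¬ x — y × ¬ u — w × Σ (Split x u y w) λ S → (∃[ s ] (Split.Tip S x w u s × Split.Tip S y u w (not s))) × Split.Cross S u x y × Split.Cross S w y x)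

    -- The blocking subtrail starts at w, and the tips x and w are neighbours on the four-cycle.
    record Adjacent (x u w : V) : Set where
      field
        y : V
        uy : u — y
        yw : y — w
        x≢y : x ≢ y
        τu : τ σ u x ≡ y
        τy : τ σ y u ≡ w
        straight-u : σ u ≡ nothing
        straight-y : σ y ≡ nothing
        meets-w : Meets σ w
        no-xy : ¬ x — y
        no-uw : ¬ u — w
        S : Split x u y w
        tips : ∃[ s ] (Split.Tip S x w u s × Split.Tip S w y x (not s))
        cross-u : Split.Cross S u x y
        cross-y : Split.Cross S y u w

    -- Seen from the edge xw, which a second blocked corner will share: `uses` bends into the face
    -- at w itself, `via` reaches w along the face from u, and the subtrails of `far` and `near`
    -- start at w and at u.
    data Kind₂ (x u w : V) : Set where
      via   : Using x u w → Kind₂ x u w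
      uses  : Uses x w u → Kind₂ x u w
      two   : Two x u w → Kind₂ x u w
      far   : Adjacent x u w → Kind₂ x u w
      near  : Adjacent x w u → Kind₂ x u w

    module _ {x u w : V} (mx : Meets σ x) (xu : x — u) (xw : x — w) (nx : Next x u w) where

      private
        u≢w : u ≢ w
        u≢w refl = case nx of λ { (inj₁ e) → r≢ xu (sym e) ; (inj₂ e) → r≢ xu (sym e) }
        xu≉xw : ¬ (x , u) ≈ (x , w)
        xu≉xw = meets-next mx xu xw nx
        antisym : w ≡ r x u → u ≢ r x w
        antisym refl e = r²≢ xu (sym e)

      using-triangle : u — w → τ σ u x ≡ w → Using x u w × Uses x u w
      using-triangle uw e = record
          { meets-w = meets (—-sym uw) (—-sym xw) λ h → xu≉xw (trans xu≈ (trans h (≈-flip (—-sym xw))))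
          ; z = u ; wz = —-sym uw ; along = sym xu≈
          ; z-at-w = (λ h → sym (proj₁ (proj₂ (plus h)))) , (λ h → sym (proj₁ (proj₂ (minus h))))
          ; τ-at-z = (λ h → trans (τ-sym (—-sym xu) e) (sym (proj₂ (proj₂ (plus h))))) , (λ h → trans (sym (proj₂ (proj₂ (minus h)))) (cong (r u) (sym (τ-sym (—-sym xu) e))))
          ; z-bent = bent ; u-bent = bent ; path = inj₁ (refl , e) }
        , record { bent = bent ; side = (λ h → trans (sym (proj₂ (proj₂ (plus h)))) (cong (r u) (sym e))) , (λ h → trans e (sym (proj₂ (proj₂ (minus h))))) }
        where
        bent : σ u ≢ nothing
        bent = is-turned (—-sym xu) uw e (triangle-next xu uw (—-sym xw))
        xu≈ : (x , u) ≈ (w , u)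
        xu≈ = trans (≈-via (—-sym xu) e) (≈-flip uw)
        tri = Triangle.triangle-facial (—-sym xu) xw (—-sym uw)
        plus : w ≡ r x u → r x u ≡ w × r w x ≡ u × r u w ≡ x
        plus h with tri
        ... | inj₁ t = t
        ... | inj₂ (p , _) = contradiction (sym p) (antisym h)
        minus : u ≡ r x w → r x w ≡ u × r w u ≡ x × r u x ≡ w
        minus h with tri
        ... | inj₁ (p , _) = contradiction h (antisym (sym p))
        ... | inj₂ t = t

      private
        shape : ∀ {y} → u — y → y — w → y ≢ x → TipShape x u y w
        shape uy yw y≢x = tip-shape xu uy yw (—-sym xw) (y≢x ∘ sym) u≢w nx

      -- The edges wy and wx lie on different trails, so w is straight and x is not opposite y
      -- there. This excludes all shapes crossing at w and leaves a face, or tips at x and w.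
      kind-uy : ∀ y → u — y → y — w → y ≢ x → τ σ u x ≡ y → τ σ y u ≡ w → (Using x u w × Uses x u w) ⊎ Adjacent x u w
      kind-uy y uy yw y≢x e f = go (shape uy yw y≢x)
        where
        xu≈ : (x , u) ≈ (w , y)
        xu≈ = trans (≈-via (—-sym xu) e) (trans (≈-via (—-sym uy) f) (≈-flip yw))
        mw : Meets σ w
        mw = meets (—-sym yw) (—-sym xw) λ h → xu≉xw (trans xu≈ (trans h (≈-flip (—-sym xw))))
        straight-through : x ≡ r² w y → ⊥
        straight-through h = xu≉xw (trans xu≈ (trans (subst (λ k → (w , y) ≈ (w , k)) (sym h) (opposite-≈ {σ} (proj₁ mw) (—-sym yw))) (≈-flip (—-sym xw))))
        go : TipShape x u y w → (Using x u w × Uses x u w) ⊎ Adjacent x u w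
        go (facial q) = inj₁ (record
            { meets-w = mw ; z = y ; wz = —-sym yw ; along = sym xu≈
            ; z-at-w = (λ h → let _ , _ , c , _ = minus h in sym c) , (λ h → let _ , _ , c , _ = plus h in sym c)
            ; τ-at-z = (λ h → let _ , b , _ = minus h in trans (τ-sym (—-sym uy) f) (sym b)) , (λ h → let _ , b , _ = plus h in trans (sym b) (cong (r y) (sym (τ-sym (—-sym uy) f))))
            ; z-bent = is-turned (—-sym uy) yw f y-next ; u-bent = bent
            ; path = inj₂ (uy , e , f , y≢x) }
          , record { bent = bent ; side = (λ h → let a , _ = minus h in trans (sym a) (cong (r u) (sym e))) , (λ h → let a , _ = plus h in trans e (sym a)) })
          where
          minus : w ≡ r x u → r u y ≡ x × r y w ≡ u × r w x ≡ y × r x u ≡ w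
          minus h = case q of λ where
            (inj₂ t) → t
            (inj₁ (_ , _ , _ , p)) → contradiction (sym p) (antisym h)
          plus : u ≡ r x w → r u x ≡ y × r y u ≡ w × r w y ≡ x × r x w ≡ u
          plus h = case q of λ where
            (inj₁ t) → t
            (inj₂ (_ , _ , _ , p)) → contradiction h (antisym (sym p))
          bent : σ u ≢ nothing
          bent = is-turned (—-sym xu) uy e (case q of λ { (inj₁ (p , _)) → inj₁ (sym p) ; (inj₂ (p , _)) → inj₂ (sym p) })
          y-next : Next y u w
          y-next = case q of λ { (inj₁ (_ , p , _)) → inj₁ (sym p) ; (inj₂ (_ , p , _)) → inj₂ (sym p) }
        go (diamond _ _ p) = ⊥-elim (straight-through (r²-sym (—-sym xw) p))
        go (tips-xy _ _ _ _ _ (p , _)) = ⊥-elim (straight-through p)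
        go (tips-xu _ _ _ _ _ (p , _)) = ⊥-elim (straight-through p)
        go (tips-xw no-xy no-uw S t cu cy) = inj₂ (record
            { y = y ; uy = uy ; yw = yw ; x≢y = y≢x ∘ sym ; τu = e ; τy = f
            ; straight-u = is-straight (—-sym xu) (trans e (proj₁ cu)) ; straight-y = is-straight (—-sym uy) (trans f (proj₁ cy))
            ; meets-w = mw
            ; no-xy = no-xy ; no-uw = no-uw ; S = S ; tips = t ; cross-u = cu ; cross-y = cy })

      -- The trails through u and w differ and meet at y, so u and w are not opposite there; shapes
      -- crossing at y are impossible.
      kind-uw : ∀ y → u — y → y — w → y ≢ x → τ σ u x ≡ y → τ σ w x ≡ y → Kind₂ x u w
      kind-uw y uy yw y≢x e f = go (shape uy yw y≢x)
        where
        yu≉yw : ¬ (y , u) ≈ (y , w)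
        yu≉yw h = xu≉xw (trans (≈-via (—-sym xu) e) (trans (≈-flip uy) (trans h (trans (≈-flip yw) (sym (≈-via (—-sym xw) f))))))
        my : Meets σ y
        my = meets (—-sym uy) yw yu≉yw
        y-next : Next y u w
        y-next = ¬opp-Next (—-sym uy) yw u≢w λ h → yu≉yw (subst (λ k → (y , u) ≈ (y , k)) (sym h) (opposite-≈ {σ} (proj₁ my) (—-sym uy)))
        mk : σ u ≡ nothing → σ w ≡ nothing → u — w ⊎ (¬ x — y × ¬ u — w × Σ (Split x u y w) λ S → (∃[ s ] (Split.Tip S x w u s × Split.Tip S y u w (not s))) × Split.Cross S u x y × Split.Cross S w y x) → Kind₂ x u w
        mk su sw l = two (record { y = y ; uy = uy ; yw = yw ; x≢y = y≢x ∘ sym ; τu = e ; τw = f ; straight-u = su ; straight-w = sw ; meets-y = my ; y-next = y-next ; lens = l })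
        go : TipShape x u y w → Kind₂ x u w
        go (facial q) = uses (record
          { bent = is-turned (—-sym xw) (—-sym yw) f (case q of λ { (inj₁ (_ , _ , p , _)) → inj₂ (sym p) ; (inj₂ (_ , _ , p , _)) → inj₁ (sym p) })
          ; side = (λ h → case q of λ { (inj₁ (_ , _ , p , _)) → trans (sym p) (cong (r w) (sym f)) ; (inj₂ (_ , _ , _ , p)) → contradiction h (antisym (sym p)) })
                 , (λ h → case q of λ { (inj₂ (_ , _ , p , _)) → trans f (sym p) ; (inj₁ (_ , _ , _ , p)) → contradiction (sym p) (antisym h) }) })
        go (diamond uw p q) = mk (is-straight (—-sym xu) (trans e p)) (is-straight (—-sym xw) (trans f q)) (inj₁ uw)
        go (tips-xy nxy nuw S t cu cw) = mk (is-straight (—-sym xu) (trans e (proj₁ cu))) (is-straight (—-sym xw) (trans f (r²-sym (—-sym yw) (proj₁ cw)))) (inj₂ (nxy , nuw , S , t , cu , cw))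
        go (tips-xu _ _ S _ cy _) = contradiction (subst (λ k → (y , u) ≈ (y , k)) (sym (proj₁ cy)) (opposite-≈ {σ} (proj₁ my) (—-sym uy))) yu≉yw
        go (tips-xw _ _ S _ _ cy) = contradiction (subst (λ k → (y , u) ≈ (y , k)) (sym (proj₁ cy)) (opposite-≈ {σ} (proj₁ my) (—-sym uy))) yu≉yw

    classify : ∀ {x u w} → Meets σ x → x — u → x — w → Next x u w → Blocked σ x u w → Kind₂ x u w
    classify mx xu xw nx (b₃ uw (inj₁ e)) = via (proj₁ (using-triangle mx xu xw nx uw e))
    classify mx xu xw nx (b₃ uw (inj₂ e)) = uses (proj₂ (using-triangle mx xw xu (Next-sym nx) (—-sym uw) e))
    classify mx xu xw nx (b-uy y uy yw y≢x e f) with kind-uy mx xu xw nx y uy yw y≢x e f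
    ... | inj₁ (k , _) = via k
    ... | inj₂ k = far k
    classify mx xu xw nx (b-yw y uy yw y≢x e f) with kind-uy mx xw xu (Next-sym nx) y (—-sym yw) (—-sym uy) y≢x e f
    ... | inj₁ (_ , k) = uses k
    ... | inj₂ k = near k
    classify mx xu xw nx (b-uw y uy yw y≢x e f) = kind-uw mx xu xw nx y uy yw y≢x e f

  -- Two blocked corners on a common edge

  Next-opposite : ∀ {w x z} → w — x → w — z → Next w x z → Next w (r² w x) z
  Next-opposite wx wz (inj₁ refl) = inj₂ refl
  Next-opposite wx wz (inj₂ refl) = inj₁ (sym (r⁴ wz))

  Next-≢ : ∀ {w x z} → w — x → w — z → Next w x z → x ≢ z
  Next-≢ wx wz (inj₁ e) refl = r≢ wx (sym e)
  Next-≢ wx wz (inj₂ e) refl = r≢ wx (sym e)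

  cross-sides : ∀ {a b c d} (S : Split a b c d) {w p q z} → Split.Cross S w p q → w — p → w — z → Next w p z →
    Split.Off S z × Split.Off S (r² w z) × Split.sd S (r² w z) ≡ not (Split.sd S z)
  cross-sides S (_ , ox , oy , e) wp wz (inj₁ refl) = ox , oy , e
  cross-sides S {w} (_ , ox , oy , e) wp wz (inj₂ refl) = subst (Split.Off S) (r⁴ wz) oy , ox , not-flip (trans (cong (Split.sd S) (sym (r⁴ wz))) e)

  Step : State → Set
  Step σ = ∃[ x ] ∃[ a ] (x — a × Meets σ x × ¬ Blocked σ x a (r x a) × ¬ Blocked σ x (r² x a) (r³ x a))

  turn-step : ∀ {σ w x z} → Meets σ w → w — x → w — z → Next w x z →
    ¬ Blocked σ w z (r² w x) → ¬ Blocked σ w x (r² w z) → Step σ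
  turn-step {σ} {w} {x} m wx wz (inj₁ refl) h k = w , r w x , r-nbr wx , m , h , λ b → k (Blocked-sym (subst (Blocked σ w (r³ w x)) (r⁴ wx) b))
  turn-step {σ} {w} {z = z} m wx wz (inj₂ refl) h k = w , r³ w z , r³-nbr wz , m ,
    (λ b → h (Blocked-sym (subst (Blocked σ w (r³ w z)) (r⁴ wz) b))) , λ b → k (subst (λ c → Blocked σ w (r w c) (r² w c)) (r⁴ wz) b)

  module LocalMoves {σ : State} (st : Stable σ) where

    open Stable st
    open Local st public

    -- At w the edge xw is paired with a single neighbour, so a subtrail along it turns into only
    -- one of the two faces at that edge.
    uses-once : ∀ {x u v w} → x — u → x — v → x — w → u ≢ v → w — x → Next x u w → Next x v w → Uses x w u → Uses x w v → ⊥
    uses-once xu xv xw u≢v wx (inj₁ e) (inj₁ f) k l = u≢v (r-inj xu xv (trans (sym e) f))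
    uses-once xu xv xw u≢v wx (inj₁ e) (inj₂ f) k l = r²≢ wx (sym (trans (proj₁ (Uses.side l) f) (cong (r _) (proj₂ (Uses.side k) e))))
    uses-once xu xv xw u≢v wx (inj₂ e) (inj₁ f) k l = r²≢ wx (sym (trans (proj₁ (Uses.side k) e) (cong (r _) (proj₂ (Uses.side l) f))))
    uses-once xu xv xw u≢v wx (inj₂ e) (inj₂ f) k l = u≢v (trans e (sym f))

    data Walk : D → D → List D → Set where
      stop : ∀ {d} → Walk d d (d ∷ [])
      next : ∀ {u v w e L} → v — u → τ σ v u ≡ w → Walk (v , w) e L → Walk (u , v) e ((u , v) ∷ L)

    first : ∀ {d e L} → Walk d e L → d ∈ L
    first stop = here refl
    first (next _ _ _) = here refl

    -- A closed subtrail is a whole component.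
    closed-component : ∀ {u v w L} → Walk (v , w) (u , v) L → v — u → τ σ v u ≡ w →
      ∀ {d e} → d ∈ L → d ≈ e → e ∈ L ⊎ swap e ∈ L
    closed-component {u} {v} {w} {L} walk vu eq {d} {e} d∈ de = toWit (in? e) (trans (sym (rep-elim every σ f flips links′ de)) (fromWit (in? d) (inj₁ d∈)))
      where
      open DecMembership _≟D_ using () renaming (_∈?_ to _∈D?_)
      Near : D → Set
      Near d = d ∈ L ⊎ swap d ∈ L
      in? : ∀ d → Dec (Near d)
      in? d = (d ∈D? L) ⊎-dec (swap d ∈D? L)
      f : D → Bool
      f d = ⌊ in? d ⌋
      last : ∀ {d e L} → Walk d e L → e ∈ L
      last stop = here refl
      last (next _ _ k) = there (last k)
      forward : ∀ {d e L p q} → Walk d e L → (p , q) ∈ L → (p , q) ≡ e ⊎ (q , τ σ q p) ∈ L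
      forward stop (here e) = inj₁ e
      forward (next _ refl k) (here refl) = inj₂ (there (first k))
      forward (next _ _ k) (there m) with forward k m
      ... | inj₁ e = inj₁ e
      ... | inj₂ m′ = inj₂ (there m′)
      backward : ∀ {d e L p q} → Walk d e L → (p , q) ∈ L → (p , q) ≡ d ⊎ (τ σ p q , p) ∈ L
      backward stop (here e) = inj₁ e
      backward (next _ _ k) (here e) = inj₁ e
      backward (next h eq k) (there m) with backward k m
      ... | inj₁ refl = inj₂ (here (cong (_, _) (τ-sym h eq)))
      ... | inj₂ m′ = inj₂ (there m′)
      follow : ∀ {q p} → Near (q , p) → Near (q , τ σ q p)
      follow (inj₁ m) with backward walk m
      ... | inj₁ refl = inj₂ (subst (λ k → (k , v) ∈ L) (sym (τ-sym vu eq)) (last walk))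
      ... | inj₂ m′ = inj₂ m′
      follow (inj₂ m) with forward walk m
      ... | inj₁ refl = inj₁ (subst (λ k → (v , k) ∈ L) (sym eq) (first walk))
      ... | inj₂ m′ = inj₁ m′
      flips : ∀ {u v} → u — v → f (u , v) ≡ f (v , u)
      flips {u} {v} _ = ⌊⌋-cong (in? (u , v)) (in? (v , u)) ⊎-swap ⊎-swap
      links′ : ∀ {v u} → true ≡ true → v — u → f (v , u) ≡ f (v , τ σ v u)
      links′ {v} {u} _ vu = ⌊⌋-cong (in? (v , u)) (in? (v , τ σ v u)) follow (λ m → subst (λ k → Near (v , k)) (τ-inv ok vu) (follow m))

    module _ {x u v w : V} (mx : Meets σ x) (xu : x — u) (xw : x — w) (opp : v ≡ r² x u) (nu : Next x u w) (nv : Next x v w) where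

      private
        xv : x — v
        xv = subst (x —_) (sym opp) (r²-nbr xu)
        ux = —-sym xu
        vx = —-sym xv
        wx = —-sym xw
        u≢v : u ≢ v
        u≢v e = r²≢ xu (sym (trans e opp))
        u≢w = Next-≢ xu xw nu
        v≢w = Next-≢ xv xw nv
        τx : τ σ x u ≡ v
        τx = trans (τ-straight {σ} (proj₁ mx) u) (sym opp)
        no-uv : ¬ u — v
        no-uv uv = Next-¬opp xu xv (triangle-next ux xv (—-sym uv)) opp

      -- The two faces at xw contain the two edges next to wx in the rotation at w, and these are
      -- opposite.
      sides-opposite : ∀ {z₁ z₂} → w — z₁ → w — z₂ → (w ≡ r x u → z₁ ≡ r w x) × (u ≡ r x w → x ≡ r w z₁) →
        (w ≡ r x v → z₂ ≡ r w x) × (v ≡ r x w → x ≡ r w z₂) → z₂ ≡ r² w z₁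
      sides-opposite {z₁} {z₂} wz₁ wz₂ (a , b) (c , d) = go nu nv
        where
        go : Next x u w → Next x v w → z₂ ≡ r² w z₁
        go (inj₁ e) (inj₁ f) = contradiction (r-inj xu xv (trans (sym e) f)) u≢v
        go (inj₁ e) (inj₂ f) = r²-sym wz₂ (trans (a e) (cong (r w) (d f)))
        go (inj₂ e) (inj₁ f) = trans (c f) (cong (r w) (b e))
        go (inj₂ e) (inj₂ f) = contradiction (trans e (sym f)) u≢v

      -- Both faces at xw used, at vertices other than w, close up a component
      -- through a turned vertex.
      two-faces : Using x u w → Using x v w → ⊥
      two-faces k₁ k₂ = go wz₁ wz₂ τw (Using.path k₁) (Using.path k₂)
        where
        z₁ = Using.z k₁
        z₂ = Using.z k₂
        wz₁ = Using.wz k₁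
        wz₂ = Using.wz k₂
        τw : τ σ w z₁ ≡ z₂
        τw = trans (τ-straight {σ} (proj₁ (Using.meets-w k₁)) z₁) (sym (sides-opposite wz₁ wz₂ (Using.z-at-w k₁) (Using.z-at-w k₂)))
        u-mono = mono (Using.u-bent k₁)
        far-edge : ∀ {q} → u — q → τ σ u x ≡ q → r² u x ≢ q
        far-edge uq e h = Using.u-bent k₁ (is-straight ux (trans e (sym h)))
        u≢z : ∀ {z} → v — z → u ≢ z
        u≢z vz e = no-uv (—-sym (subst (v —_) (sym e) vz))
        x≢u = —-≢ xu
        v≢u = u≢v ∘ sym
        w≢u = u≢w ∘ sym
        -- The walk passes u only once, but its component contains all edges at u.
        passes-once : ∀ {q L} → u — q → τ σ u x ≡ q → Walk (u , x) (q , u) L →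
          All (λ d → d ≡ (u , x) ⊎ d ≡ (q , u) ⊎ (proj₁ d ≢ u × proj₂ d ≢ u)) L → ⊥
        passes-once {q} {L} uq e walk all = case closed-component walk uq (τ-sym ux e) (first walk) (u-mono ux (r²-nbr ux)) of λ where
            (inj₁ m) → out (All.lookup all m)
            (inj₂ m) → back (All.lookup all m)
          where
          out : (u , r² u x) ≡ (u , x) ⊎ (u , r² u x) ≡ (q , u) ⊎ (u ≢ u × r² u x ≢ u) → ⊥
          out (inj₁ h) = r²≢ ux (cong proj₂ h)
          out (inj₂ (inj₁ h)) = —-≢ uq (cong proj₁ h)
          out (inj₂ (inj₂ (h , _))) = h refl
          back : (r² u x , u) ≡ (u , x) ⊎ (r² u x , u) ≡ (q , u) ⊎ (r² u x ≢ u × u ≢ u) → ⊥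
          back (inj₁ h) = —-≢ ux (cong proj₂ h)
          back (inj₂ (inj₁ h)) = far-edge uq e (cong proj₁ h)
          back (inj₂ (inj₂ (_ , h))) = h refl
        go : ∀ {z₁ z₂} → w — z₁ → w — z₂ → τ σ w z₁ ≡ z₂ → (z₁ ≡ u × τ σ u x ≡ w) ⊎ (u — z₁ × τ σ u x ≡ z₁ × τ σ z₁ u ≡ w × z₁ ≢ x) →
             (z₂ ≡ v × τ σ v x ≡ w) ⊎ (v — z₂ × τ σ v x ≡ z₂ × τ σ z₂ v ≡ w × z₂ ≢ x) → ⊥
        go wz₁ wz₂ τw (inj₁ (refl , e)) (inj₁ (refl , f)) = passes-once (—-sym wz₁) e (next xu τx (next vx f (next wz₂ (τ-sym wz₁ τw) stop)))
          (inj₁ refl ∷ inj₂ (inj₂ (x≢u , v≢u)) ∷ inj₂ (inj₂ (v≢u , w≢u)) ∷ inj₂ (inj₁ refl) ∷ [])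
        go wz₁ wz₂ τw (inj₂ (uz , e , e′ , _)) (inj₁ (refl , f)) = passes-once uz e
          (next xu τx (next vx f (next wz₂ (τ-sym wz₁ τw) (next (—-sym wz₁) (τ-sym (—-sym uz) e′) stop))))
          (inj₁ refl ∷ inj₂ (inj₂ (x≢u , v≢u)) ∷ inj₂ (inj₂ (v≢u , w≢u)) ∷ inj₂ (inj₂ (w≢u , —-≢ uz ∘ sym)) ∷ inj₂ (inj₁ refl) ∷ [])
        go wz₁ wz₂ τw (inj₁ (refl , e)) (inj₂ (vz , f , f′ , _)) = passes-once (—-sym wz₁) e
          (next xu τx (next vx f (next (—-sym vz) f′ (next wz₂ (τ-sym wz₁ τw) stop))))
          (inj₁ refl ∷ inj₂ (inj₂ (x≢u , v≢u)) ∷ inj₂ (inj₂ (v≢u , u≢z vz ∘ sym)) ∷ inj₂ (inj₂ (u≢z vz ∘ sym , w≢u)) ∷ inj₂ (inj₁ refl) ∷ [])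
        go wz₁ wz₂ τw (inj₂ (uz , e , e′ , _)) (inj₂ (vz , f , f′ , _)) = passes-once uz e
          (next xu τx (next vx f (next (—-sym vz) f′ (next wz₂ (τ-sym wz₁ τw) (next (—-sym wz₁) (τ-sym (—-sym uz) e′) stop)))))
          (inj₁ refl ∷ inj₂ (inj₂ (x≢u , v≢u)) ∷ inj₂ (inj₂ (v≢u , u≢z vz ∘ sym)) ∷ inj₂ (inj₂ (u≢z vz ∘ sym , w≢u)) ∷ inj₂ (inj₂ (w≢u , —-≢ uz ∘ sym)) ∷ inj₂ (inj₁ refl) ∷ [])

  four : ∀ {w x z k} → w — x → w — z → Next w x z → w — k → k ≡ x ⊎ k ≡ r² w x ⊎ k ≡ z ⊎ k ≡ r² w z
  four wx wz nx wk with position wx wk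
  ... | at0 e = inj₁ e
  ... | at2 e = inj₂ (inj₁ e)
  four wx wz (inj₁ refl) wk | at1 e = inj₂ (inj₂ (inj₁ e))
  four wx wz (inj₁ refl) wk | at3 e = inj₂ (inj₂ (inj₂ e))
  four wx wz (inj₂ refl) wk | at1 e = inj₂ (inj₂ (inj₂ e))
  four wx wz (inj₂ refl) wk | at3 e = inj₂ (inj₂ (inj₁ (trans e (r⁴ wz))))

  module LensMoves {σ : State} (st : Stable σ) where

    open Stable st
    open LocalMoves st public

    -- With the chord uw the lens is symmetric: it blocks the corner at y just as it blocks the one
    -- at x.
    two-flip : ∀ {x u w} (k : Two x u w) → Meets σ x → x — u → x — w → Next x u w → u — w → Two (Two.y k) u w
    two-flip k mx xu xw nx uw = record
      { y = _ ; uy = —-sym xu ; yw = xw ; x≢y = Two.x≢y k ∘ sym ; τu = τ-sym (—-sym xu) (Two.τu k) ; τw = τ-sym (—-sym xw) (Two.τw k)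
      ; straight-u = Two.straight-u k ; straight-w = Two.straight-w k ; meets-y = mx ; y-next = nx ; lens = inj₁ uw }

    two-swap : ∀ {x u w} (k : Two x u w) → u — w → Two x w u
    two-swap k uw = record
      { y = Two.y k ; uy = —-sym (Two.yw k) ; yw = —-sym (Two.uy k) ; x≢y = Two.x≢y k ; τu = Two.τw k ; τw = Two.τu k
      ; straight-u = Two.straight-w k ; straight-w = Two.straight-u k ; meets-y = Two.meets-y k ; y-next = Next-sym (Two.y-next k) ; lens = inj₁ (—-sym uw) }

    module Pair {x u v w : V} (mx : Meets σ x) (xu : x — u) (xw : x — w) (opp : v ≡ r² x u) (nu : Next x u w) (nv : Next x v w) where

      xv : x — v
      xv = subst (x —_) (sym opp) (r²-nbr xu)

      private
        ux = —-sym xu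
        vx = —-sym xv
        wx = —-sym xw
        u≢v : u ≢ v
        u≢v e = r²≢ xu (sym (trans e opp))
        u≢w = Next-≢ xu xw nu
        v≢w = Next-≢ xv xw nv
        τx : τ σ x u ≡ v
        τx = trans (τ-straight {σ} (proj₁ mx) u) (sym opp)

        chord-≢ : ∀ {k y} → ¬ x — y → x — k → k ≢ y
        chord-≢ h xk refl = h xk

      -- Both lenses have the far vertex `τ σ w x`, so from there the trail through u, x, v returns
      -- after four edges, against `good₄`.
      two-two : Two x u w → Two x v w → ⊥
      two-two k l = Good.good₄ good {u} {x} {v} {Two.y k} ((ux , xv , subst (v —_) y≡ (Two.uy l) , —-sym (Two.uy k) , u≢v , Two.x≢y k) ,
          τ-sym ux (Two.τu k) , τx , trans (Two.τu l) y≡)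
        where
        y≡ : Two.y l ≡ Two.y k
        y≡ = trans (sym (Two.τw l)) (Two.τw k)

      -- The vertex v is a further neighbour of the tip x, and y′ of the tip w, so these adjacent
      -- vertices would lie on opposite sides of the four-cycle. `far-near` and `two-far` argue
      -- alike.
      far-far : Adjacent x u w → Adjacent x v w → ⊥
      far-far k l = not-≢ (trans (sym y′-sd) (trans (sym (Split.same S (Adjacent.uy l) v-off y′-off)) v-sd))
        where
        open Adjacent k using (S; tips; y; no-xy; no-uw)
        y′ = Adjacent.y l
        v-off : Split.Off S v
        v-off = —-≢ vx , u≢v ∘ sym , chord-≢ no-xy xv , v≢w
        y′-off : Split.Off S y′
        y′-off = Adjacent.x≢y l ∘ sym , (λ { refl → no-uw (Adjacent.yw l) }) ,
          (λ e → u≢v (trans (sym (τ-sym (—-sym (Adjacent.uy k)) (Adjacent.τy k))) (trans (cong (λ q → τ σ q w) (sym e)) (τ-sym (—-sym (Adjacent.uy l)) (Adjacent.τy l))))) , —-≢ (Adjacent.yw l)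
        v-sd : Split.sd S v ≡ proj₁ tips
        v-sd = proj₂ (proj₁ (proj₂ tips)) xv v-off
        y′-sd : Split.sd S y′ ≡ not (proj₁ tips)
        y′-sd = proj₂ (proj₂ (proj₂ tips)) (—-sym (Adjacent.yw l)) y′-off

      far-near : Adjacent x u w → Adjacent x w v → ⊥
      far-near k l = not-≢ (trans (sym y′-sd) (trans (Split.same S (Adjacent.yw l) y′-off v-off) v-sd))
        where
        open Adjacent k using (S; tips; y; no-xy; no-uw; meets-w; yw)
        y′ = Adjacent.y l
        v-off : Split.Off S v
        v-off = —-≢ vx , u≢v ∘ sym , chord-≢ no-xy xv , v≢w
        y′-opp : y′ ≡ r² w x
        y′-opp = straight-τ (proj₁ meets-w) (Adjacent.τu l)
        y′-off : Split.Off S y′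
        y′-off = Adjacent.x≢y l ∘ sym , (λ e → no-uw (subst (_— w) e (—-sym (Adjacent.uy l)))) ,
          (λ e → Next-¬opp wx (—-sym yw) (Next-sym (proj₁ (proj₂ (proj₂ tips)))) (trans (sym e) y′-opp)) , —-≢ (—-sym (Adjacent.uy l))
        v-sd : Split.sd S v ≡ proj₁ tips
        v-sd = proj₂ (proj₁ (proj₂ tips)) xv v-off
        y′-sd : Split.sd S y′ ≡ not (proj₁ tips)
        y′-sd = proj₂ (proj₂ (proj₂ tips)) (Adjacent.uy l) y′-off

      near-near : Adjacent x w u → Adjacent x w v → ⊥
      near-near k l = u≢v (trans (sym (Adjacent.τy k)) (trans (cong (λ q → τ σ q w) (trans (sym (Adjacent.τu k)) (Adjacent.τu l))) (Adjacent.τy l)))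

      two-far : Two x u w → Adjacent x v w → ⊥
      two-far k l = not-≢ (trans (sym y-sd) (trans (sym (Split.same S (Two.uy k) u-off y-off)) u-sd))
        where
        open Adjacent l using (S; tips; no-xy; no-uw)
        y = Two.y k
        u-off : Split.Off S u
        u-off = —-≢ ux , u≢v , chord-≢ no-xy xu , u≢w
        y-off : Split.Off S y
        y-off = Two.x≢y k ∘ sym , (λ e → no-uw (subst (_— w) e (Two.yw k))) ,
          (λ e → Next-¬opp wx (—-sym (Adjacent.yw l)) (Next-sym (proj₁ (proj₂ (proj₂ tips)))) (trans (sym e) (straight-τ (Two.straight-w k) (Two.τw k)))) , —-≢ (Two.yw k)
        u-sd : Split.sd S u ≡ proj₁ tips
        u-sd = proj₂ (proj₁ (proj₂ tips)) xu u-off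
        y-sd : Split.sd S y ≡ not (proj₁ tips)
        y-sd = proj₂ (proj₂ (proj₂ tips)) (—-sym (Two.yw k)) y-off

      -- Without the chord uw, v would be a further neighbour of both tips of the lens and lie on
      -- both of its sides. With the chord, u takes the edges that w and y send to its side of the
      -- four-cycle of l, so x and u cut off the rest of that side.
      two-near : Two x u w → Adjacent x w v → ⊥
      two-near k l = go (Two.lens k)
        where
        open Adjacent l using (no-xy) renaming (S to S′; tips to tips′)
        y = Two.y k
        y≡ : Adjacent.y l ≡ y
        y≡ = trans (sym (Adjacent.τu l)) (Two.τw k)
        yv : y — v
        yv = subst (_— v) y≡ (Adjacent.yw l)
        s′ = proj₁ tips′
        L′ : List V
        L′ = x ∷ w ∷ Adjacent.y l ∷ v ∷ []
        off-In : ∀ {a} → On L′ a ≡ false → Split.Off S′ a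
        off-In f = (λ { refl → out-on f (here refl) }) , (λ { refl → out-on f (2nd refl) }) , (λ { refl → out-on f (3rd refl) }) , (λ { refl → out-on f (4th refl) })
        In-off : ∀ {a} → Split.Off S′ a → On L′ a ≡ false
        In-off (p , q , s , t) = on-out λ { (here e) → p e ; (2nd e) → q e ; (3rd e) → s e ; (4th e) → t e }
        x-nbr-off : ∀ {a} → x — a → a ≢ w → a ≢ v → Split.Off S′ a
        x-nbr-off xa a≢w a≢v = —-≢ xa ∘ sym , a≢w , chord-≢ no-xy xa , a≢v
        u-off = x-nbr-off xu u≢w u≢v
        u-sd : Split.sd S′ u ≡ s′
        u-sd = proj₂ (proj₁ (proj₂ tips′)) xu u-off
        t = r² x w
        xt : x — t
        xt = r²-nbr xw
        t-off : Split.Off S′ t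
        t-off = x-nbr-off xt (r²≢ xw) λ e → Next-¬opp xw xv (Next-sym nv) (sym e)
        t≢u : t ≢ u
        t≢u e = Next-¬opp xw xu (Next-sym nu) (sym e)
        I : V → Bool
        I a = not (On L′ a) ∧ (⌊ Split.sd S′ a ≟B s′ ⌋ ∧ not ⌊ a ≟ u ⌋)
        I-intro : ∀ {a} → Split.Off S′ a → Split.sd S′ a ≡ s′ → a ≢ u → I a ≡ true
        I-intro {a} o e ne = ∧-intro (cong not (In-off o)) (∧-intro (fromWit (Split.sd S′ a ≟B s′) e) (cong not (fromWit¬ (a ≟ u) ne)))
        not-true : ∀ {b} → not b ≡ true → b ≡ false
        not-true {false} e = refl
        I-elim : ∀ {a} → I a ≡ true → Split.Off S′ a × Split.sd S′ a ≡ s′ × a ≢ u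
        I-elim {a} h = let p , q = ∧-elim {not (On L′ a)} h
                           q₁ , q₂ = ∧-elim {⌊ Split.sd S′ a ≟B s′ ⌋} q
                       in off-In (not-true p) , toWit (Split.sd S′ a ≟B s′) q₁ , λ e → true≢false (trans (sym (fromWit (a ≟ u) e)) (not-true q₂))
        go : u — w ⊎ (¬ x — y × ¬ u — w × Σ (Split x u y w) λ S → (∃[ s ] (Split.Tip S x w u s × Split.Tip S y u w (not s))) × Split.Cross S u x y × Split.Cross S w y x) → ⊥
        go (inj₂ (no-xy′ , no-uw′ , S , (s , tx , ty) , _)) = not-≢ (trans (sym (proj₂ ty yv v-off)) (proj₂ tx xv v-off))
          where
          v-off : Split.Off S v
          v-off = —-≢ vx , u≢v ∘ sym , chord-≢ no-xy′ xv , v≢w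
        -- The neighbour t of x opposite w lies inside the cut, and v outside.
        go (inj₁ uw) = two-cut I x u closed (I-intro t-off (proj₂ (proj₁ (proj₂ tips′)) xt t-off) t≢u) (—-≢ xt ∘ sym) t≢u
            (bool-false λ h → proj₂ (proj₂ (proj₂ (proj₁ (I-elim h)))) refl) (—-≢ vx) (u≢v ∘ sym)
          where
          -- At a straight vertex only one further edge leads to the side of u.
          at-cross : ∀ {b p q a} → Split.Cross S′ b p q → b — p → b — u → Next b p u → b — a → Split.Off S′ p ⊎ Split.Off S′ a → p ∈ L′ → q ∈ L′ → Split.Off S′ a → Split.sd S′ a ≡ s′ → a ≡ u
          at-cross {b} {p} {q} cr bp bu np ba _ p∈ q∈ ao a-sd with four bp bu np ba
          ... | inj₁ refl = contradiction p∈ (out-on (In-off ao))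
          ... | inj₂ (inj₁ e) = contradiction (subst (_∈ L′) (trans (proj₁ cr) (sym e)) q∈) (out-on (In-off ao))
          ... | inj₂ (inj₂ (inj₁ e)) = e
          ... | inj₂ (inj₂ (inj₂ refl)) = contradiction (trans (sym (proj₂ (proj₂ (cross-sides S′ cr bp bu np)))) (trans a-sd (sym u-sd))) not-≢
          closed : ∀ {a b} → I a ≡ true → a — b → I b ≡ true ⊎ b ≡ x ⊎ b ≡ u
          closed {a} {b} Ia ab with I-elim Ia | On L′ b in b-on
          ... | ao , a-sd , a≢u | false with b ≟ u
          ...   | yes e = inj₂ (inj₂ e)
          ...   | no b≢u = inj₁ (∧-intro (fromWit (Split.sd S′ b ≟B s′) (trans (sym (Split.same S′ ab ao (off-In b-on))) a-sd)) refl)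
          closed {a} {b} Ia ab | ao , a-sd , a≢u | true with in-on b-on
          ... | here refl = inj₂ (inj₁ refl)
          ... | 2nd refl = contradiction (at-cross (Adjacent.cross-u l) wx (—-sym uw) (triangle-next xw (—-sym uw) ux) (—-sym ab) (inj₂ ao) (here refl) (3rd refl) ao a-sd) a≢u
          ... | 3rd refl = contradiction (at-cross (Adjacent.cross-y l) (—-sym (Adjacent.uy l)) (subst (_— u) (sym y≡) (—-sym (Two.uy k)))
                    (triangle-next (Adjacent.uy l) (subst (_— u) (sym y≡) (—-sym (Two.uy k))) uw) (—-sym ab) (inj₂ ao) (2nd refl) (4th refl) ao a-sd) a≢u
          ... | 4th refl = contradiction (trans (sym (proj₂ (proj₂ (proj₂ tips′)) (—-sym ab) ao)) a-sd) not-≢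

      -- One lens at the corner x and one used face at the adjacent corner
      module Face (f : Using x v w) where

        open Using f using (z; wz; meets-w) public

        nz : Next w x z
        nz = case nv of λ where
          (inj₁ e) → inj₁ (proj₁ (Using.z-at-w f) e)
          (inj₂ e) → inj₂ (proj₂ (Using.z-at-w f) e)

        zv : z ≡ v ⊎ v — z
        zv = case Using.path f of λ where
          (inj₁ (e , _)) → inj₁ e
          (inj₂ (e , _)) → inj₂ e

        z-side : ∀ {a b c d} (S : Split a b c d) → Split.Off S v → Split.Off S z → Split.sd S z ≡ Split.sd S v
        z-side S ov oz = case zv of λ where
          (inj₁ e) → cong (Split.sd S) e
          (inj₂ e) → sym (Split.same S e ov oz)

        -- As v or a neighbour of v, z lies on the side of the tip x, but as a neighbour of w on
        -- that of the tip w. The exception z = y fails because y is straight and z bent.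
        far-face : Adjacent x u w → ⊥
        far-face k = case z ≟ y of λ where
            (yes e) → Using.z-bent f (subst (λ q → σ q ≡ nothing) (sym e) (Adjacent.straight-y k))
            (no z≢y) → let z-off = z≢x , (λ { refl → no-uw (—-sym wz) }) , z≢y , —-≢ wz ∘ sym in
              not-≢ (trans (sym (proj₂ (proj₂ (proj₂ tips)) wz z-off)) (trans (z-side S v-off z-off) (proj₂ (proj₁ (proj₂ tips)) xv v-off)))
          where
          open Adjacent k using (y; S; tips; no-xy; no-uw)
          z≢x : z ≢ x
          z≢x = Next-≢ wx wz nz ∘ sym
          v-off : Split.Off S v
          v-off = —-≢ vx , u≢v ∘ sym , chord-≢ no-xy xv , v≢w

        -- The turn is made at w: z is paired with y, and x with the vertex opposite z. The lens
        -- separates z from the neighbours of y, and that opposite vertex from those of x. The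
        -- fourth vertex of a short subtrail could only be u, and the transitions at x, u and y do
        -- not lead that way.
        two-face : (k : Two x u w) → ¬ u — w → Step σ
        two-face k nuw with Two.lens k
        ... | inj₁ uw = contradiction uw nuw
        ... | inj₂ (no-xy , no-uw , S , (s , tx , ty) , cu , cw) = turn-step meets-w wx wz nz block₁ block₂
          where
          open Two k using (y; uy; yw; τu; τw)
          yu = —-sym uy
          y≡ : y ≡ r² w x
          y≡ = straight-τ (Two.straight-w k) τw
          wy = —-sym yw
          zB = r² w z
          z-sides = cross-sides S cw wy wz (subst (λ q → Next w q z) (sym y≡) (Next-opposite wx wz nz))
          z-off = proj₁ z-sides
          b-off = proj₁ (proj₂ z-sides)
          v-off : Split.Off S v
          v-off = —-≢ vx , u≢v ∘ sym , chord-≢ no-xy xv , v≢w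
          z-sd : Split.sd S z ≡ s
          z-sd = trans (z-side S v-off z-off) (proj₂ tx xv v-off)
          b-sd : Split.sd S zB ≡ not s
          b-sd = trans (proj₂ (proj₂ z-sides)) (cong not z-sd)
          nbr-y : ∀ {m} → m — y → m ≢ w → m — z → m ≡ u
          nbr-y {m} my m≢w mz with m ≟ u
          ... | yes e = e
          ... | no m≢u = let m-off = (λ { refl → no-xy my }) , m≢u , —-≢ my , m≢w in
            contradiction (trans (sym (proj₂ ty (—-sym my) m-off)) (trans (Split.same S mz m-off z-off) z-sd)) not-≢
          nbr-x : ∀ {m} → x — m → m ≢ w → m — zB → m ≡ u
          nbr-x {m} xm m≢w mb with m ≟ u
          ... | yes e = e
          ... | no m≢u = let m-off = —-≢ xm ∘ sym , m≢u , chord-≢ no-xy xm , m≢w in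
            contradiction (trans (sym b-sd) (trans (sym (Split.same S mb m-off b-off)) (proj₂ tx xm m-off))) not-≢
          τyw : τ σ y w ≢ u
          τyw e = Next-¬opp yu yw (Two.y-next k) (r²-sym yw (straight-τ (proj₁ (Two.meets-y k)) e))
          τuz : u — z → τ σ u z ≢ y
          τuz uz e = proj₁ z-off (trans (sym (τ-sym uz e)) (τ-sym ux τu))
          block₁ : ¬ Blocked σ w z (r² w x)
          block₁ b = go (subst (Blocked σ w z) (sym y≡) b)
            where
            go : ¬ Blocked σ w z y
            go (b₃ zy _) = not-≢ (trans (sym (proj₂ ty (—-sym zy) z-off)) z-sd)
            go (b-uy m zm my m≢w e f) with nbr-y my m≢w (—-sym zm)
            ... | refl = τuz (—-sym zm) f
            go (b-yw m zm my m≢w e f) = τyw (trans e (nbr-y my m≢w (—-sym zm)))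
            go (b-uw m zm my m≢w e f) = τyw (trans f (nbr-y my m≢w (—-sym zm)))
          τxw : τ σ x w ≢ u
          τxw e = Next-¬opp xw xu (Next-sym nu) (straight-τ (proj₁ mx) e)
          block₂ : ¬ Blocked σ w x zB
          block₂ (b₃ xb _) = not-≢ (trans (sym b-sd) (proj₂ tx xb b-off))
          block₂ (b-uy m xm mb m≢w e f) = τxw (trans e (nbr-x xm m≢w mb))
          block₂ (b-yw m xm mb m≢w e f) with nbr-x xm m≢w mb
          ... | refl = proj₁ (proj₂ (proj₂ b-off)) (trans (sym (τ-sym mb f)) τu)
          block₂ (b-uw m xm mb m≢w e f) = τxw (trans e (nbr-x xm m≢w mb))

        -- The same turn at w. Now the tips of the four-cycle are x and u, so it separates at these
        -- two; on the other end the trail entering z is known, because it follows the used face.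
        near-face : Adjacent x w u → Step σ
        near-face k = turn-step meets-w wx wz nz block₁ block₂
          where
          open Adjacent k using (y; uy; yw; τu; τy; S; tips; no-xy; no-uw; cross-u)
          s = proj₁ tips
          tx = proj₁ (proj₂ tips)
          tu = proj₂ (proj₂ tips)
          y≡ : y ≡ r² w x
          y≡ = straight-τ (proj₁ meets-w) τu
          zB = r² w z
          z-sides = cross-sides S cross-u wx wz nz
          z-off = proj₁ z-sides
          b-off = proj₁ (proj₂ z-sides)
          v-off : Split.Off S v
          v-off = —-≢ vx , v≢w , chord-≢ no-xy xv , u≢v ∘ sym
          z-sd : Split.sd S z ≡ s
          z-sd = trans (z-side S v-off z-off) (proj₂ tx xv v-off)
          b-sd : Split.sd S zB ≡ not s
          b-sd = trans (proj₂ (proj₂ z-sides)) (cong not z-sd)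
          nbr-x : ∀ {m} → x — m → m ≢ w → m — zB → m ≡ u
          nbr-x {m} xm m≢w mb with m ≟ u
          ... | yes e = e
          ... | no m≢u = let m-off = —-≢ xm ∘ sym , m≢w , chord-≢ no-xy xm , m≢u in
            contradiction (trans (sym b-sd) (trans (sym (Split.same S mb m-off b-off)) (proj₂ tx xm m-off))) not-≢
          v≢y : v ≢ y
          v≢y = chord-≢ no-xy xv
          -- The subtrail through w along the used face continues to x or v.
          after-z : ∀ {m} → τ σ z w ≡ m → (m ≡ x) ⊎ (m ≡ v × v — z × τ σ v z ≡ x)
          after-z e = case Using.path f of λ where
            (inj₁ (z≡v , g)) → inj₁ (trans (sym e) (trans (cong (λ q → τ σ q w) z≡v) (τ-sym vx g)))
            (inj₂ (vz , g , g′ , _)) → inj₂ (trans (sym e) (τ-sym (—-sym vz) g′) , vz , τ-sym vx g)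
          block₁ : ¬ Blocked σ w z (r² w x)
          block₁ b = go (subst (Blocked σ w z) (sym y≡) b)
            where
            go : ¬ Blocked σ w z y
            go (b₃ zy (inj₁ e)) = case after-z e of λ where
              (inj₁ h) → Adjacent.x≢y k (sym h)
              (inj₂ (h , _)) → v≢y (sym h)
            go (b₃ zy (inj₂ e)) = proj₂ (proj₂ (proj₂ z-off)) (trans (sym e) τy)
            go (b-uy m zm my m≢w e g) = case after-z e of λ where
              (inj₁ refl) → no-xy my
              (inj₂ (refl , vz , h)) → Adjacent.x≢y k (trans (sym h) g)
            go (b-yw m zm my m≢w e g) = not-≢ (trans (sym (proj₂ tu (subst (_— z) (trans (sym e) τy) (—-sym zm)) z-off)) z-sd)
            go (b-uw m zm my m≢w e g) = case after-z e of λ where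
              (inj₁ h) → —-≢ xu (trans (sym h) (trans (sym g) τy))
              (inj₂ (h , _)) → u≢v (trans (sym τy) (trans g h))
          τxw : τ σ x w ≢ u
          τxw e = Next-¬opp xw xu (Next-sym nu) (straight-τ (proj₁ mx) e)
          block₂ : ¬ Blocked σ w x zB
          block₂ (b₃ xb _) = not-≢ (trans (sym b-sd) (proj₂ tx xb b-off))
          block₂ (b-uy m xm mb m≢w e g) = τxw (trans e (nbr-x xm m≢w mb))
          block₂ (b-uw m xm mb m≢w e g) = τxw (trans e (nbr-x xm m≢w mb))
          -- The remaining subtrail passes u straight from zB to x, and no shape of the four-cycle
          -- x, u, zB, w admits this.
          block₂ (b-yw m xm mb m≢w e g) with nbr-x xm m≢w mb
          ... | refl = go (tip-shape xu mb (—-sym (r²-nbr wz)) wx (proj₁ b-off ∘ sym) u≢w nu)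
            where
            u-opp : zB ≡ r² u x
            u-opp = straight-τ (proj₁ (Adjacent.meets-w k)) (τ-sym mb g)
            not-next : ¬ Next u x zB
            not-next h = Next-¬opp ux mb h u-opp
            go : TipShape x u zB w → ⊥
            go (facial (inj₁ (p , _))) = not-next (inj₁ (sym p))
            go (facial (inj₂ (p , _))) = not-next (inj₂ (sym p))
            go (diamond uw _ _) = no-uw (—-sym uw)
            go (tips-xy _ _ S′ _ _ cw) = Next-≢ wx wz nz (trans (proj₁ cw) (r⁴ wz))
            go (tips-xu _ _ S′ (_ , _ , tu′) _ _) = not-next (proj₁ tu′)
            go (tips-xw no-xb _ S′ (s′ , tx′ , tw′) _ _) = not-≢ (trans (sym (proj₂ tw′ wz z-off′)) (trans (z-side S′ v-off′ z-off′) (proj₂ tx′ xv v-off′)))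
              where
              v-off′ : Split.Off S′ v
              v-off′ = —-≢ vx , u≢v ∘ sym , chord-≢ no-xb xv , v≢w
              z-off′ : Split.Off S′ z
              z-off′ = Next-≢ wx wz nz ∘ sym , proj₂ (proj₂ (proj₂ z-off)) , r²≢ wz ∘ sym , —-≢ wz ∘ sym

        -- In the triangle x u w the face and the chord continue each other at w.
        chord-opposite : u — w → z ≡ r² w u
        chord-opposite uw = sides-opposite mx xu xw opp nu nv (—-sym uw) wz orient (Using.z-at-w f)
          where
          orient : (w ≡ r x u → u ≡ r w x) × (u ≡ r x w → x ≡ r w u)
          orient = (λ h → case Triangle.triangle-facial ux xw (—-sym uw) of λ where
                     (inj₁ (_ , p , _)) → sym p
                     (inj₂ (p , _)) → contradiction (trans (sym p) (cong (r x) h)) (r²≢ xu ∘ sym))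
                 , (λ h → case Triangle.triangle-facial ux xw (—-sym uw) of λ where
                     (inj₂ (_ , p , _)) → sym p
                     (inj₁ (p , _)) → contradiction (trans (sym p) (cong (r x) h)) (r²≢ xw ∘ sym))

  -- Finding a safe turn

  Blocked? : ∀ σ x u w → Dec (Blocked σ x u w)
  Blocked? σ x u w = map′ to from
      ((adj? u w ×-dec ((τ σ u x ≟ w) ⊎-dec (τ σ w x ≟ u))) ⊎-dec
       any? (λ y → (adj? u y ×-dec adj? y w ×-dec ¬? (y ≟ x)) ×-dec
         (((τ σ u x ≟ y) ×-dec (τ σ y u ≟ w)) ⊎-dec ((τ σ w x ≟ y) ×-dec (τ σ y w ≟ u)) ⊎-dec ((τ σ u x ≟ y) ×-dec (τ σ w x ≟ y)))))
    where
    Flat : Set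
    Flat = (u — w × (τ σ u x ≡ w ⊎ τ σ w x ≡ u)) ⊎ (∃[ y ] ((u — y × y — w × y ≢ x) ×
      ((τ σ u x ≡ y × τ σ y u ≡ w) ⊎ (τ σ w x ≡ y × τ σ y w ≡ u) ⊎ (τ σ u x ≡ y × τ σ w x ≡ y))))
    to : Flat → Blocked σ x u w
    to (inj₁ (a , e)) = b₃ a e
    to (inj₂ (y , (a , b , c) , inj₁ (e , f))) = b-uy y a b c e f
    to (inj₂ (y , (a , b , c) , inj₂ (inj₁ (e , f)))) = b-yw y a b c e f
    to (inj₂ (y , (a , b , c) , inj₂ (inj₂ (e , f)))) = b-uw y a b c e f
    from : Blocked σ x u w → Flat
    from (b₃ a e) = inj₁ (a , e)
    from (b-uy y a b c e f) = inj₂ (y , (a , b , c) , inj₁ (e , f))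
    from (b-yw y a b c e f) = inj₂ (y , (a , b , c) , inj₂ (inj₁ (e , f)))
    from (b-uw y a b c e f) = inj₂ (y , (a , b , c) , inj₂ (inj₂ (e , f)))

  module StepMoves {σ : State} (st : Stable σ) where

    open Stable st
    open LensMoves st public

    module _ {x u v w : V} (mx : Meets σ x) (xu : x — u) (xw : x — w) (opp : v ≡ r² x u) (nu : Next x u w) (nv : Next x v w) where

      private
        module P = Pair mx xu xw opp nu nv
        module P′ = Pair mx P.xv xw (r²-sym xu opp) nv nu
        wx = —-sym xw
        ux = —-sym xu

      -- The turn is made at the far tip y, from where the diamond is again a lens. The pair lemmas
      -- for that lens leave only used faces as obstacles at y.
      diamond-face : (k : Two x u w) → u — w → Using x v w → Step σ
      diamond-face k uw f = turn-step my yt₂ yt₁ n₂₁ (λ b → block₁ (subst (Blocked σ y t₁) (r⁴ yw) b)) (λ b → block₂ (subst (Blocked σ y t₂) (r⁴ yu) b))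
        where
        y = Two.y k
        my = Two.meets-y k
        yu = —-sym (Two.uy k)
        yw = Two.yw k
        wu = —-sym uw
        t₁ = r² y u
        t₂ = r² y w
        yt₁ = r²-nbr yu
        yt₂ = r²-nbr yw
        nuw = Two.y-next k
        n₁w : Next y t₁ w
        n₁w = Next-opposite yu yw nuw
        n₂u : Next y t₂ u
        n₂u = Next-opposite yw yu (Next-sym nuw)
        n₂₁ : Next y t₂ t₁
        n₂₁ = Next-sym (Next-opposite yu yt₂ (Next-sym n₂u))
        k₁ : Two y u w
        k₁ = two-flip k mx xu xw nu uw
        module P₁ = Pair my yu yw refl nuw n₁w
        module P₂ = Pair my yw yu refl (Next-sym nuw) n₂u
        z = Using.z f
        zw = —-sym (Using.wz f)
        y≡ : y ≡ r² w x
        y≡ = straight-τ (Two.straight-w k) (Two.τw k)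
        x≡ : r² w y ≡ x
        x≡ = trans (cong (r² w) y≡) (r⁴ wx)
        z≡ : z ≡ r² w u
        z≡ = P.Face.chord-opposite f uw
        -- Both used faces would contain the edge wz opposite to wu, one on either side of it, and
        -- the trail at z would turn into both.
        both-sides : Using y t₁ w → ⊥
        both-sides g = go nu nv
          where
          same-z : Using.z g ≡ z
          same-z = trans (P₁.Face.chord-opposite g uw) (sym z≡)
          gτ : (w ≡ r y t₁ → τ σ z w ≡ r z w) × (t₁ ≡ r y w → w ≡ r z (τ σ z w))
          gτ = subst (λ q → (w ≡ r y t₁ → τ σ q w ≡ r q w) × (t₁ ≡ r y w → w ≡ r q (τ σ q w))) same-z (Using.τ-at-z g)
          clash : τ σ z w ≡ r z w → w ≡ r z (τ σ z w) → ⊥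
          clash e h = r²≢ zw (sym (trans h (cong (r z) e)))
          go : Next x u w → Next x v w → ⊥
          go (inj₁ h) (inj₁ h′) = r²≢ xu (trans (sym opp) (sym (r-inj xu P.xv (trans (sym h) h′))))
          go (inj₂ h) (inj₂ h′) = r²≢ xu (trans (sym opp) (trans h′ (sym h)))
          go (inj₁ h) (inj₂ h′) = clash (proj₁ gτ (sym w-at)) (proj₂ (Using.τ-at-z f) h′)
            where
            u-at : r w x ≡ u
            u-at = case Triangle.triangle-facial ux xw wu of λ where
              (inj₁ (_ , p , _)) → p
              (inj₂ (p , _)) → contradiction (trans (sym p) (cong (r x) h)) (r²≢ xu ∘ sym)
            ywu : r y w ≡ u
            ywu = case Triangle.triangle-facial uw (—-sym yw) yu of λ where
              (inj₁ (_ , p , _)) → p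
              (inj₂ (p , _)) → contradiction (trans (cong (r w) (trans (cong (r w) (sym u-at)) (sym y≡))) p) (r²≢ wu)
            w-at : r y t₁ ≡ w
            w-at = trans (cong (r³ y) (sym ywu)) (r⁴ yw)
          go (inj₂ h) (inj₁ h′) = clash (proj₁ (Using.τ-at-z f) h′) (proj₂ gτ t-at)
            where
            x-at : r w u ≡ x
            x-at = case Triangle.triangle-facial ux xw wu of λ where
              (inj₂ (_ , p , _)) → p
              (inj₁ (p , _)) → contradiction (trans (sym p) (cong (r x) h)) (r²≢ xw ∘ sym)
            u-at : r w y ≡ u
            u-at = trans (cong (r w) y≡) (trans (cong (r³ w) (sym x-at)) (r⁴ wu))
            yuw : r y u ≡ w
            yuw = case Triangle.triangle-facial yw wu (Two.uy k) of λ where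
              (inj₁ (_ , _ , p)) → p
              (inj₂ (p , _)) → contradiction (trans (cong (r w) u-at) p) (r²≢ (—-sym yw))
            t-at : t₁ ≡ r y w
            t-at = cong (r y) yuw
        -- The two used faces and the straight passages at x, w, u and y would link the two trails
        -- that meet at x.
        other-side : Using y t₂ u → ⊥
        other-side g = meets-next mx xu xw nu (begin
            rep every σ (x , u)     ≡⟨ trans (opposite-≈ {σ} (proj₁ mx) xu) (cong (λ q → rep every σ (x , q)) (sym opp)) ⟩
            rep every σ (x , v)     ≡⟨ Using.along f ⟨
            rep every σ (w , z)     ≡⟨ cong (λ q → rep every σ (w , q)) z≡ ⟩
            rep every σ (w , r² w u) ≡⟨ opposite-≈ {σ} (Two.straight-w k) wu ⟨
            rep every σ (w , u)     ≡⟨ ≈-flip wu ⟩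
            rep every σ (u , w)     ≡⟨ opposite-≈ {σ} (Two.straight-u k) uw ⟩
            rep every σ (u , r² u w) ≡⟨ cong (λ q → rep every σ (u , q)) (P₂.Face.chord-opposite g wu) ⟨
            rep every σ (u , Using.z g) ≡⟨ Using.along g ⟩
            rep every σ (y , r² y w) ≡⟨ opposite-≈ {σ} (proj₁ my) yw ⟨
            rep every σ (y , w)     ≡⟨ ≈-flip yw ⟩
            rep every σ (w , y)     ≡⟨ opposite-≈ {σ} (Two.straight-w k) (—-sym yw) ⟩
            rep every σ (w , r² w y) ≡⟨ cong (λ q → rep every σ (w , q)) x≡ ⟩
            rep every σ (w , x)     ≡⟨ ≈-flip wx ⟩
            rep every σ (x , w)     ∎)
          where open ≡-Reasoning
        block₁ : ¬ Blocked σ y t₁ w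
        block₁ b with classify my yt₁ yw n₁w b
        ... | via g = both-sides g
        ... | uses g = Uses.bent g (Two.straight-w k)
        ... | two l = P₁.two-two k₁ l
        ... | far l = P₁.two-far k₁ l
        ... | near l = P₁.two-near k₁ l
        block₂ : ¬ Blocked σ y t₂ u
        block₂ b with classify my yt₂ yu n₂u b
        ... | via g = other-side g
        ... | uses g = Uses.bent g (Two.straight-u k)
        ... | two l = P₂.two-two (two-swap k₁ uw) l
        ... | far l = P₂.two-far (two-swap k₁ uw) l
        ... | near l = P₂.two-near (two-swap k₁ uw) l

      two-via : Two x u w → Using x v w → Step σ
      two-via k f with adj? u w
      ... | yes uw = diamond-face k uw f
      ... | no nuw = P.Face.two-face f k nuw

    module _ {x u v w : V} (mx : Meets σ x) (xu : x — u) (xw : x — w) (opp : v ≡ r² x u) (nu : Next x u w) (nv : Next x v w) where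

      private
        module P = Pair mx xu xw opp nu nv
        xv = P.xv
        opp′ = r²-sym xu opp
        module P′ = Pair mx xv xw opp′ nv nu

        straight-w : Kind₂ x v w → σ w ≡ nothing ⊎ Uses x w v
        straight-w (via f) = inj₁ (proj₁ (Using.meets-w f))
        straight-w (uses f) = inj₂ f
        straight-w (two f) = inj₁ (Two.straight-w f)
        straight-w (far f) = inj₁ (proj₁ (Adjacent.meets-w f))
        straight-w (near f) = inj₁ (Adjacent.straight-u f)

        straight-w′ : Kind₂ x u w → σ w ≡ nothing ⊎ Uses x w u
        straight-w′ (via f) = inj₁ (proj₁ (Using.meets-w f))
        straight-w′ (uses f) = inj₂ f
        straight-w′ (two f) = inj₁ (Two.straight-w f)
        straight-w′ (far f) = inj₁ (proj₁ (Adjacent.meets-w f))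
        straight-w′ (near f) = inj₁ (Adjacent.straight-u f)

        u≢v : u ≢ v
        u≢v e = r²≢ xu (sym (trans e opp))

      -- All kinds except `uses` make w straight, whereas `uses` bends it; hence `uses` could only
      -- occur twice, which `uses-once` forbids.
      resolve : Kind₂ x u w → Kind₂ x v w → Step σ
      resolve (uses k) l = ⊥-elim (case straight-w l of λ where
        (inj₁ e) → Uses.bent k e
        (inj₂ l′) → uses-once xu xv xw u≢v (—-sym xw) nu nv k l′)
      resolve k (uses l) = ⊥-elim (case straight-w′ k of λ where
        (inj₁ e) → Uses.bent l e
        (inj₂ k′) → uses-once xu xv xw u≢v (—-sym xw) nu nv k′ l)
      resolve (via k) (via l) = ⊥-elim (two-faces mx xu xw opp nu nv k l)
      resolve (via k) (two l) = two-via mx xv xw opp′ nv nu l k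
      resolve (via k) (far l) = ⊥-elim (P′.Face.far-face k l)
      resolve (via k) (near l) = P′.Face.near-face k l
      resolve (two k) (via l) = two-via mx xu xw opp nu nv k l
      resolve (far k) (via l) = ⊥-elim (P.Face.far-face l k)
      resolve (near k) (via l) = P.Face.near-face l k
      resolve (two k) (two l) = ⊥-elim (P.two-two k l)
      resolve (two k) (far l) = ⊥-elim (P.two-far k l)
      resolve (two k) (near l) = ⊥-elim (P.two-near k l)
      resolve (far k) (two l) = ⊥-elim (P′.two-far l k)
      resolve (far k) (far l) = ⊥-elim (P.far-far k l)
      resolve (far k) (near l) = ⊥-elim (P.far-near k l)
      resolve (near k) (two l) = ⊥-elim (P′.two-near l k)
      resolve (near k) (far l) = ⊥-elim (P′.far-near l k)
      resolve (near k) (near l) = ⊥-elim (P.near-near k l)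

      both-blocked : Blocked σ x u w → Blocked σ x v w → Step σ
      both-blocked b c = resolve (classify mx xu xw nu b) (classify mx xv xw nv c)

    -- Each of the two turns at x has two corners, and a corner of one turn shares an edge with each
    -- corner of the other. So two blocked turns lead to `both-blocked`.
    step : ∀ {x} → Meets σ x → Step σ
    step {x} mx = go (Blocked? σ x a (r x a)) (Blocked? σ x (r² x a) (r³ x a)) (Blocked? σ x (r x a) (r² x a)) (Blocked? σ x (r³ x a) a)
      where
      a = proj₁ (some-nbr x)
      xa = proj₂ (some-nbr x)
      turn : ∀ {u w v} → x — u → x — w → v ≡ r² x u → Next x u w → Next x v w → Blocked σ x u w → Blocked σ x v w → Step σ
      turn = both-blocked mx
      go : Dec (Blocked σ x a (r x a)) → Dec (Blocked σ x (r² x a) (r³ x a)) → Dec (Blocked σ x (r x a) (r² x a)) → Dec (Blocked σ x (r³ x a) a) → Step σ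
      go (no h) (no k) _ _ = x , a , xa , mx , h , k
      go _ _ (no h) (no k) = x , r x a , r-nbr xa , mx , h , λ b → k (subst (Blocked σ x (r³ x a)) (r⁴ xa) b)
      go (yes b) _ (yes c) _ = turn xa (r-nbr xa) refl (inj₁ refl) (inj₂ refl) b (Blocked-sym c)
      go (yes b) _ _ (yes c) = turn (r-nbr xa) xa refl (inj₂ refl) (inj₁ (sym (r⁴ xa))) (Blocked-sym b) c
      go _ (yes b) (yes c) _ = turn (r³-nbr xa) (r²-nbr xa) (sym (r⁴ (r-nbr xa))) (inj₂ refl) (inj₁ refl) (Blocked-sym b) c
      go _ (yes b) _ (yes c) = turn (r²-nbr xa) (r³-nbr xa) (sym (r⁴ xa)) (inj₁ refl) (inj₂ (sym (r⁴ xa))) b (Blocked-sym c)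

    advance : ∀ {x} → Meets σ x → ∃[ σ′ ] (Stable σ′ × (∃[ y ] (σ y ≡ nothing × σ′ y ≢ nothing)) × (∀ {v} → σ v ≢ nothing → σ′ v ≢ nothing))
    advance mx with step mx
    ... | y , a , ya , my , h , k = σ [ y ≔ a ] , record { ok = ≔-valid ok ya ; good = turn-good ok good ya (turn-unblocked ya h k) ; mono = mono′ }
          , (y , proj₁ my , λ e → case trans (sym (≔-at {σ} {y} {a})) e of λ ()) , keep
      where
      keep : ∀ {v} → σ v ≢ nothing → (σ [ y ≔ a ]) v ≢ nothing
      keep {v} ne e = case v ≟ y of λ where
        (yes refl) → case trans (sym (≔-at {σ} {y} {a})) e of λ ()
        (no v≢y) → ne (trans (sym (≔-other {σ} {y} {a} v≢y)) e)
      mono′ : ∀ {v} → (σ [ y ≔ a ]) v ≢ nothing → Mono (σ [ y ≔ a ]) v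
      mono′ {v} ne = case v ≟ y of λ where
        (yes refl) → Merge.merged ok ya my
        (no v≢y) → λ vu vw → Merge.coarser ok ya my (mono (λ e → ne (trans (≔-other {σ} {y} {a} v≢y) e)) vu vw)

  -- Merging until a single trail is left

  straight? : State → V → Bool
  straight? σ v = is-nothing (σ v)

  straight?-true : ∀ {σ v} → straight? σ v ≡ true → σ v ≡ nothing
  straight?-true {σ} {v} e with σ v
  ... | nothing = refl

  straight?-false : ∀ {σ v} → σ v ≢ nothing → straight? σ v ≡ false
  straight?-false {σ} {v} ne with σ v
  ... | nothing = contradiction refl ne
  ... | just _ = refl

  saturate : ∀ k {σ} → count (straight? σ) ≤ k → Stable σ → ∃[ σ′ ] (Stable σ′ × (∀ v → Mono σ′ v))
  saturate k {σ} l st = go (choose (λ v → cases v (σ v) refl))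
    where
    cases : ∀ v s → σ v ≡ s → Mono σ v ⊎ Meets σ v
    cases v nothing e = mono-or-meets {σ} e
    cases v (just _) e = inj₁ (Stable.mono st λ e′ → case trans (sym e) e′ of λ ())
    less : ∀ {σ′} → (∃[ y ] (σ y ≡ nothing × σ′ y ≢ nothing)) → (∀ {v} → σ v ≢ nothing → σ′ v ≢ nothing) → count (straight? σ′) < count (straight? σ)
    less {σ′} (y , s , s′) keep = count-< {p = straight? σ′} {q = straight? σ} sub y (straight?-false {σ′} s′) (cong is-nothing s)
      where
      sub : ∀ i → straight? σ′ i ≡ true → straight? σ i ≡ true
      sub i e with straight? σ i in f
      ... | true = refl
      ... | false = contradiction (straight?-true {σ′} e) (keep λ h → true≢false (trans (sym (cong is-nothing h)) f))
    next : ∀ k {σ′} → count (straight? σ′) < k → Stable σ′ → ∃[ σ″ ] (Stable σ″ × (∀ v → Mono σ″ v))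
    next (suc k) (s≤s l′) = saturate k l′
    go : (∀ v → Mono σ v) ⊎ (∃[ x ] Meets σ x) → ∃[ σ″ ] (Stable σ″ × (∀ v → Mono σ″ v))
    go (inj₁ m) = σ , st , m
    go (inj₂ (x , mx)) = let σ′ , st′ , some , keep = StepMoves.advance st mx in next k (≤-trans (less some keep) l) st′

  -- The transitions of a single component traced out as a circuit

  module Trace {σ : State} (st : Stable σ) (mono : ∀ v → Mono σ v) {u₀ v₀ : V} (e₀ : u₀ — v₀) where

    open Stable st using (ok; good)

    ν : D → D
    ν (u , v) = v , τ σ v u

    ρ : D → D
    ρ (u , v) = v , u

    ν-adj : ∀ {d} → adjD d ≡ true → adjD (ν d) ≡ true
    ν-adj e = τ-nbr ok (—-sym e)

    ν-inj : ∀ {d e} → adjD d ≡ true → adjD e ≡ true → ν d ≡ ν e → d ≡ e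
    ν-inj {u , v} {u′ , v′} a b eq with cong proj₁ eq
    ... | refl = cong (_, v) (trans (sym (τ-inv ok (—-sym a))) (trans (cong (τ σ v) (cong proj₂ eq)) (τ-inv ok (—-sym b))))

    νρν : ∀ {d} → adjD d ≡ true → ν (ρ (ν d)) ≡ ρ d
    νρν {u , v} a = cong (v ,_) (τ-inv ok (—-sym a))

    open Orbit ν (λ d → adjD d ≡ true) (λ {d} → ν-adj {d}) (λ {d} {e} → ν-inj {d} {e})

    -- A trail coming back along its own reverse could be shortened by one step at each end, until a
    -- dart equals its reverse or a transition fixes an edge.
    no-reverse : ∀ k {d} → adjD d ≡ true → iter ν k d ≢ ρ d
    no-reverse zero {u , v} a e = —-≢ a (cong proj₁ e)
    no-reverse (suc zero) {u , v} a e = τ-≢ ok (—-sym a) (cong proj₂ e)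
    no-reverse (suc (suc k)) {d} a e = no-reverse k {ν d} (ν-adj {d} a) (ν-inj {iter ν k (ν d)} {ρ (ν d)} (iter-good k {ν d} (ν-adj {d} a)) (—-sym (ν-adj {d} a))
      (trans (cong ν (sym (iter-suc ν k d))) (trans e (sym (νρν {d} a)))))

    d₀ : D
    d₀ = u₀ , v₀

    at : ℕ → D
    at k = iter ν k d₀

    at-adj : ∀ k → adjD (at k) ≡ true
    at-adj k = iter-good k {d₀} e₀

    abstract
      least-period : ∃[ k ] (at (suc k) ≡ d₀ × (∀ j → j < k → at (suc j) ≢ d₀))
      least-period with period {d₀} e₀
      ... | suc p , _ , _ , e with least-true {λ k → at (suc k) ≡ d₀} (λ k → at (suc k) ≟D d₀) p e
      ...   | k , _ , q , min = k , q , min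

    m len′ : ℕ
    m = proj₁ least-period
    len′ = suc m

    at-len : at len′ ≡ d₀
    at-len = proj₁ (proj₂ least-period)

    at-multiple : ∀ q → at (q * len′) ≡ d₀
    at-multiple zero = refl
    at-multiple (suc q) = trans (iter-+ ν len′ (q * len′) d₀) (trans (cong (iter ν len′) (at-multiple q)) at-len)

    at-% : ∀ k → at (k % len′) ≡ at k
    at-% k = trans (cong (iter ν (k % len′)) (sym (at-multiple (k / len′)))) (trans (sym (iter-+ ν (k % len′) _ d₀)) (cong at (sym (m≡m%n+[m/n]*n k len′))))

    C : Circuit G
    C = record { len-1 = m ; vtx = λ i → proj₁ (at (toℕ i)) }

    pos-at : ∀ k → pos C k ≡ proj₁ (at k)
    pos-at k = cong proj₁ (trans (cong at (toℕ-fromℕ< (m%n<n k len′))) (at-% k))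

    pos-suc : ∀ k → pos C (suc k) ≡ proj₂ (at k)
    pos-suc k = trans (pos-at (suc k)) refl

    edgeAt-at : ∀ k → edgeAt C k ≡ at k
    edgeAt-at k = cong₂ _,_ (pos-at k) (pos-suc k)

    at-inj-≤ : ∀ {i j} → i ≤ j → j < len′ → at i ≡ at j → i ≡ j
    at-inj-≤ {i} {j} l j<len eq = go (j ∸ i) refl
      where
      go : ∀ k → j ∸ i ≡ k → i ≡ j
      go zero d = ≤-antisym l (m∸n≡0⇒m≤n d)
      go (suc k) d = contradiction (sym (iter-cancel i {d₀} {at (suc k)} e₀ (at-adj (suc k)) (trans eq (trans (cong at (trans (sym (m+[n∸m]≡n l)) (cong (i +_) d))) (iter-+ ν i (suc k) d₀)))))
        (proj₂ (proj₂ least-period) k (≤-pred (≤-trans (s≤s (≤-trans (≤-reflexive (sym d)) (m∸n≤m j i))) j<len)))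

    reverse-≢ : ∀ i j → at i ≢ ρ (at j)
    reverse-≢ i j eq = no-reverse (j + i) {d₀} e₀ (trans (iter-+ ν j i d₀) (trans (cong (iter ν j) eq) (back j)))
      where
      back : ∀ j → iter ν j (ρ (at j)) ≡ ρ d₀
      back zero = refl
      back (suc j) = trans (iter-suc ν j (ρ (at (suc j)))) (trans (cong (iter ν j) (νρν {at j} (at-adj j))) (back j))

    distinct : ∀ i j → i < len′ → j < len′ → SameEdge (edgeAt C i) (edgeAt C j) → i ≡ j
    distinct i j i< j< same with subst (λ x → SameEdge x (edgeAt C j)) (edgeAt-at i) same
    ... | h with subst (SameEdge (at i)) (edgeAt-at j) h
    ...   | inj₂ (a , b) = contradiction (cong₂ _,_ a b) (reverse-≢ i j)
    ...   | inj₁ (a , b) with ≤-total i j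
    ...     | inj₁ l = at-inj-≤ l j< (cong₂ _,_ a b)
    ...     | inj₂ l = sym (at-inj-≤ l i< (sym (cong₂ _,_ a b)))

    circuit : IsCircuit C
    circuit = (λ i _ → subst (λ d → adjD d ≡ true) (sym (edgeAt-at i)) (at-adj i)) , distinct

    Traced : D → Set
    Traced d = ∃[ i ] (i < len′ × (at i ≡ d ⊎ at i ≡ ρ d))

    trace : ∀ k {d} → at k ≡ d ⊎ at k ≡ ρ d → Traced d
    trace k h = k % len′ , m%n<n k len′ , (case h of λ { (inj₁ e) → inj₁ (trans (at-% k) e) ; (inj₂ e) → inj₂ (trans (at-% k) e) })

    Traced? : ∀ d → Dec (Traced d)
    Traced? d = map′ (λ (i , h) → toℕ i , toℕ<n i , h) (λ (i , l , h) → fromℕ< l , (case h of λ { (inj₁ e) → inj₁ (trans (cong at (toℕ-fromℕ< l)) e) ; (inj₂ e) → inj₂ (trans (cong at (toℕ-fromℕ< l)) e) }))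
      (any? {len′} (λ i → (at (toℕ i) ≟D d) ⊎-dec (at (toℕ i) ≟D ρ d)))

    Traced-flip : ∀ {d} → Traced d → Traced (ρ d)
    Traced-flip (i , l , inj₁ e) = i , l , inj₂ e
    Traced-flip (i , l , inj₂ e) = i , l , inj₁ e

    Traced-link : ∀ {v u} → v — u → Traced (v , u) → Traced (v , τ σ v u)
    Traced-link {v} {u} vu (i , l , inj₂ e) = trace (suc i) (inj₁ (cong ν e))
    -- One step back along the circuit is `m` steps forward, one less than its length.
    Traced-link {v} {u} vu (i , l , inj₁ e) = trace (m + i) (inj₂ (ν-inj {at (m + i)} {τ σ v u , v} (at-adj (m + i)) (—-sym (τ-nbr ok vu))
      (trans (iter-+ ν (suc m) i d₀) (trans (trans (sym (iter-+ ν len′ i d₀)) (trans (cong at (+-comm len′ i)) (trans (iter-+ ν i len′ d₀) (cong (iter ν i) at-len)))) (trans e (cong (v ,_) (sym (τ-inv ok vu))))))))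

    -- Being traced is constant along trails, by `mono` therefore at each vertex, and by
    -- connectedness on the whole graph.
    all-traced : ∀ {u v} → u — v → Traced (u , v)
    all-traced {u} {v} uv = toWit (Traced? (u , v)) (trans (sym same) (fromWit (Traced? d₀) (trace 0 (inj₁ refl))))
      where
      f : D → Bool
      f d = ⌊ Traced? d ⌋
      flips : ∀ {u v} → u — v → f (u , v) ≡ f (v , u)
      flips {u} {v} _ = ⌊⌋-cong (Traced? (u , v)) (Traced? (v , u)) Traced-flip Traced-flip
      links′ : ∀ {v u} → every v ≡ true → v — u → f (v , u) ≡ f (v , τ σ v u)
      links′ {v} {u} _ vu = ⌊⌋-cong (Traced? (v , u)) (Traced? (v , τ σ v u)) (Traced-link vu)
        (λ t → subst (λ q → Traced (v , q)) (τ-inv ok vu) (Traced-link (τ-nbr ok vu) t))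
      reach : ∀ {a b} → Reach G (λ _ → false) a b → ∀ {c d} → a — c → b — d → f (a , c) ≡ f (b , d)
      reach reach-here ac bd = rep-elim every σ f flips links′ (mono _ ac bd)
      reach (reach-step ab _ p) ac bd = trans (rep-elim every σ f flips links′ (mono _ ac ab)) (trans (flips ab) (reach p (—-sym ab) bd))
      same : f d₀ ≡ f (u , v)
      same = reach (connected u₀ u) e₀ uv

    same-edge : ∀ {d e f} → d ≡ e → e ≡ f ⊎ e ≡ ρ f → SameEdge d f
    same-edge refl (inj₁ refl) = inj₁ (refl , refl)
    same-edge refl (inj₂ refl) = inj₂ (refl , refl)

    eulerian : IsEulerian C
    eulerian = circuit , λ u v uv → visited u v (all-traced uv)
      where
      visited : ∀ u v → Traced (u , v) → ∃[ i ] (i < suc m × SameEdge (edgeAt C i) (u , v))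
      visited u v (i , l , h) = i , l , same-edge (edgeAt-at i) h

    private
      p : ℕ → V
      p k = proj₁ (at k)
      pp : ∀ k → p k — p (suc k)
      pp k = at-adj k
      pτ : ∀ k → τ σ (p (suc k)) (p k) ≡ p (suc (suc k))
      pτ k = refl
      shift : ∀ i k → pos C (i + k) ≡ p (k + i)
      shift i k = trans (cong (pos C) (+-comm i k)) (pos-at (k + i))

    self-avoiding : LocallySelfAvoiding 4 C
    self-avoiding (i , ℓ , _ , ℓ≤4 , 1≤ℓ , _ , closed , diff) = go ℓ 1≤ℓ ℓ≤4 (trans (sym (pos-at i)) (trans closed (shift i ℓ))) λ a b a<ℓ b<ℓ e → diff a b a<ℓ b<ℓ (trans (shift i a) (trans e (sym (shift i b))))
      where
      go : ∀ ℓ → 1 ≤ ℓ → ℓ ≤ 4 → p i ≡ p (ℓ + i) → (∀ a b → a < ℓ → b < ℓ → p (a + i) ≡ p (b + i) → a ≡ b) → ⊥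
      go 1 _ _ e _ = —-≢ (pp i) e
      go 2 _ _ e _ = τ-≢ ok (—-sym (pp i)) (trans (pτ i) (sym e))
      -- The start p i takes the last place, where the transition is left open.
      go 3 _ _ e _ = Good.good₃ good {p (1 + i)} {p (2 + i)} {p i}
        ((pp (1 + i) , subst (p (2 + i) —_) (sym e) (pp (2 + i)) , pp i) , pτ i , trans (pτ (1 + i)) (sym e))
      go 4 _ _ e h = Good.good₄ good {p (1 + i)} {p (2 + i)} {p (3 + i)} {p i}
        ((pp (1 + i) , pp (2 + i) , subst (p (3 + i) —_) (sym e) (pp (3 + i)) , pp i ,
          (λ q → case h 1 3 (s≤s (s≤s z≤n)) (s≤s (s≤s (s≤s (s≤s z≤n)))) q of λ ()) , (λ q → case h 2 0 (s≤s (s≤s (s≤s z≤n))) (s≤s z≤n) q of λ ())) ,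
          pτ i , pτ (1 + i) , trans (pτ (2 + i)) (sym e))
      go (suc (suc (suc (suc (suc ℓ))))) _ (s≤s (s≤s (s≤s (s≤s ())))) _ _

  conclude : ∀ {σ} → Stable σ → Σ (Circuit G) (λ C → IsEulerian C × LocallySelfAvoiding 4 C)
  conclude {σ} st with saturate (count (straight? σ)) ≤-refl st
  ... | σ′ , st′ , m = Trace.C st′ m e₀ , Trace.eulerian st′ m e₀ , Trace.self-avoiding st′ m e₀
    where
    root : ∀ {k n} → k < n → Fin n
    root {n = suc n} _ = fz
    e₀ = proj₂ (some-nbr (root (proj₁ 3-connected)))

  -- Rings and their hubs

  four-nbrs : ∀ {v a b c d} → v — a → v — b → v — c → v — d → a ≢ b → a ≢ c → a ≢ d → b ≢ c → b ≢ d → c ≢ d →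
    ∀ {w} → v — w → w ∈ (a ∷ b ∷ c ∷ d ∷ [])
  four-nbrs {v} {a} {b} {c} {d} va vb vc vd ab ac ad bc bd cd {w} vw with w ∈? (a ∷ b ∷ c ∷ d ∷ [])
  ... | yes m = m
  ... | no ∉ = contradiction (subst (5 ≤_) (quartic v) (count-subset (a ∷ b ∷ c ∷ d ∷ w ∷ []) {adj G v}
      ( va , ∖-keep (ab ∘ sym) vb , ∖-keep (bc ∘ sym) (∖-keep (ac ∘ sym) vc)
      , ∖-keep (cd ∘ sym) (∖-keep (bd ∘ sym) (∖-keep (ad ∘ sym) vd))
      , ∖-keep (λ e → ∉ (4th e)) (∖-keep (λ e → ∉ (3rd e)) (∖-keep (λ e → ∉ (2nd e)) (∖-keep (λ e → ∉ (here e)) vw)))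
      , tt))) λ { (s≤s (s≤s (s≤s (s≤s ())))) }

  -- Closed straight subtrails of length four
  record Ring (a b c d : V) : Set where
    field
      ab : a — b
      bc : b — c
      cd : c — d
      da : d — a
      a≢c : a ≢ c
      b≢d : b ≢ d
      at-a : b ≡ r² a d
      at-b : c ≡ r² b a
      at-c : d ≡ r² c b
      at-d : a ≡ r² d c

    -- A chord would make abc a face, so that a and c are consecutive at b instead of opposite.
    no-ac : ¬ a — c
    no-ac ac = Next-¬opp (—-sym ab) bc (triangle-next ab bc (—-sym ac)) at-b

    no-bd : ¬ b — d
    no-bd bd = Next-¬opp (—-sym bc) cd (triangle-next bc cd (—-sym bd)) at-c

    On-ring : V → Set
    On-ring v = v ∈ (a ∷ b ∷ c ∷ d ∷ [])

    split : Σ (Split a b c d) λ S → Split.Cross S a d b × Split.Cross S b a c × Split.Cross S c b d × Split.Cross S d c a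
    split = Quad.ring-split ab bc cd da a≢c b≢d no-ac no-bd at-a at-b at-c

  rotate : ∀ {a b c d} → Ring a b c d → Ring b c d a
  rotate ρ = record { ab = bc ; bc = cd ; cd = da ; da = ab ; a≢c = b≢d ; b≢d = a≢c ∘ sym ; at-a = at-b ; at-b = at-c ; at-c = at-d ; at-d = at-a }
    where open Ring ρ

  reverse : ∀ {a b c d} → Ring a b c d → Ring c b a d
  reverse ρ = record { ab = —-sym bc ; bc = —-sym ab ; cd = —-sym da ; da = —-sym cd ; a≢c = a≢c ∘ sym ; b≢d = b≢d
    ; at-a = r²-sym (—-sym bc) at-c ; at-b = r²-sym (—-sym ab) at-b ; at-c = r²-sym (—-sym da) at-a ; at-d = r²-sym (—-sym cd) at-d }
    where open Ring ρ

  reverse-on : ∀ {a b c d v : V} → v ∈ (c ∷ b ∷ a ∷ d ∷ []) → v ∈ (a ∷ b ∷ c ∷ d ∷ [])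
  reverse-on (here e) = 3rd e
  reverse-on (2nd e) = 2nd e
  reverse-on (3rd e) = here e
  reverse-on (4th e) = 4th e

  rotate-on : ∀ {a b c d v : V} → v ∈ (b ∷ c ∷ d ∷ a ∷ []) → v ∈ (a ∷ b ∷ c ∷ d ∷ [])
  rotate-on (here e) = 2nd e
  rotate-on (2nd e) = 3rd e
  rotate-on (3rd e) = 4th e
  rotate-on (4th e) = here e

  hub-nbrs : ∀ {a b c d g} (ρ : Ring a b c d) → a — g → b — g → c — g → d — g → ∀ {w} → g — w → Ring.On-ring ρ w
  hub-nbrs ρ ag bg cg dg = four-nbrs (—-sym ag) (—-sym bg) (—-sym cg) (—-sym dg) (—-≢ ab) a≢c (—-≢ da ∘ sym) (—-≢ bc) b≢d (—-≢ cd)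
    where open Ring ρ

  -- The four-cycle b, a, d, e turns at b and is straight at a, so it is no face and a is no tip.
  -- Tips b and d would put c on both sides, and a crossing at d would make e equal to c. There
  -- remains the diamond, whose chord is ae.
  hub : ∀ {a b c d e} (ρ : Ring a b c d) → ¬ Ring.On-ring ρ e → b — e → d — e → a — e
  hub {a} {b} {c} {d} {e} ρ e∉ be de = go (tip-shape (—-sym ab) (—-sym da) de (—-sym be) b≢d (λ { refl → e∉ (here refl) }) next)
    where
    open Ring ρ
    next : Next b a e
    next = ¬opp-Next (—-sym ab) be (λ { refl → e∉ (here refl) }) λ h → e∉ (3rd (trans h (sym at-b)))
    not-next : ¬ Next a b d
    not-next h = Next-¬opp ab (—-sym da) h (r²-sym (—-sym da) at-a)
    go : TipShape b a d e → a — e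
    go (facial (inj₁ (p , _))) = contradiction (inj₁ (sym p)) not-next
    go (facial (inj₂ (p , _))) = contradiction (inj₂ (sym p)) not-next
    go (diamond ae _ _) = ae
    go (tips-xy _ _ S (_ , tb , td) _ _) = contradiction (trans (sym (proj₂ td (—-sym cd) c-off)) (proj₂ tb bc c-off)) not-≢
      where
      c-off : Split.Off S c
      c-off = —-≢ bc ∘ sym , a≢c ∘ sym , —-≢ cd , λ { refl → e∉ (3rd refl) }
    go (tips-xu _ _ S (_ , _ , ta) _ _) = contradiction (proj₁ ta) not-next
    go (tips-xw _ _ S _ _ cr) = contradiction (3rd (trans (proj₁ cr) (sym (r²-sym (—-sym cd) at-d)))) e∉

  hub-all : ∀ {a b c d e} (ρ : Ring a b c d) → ¬ Ring.On-ring ρ e → b — e → d — e → a — e × c — e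
  hub-all ρ e∉ be de = hub ρ e∉ be de , hub (reverse ρ) (e∉ ∘ reverse-on) be de

  module Octahedral {a b c d g h : V} (ρ : Ring a b c d) (g∉ : ¬ Ring.On-ring ρ g) (h∉ : ¬ Ring.On-ring ρ h) (g≢h : g ≢ h)
    (ag : a — g) (bg : b — g) (cg : c — g) (dg : d — g) (ah : a — h) (bh : b — h) (ch : c — h) (dh : d — h) where

    open Ring ρ

    private
      vec : Fin 6 → V
      vec fz = a
      vec (fs fz) = c
      vec (fs (fs fz)) = b
      vec (fs (fs (fs fz))) = d
      vec (fs (fs (fs (fs fz)))) = g
      vec (fs (fs (fs (fs (fs fz))))) = h

      out : ∀ {k} → ¬ k ∈ (a ∷ b ∷ c ∷ d ∷ []) → a ≢ k × b ≢ k × c ≢ k × d ≢ k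
      out k∉ = (λ e → k∉ (here (sym e))) , (λ e → k∉ (2nd (sym e))) , (λ e → k∉ (3rd (sym e))) , (λ e → k∉ (4th (sym e)))

      a≢b = —-≢ ab
      b≢c = —-≢ bc
      c≢d = —-≢ cd
      d≢a = —-≢ da
      a≢g = proj₁ (out g∉)
      b≢g = proj₁ (proj₂ (out g∉))
      c≢g = proj₁ (proj₂ (proj₂ (out g∉)))
      d≢g = proj₂ (proj₂ (proj₂ (out g∉)))
      a≢h = proj₁ (out h∉)
      b≢h = proj₁ (proj₂ (out h∉))
      c≢h = proj₁ (proj₂ (proj₂ (out h∉)))
      d≢h = proj₂ (proj₂ (proj₂ (out h∉)))

      no-gh : ¬ g — h
      no-gh gh = h∉ (hub-nbrs ρ ag bg cg dg gh)

      Hit : V → Set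
      Hit v = ∃[ i ] vec i ≡ v

      i0 i1 i2 i3 i4 i5 : Fin 6
      i0 = fz
      i1 = fs fz
      i2 = fs (fs fz)
      i3 = fs (fs (fs fz))
      i4 = fs (fs (fs (fs fz)))
      i5 = fs (fs (fs (fs (fs fz))))

      hit4 : ∀ {p q s t : Fin 6} {w} → w ∈ (vec p ∷ vec q ∷ vec s ∷ vec t ∷ []) → Hit w
      hit4 {p} (here e) = p , sym e
      hit4 {q = q} (2nd e) = q , sym e
      hit4 {s = s} (3rd e) = s , sym e
      hit4 {t = t} (4th e) = t , sym e

      closed : ∀ i {w} → vec i — w → Hit w
      closed fz aw = hit4 {i2} {i3} {i4} {i5} (four-nbrs ab (—-sym da) ag ah b≢d b≢g b≢h d≢g d≢h g≢h aw)
      closed (fs fz) cw = hit4 {i2} {i3} {i4} {i5} (four-nbrs (—-sym bc) cd cg ch b≢d b≢g b≢h d≢g d≢h g≢h cw)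
      closed (fs (fs fz)) bw = hit4 {i0} {i1} {i4} {i5} (four-nbrs (—-sym ab) bc bg bh a≢c a≢g a≢h c≢g c≢h g≢h bw)
      closed (fs (fs (fs fz))) dw = hit4 {i0} {i1} {i4} {i5} (four-nbrs da (—-sym cd) dg dh a≢c a≢g a≢h c≢g c≢h g≢h dw)
      closed (fs (fs (fs (fs fz)))) gw = hit4 {i0} {i2} {i1} {i3} (hub-nbrs ρ ag bg cg dg gw)
      closed (fs (fs (fs (fs (fs fz))))) hw = hit4 {i0} {i2} {i1} {i3} (hub-nbrs ρ ah bh ch dh hw)

      gaps : ∀ i → ¬ vec i — vec (antipode i)
      gaps fz = no-ac
      gaps (fs fz) = no-ac ∘ —-sym
      gaps (fs (fs fz)) = no-bd
      gaps (fs (fs (fs fz))) = no-bd ∘ —-sym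
      gaps (fs (fs (fs (fs fz)))) = no-gh
      gaps (fs (fs (fs (fs (fs fz))))) = no-gh ∘ —-sym

      apart : ∀ i → vec i ≢ vec (antipode i)
      apart fz = a≢c
      apart (fs fz) = a≢c ∘ sym
      apart (fs (fs fz)) = b≢d
      apart (fs (fs (fs fz))) = b≢d ∘ sym
      apart (fs (fs (fs (fs fz)))) = g≢h
      apart (fs (fs (fs (fs (fs fz))))) = g≢h ∘ sym

      edges : ∀ i j → adj octahedron i j ≡ true → vec i — vec j
      edges fz fz ()
      edges fz (fs fz) ()
      edges fz (fs (fs fz)) _ = ab
      edges fz (fs (fs (fs fz))) _ = —-sym da
      edges fz (fs (fs (fs (fs fz)))) _ = ag
      edges fz (fs (fs (fs (fs (fs fz))))) _ = ah
      edges (fs fz) fz ()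
      edges (fs fz) (fs fz) ()
      edges (fs fz) (fs (fs fz)) _ = —-sym bc
      edges (fs fz) (fs (fs (fs fz))) _ = cd
      edges (fs fz) (fs (fs (fs (fs fz)))) _ = cg
      edges (fs fz) (fs (fs (fs (fs (fs fz))))) _ = ch
      edges (fs (fs fz)) fz _ = —-sym ab
      edges (fs (fs fz)) (fs fz) _ = bc
      edges (fs (fs fz)) (fs (fs fz)) ()
      edges (fs (fs fz)) (fs (fs (fs fz))) ()
      edges (fs (fs fz)) (fs (fs (fs (fs fz)))) _ = bg
      edges (fs (fs fz)) (fs (fs (fs (fs (fs fz))))) _ = bh
      edges (fs (fs (fs fz))) fz _ = da
      edges (fs (fs (fs fz))) (fs fz) _ = —-sym cd
      edges (fs (fs (fs fz))) (fs (fs fz)) ()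
      edges (fs (fs (fs fz))) (fs (fs (fs fz))) ()
      edges (fs (fs (fs fz))) (fs (fs (fs (fs fz)))) _ = dg
      edges (fs (fs (fs fz))) (fs (fs (fs (fs (fs fz))))) _ = dh
      edges (fs (fs (fs (fs fz)))) fz _ = —-sym ag
      edges (fs (fs (fs (fs fz)))) (fs fz) _ = —-sym cg
      edges (fs (fs (fs (fs fz)))) (fs (fs fz)) _ = —-sym bg
      edges (fs (fs (fs (fs fz)))) (fs (fs (fs fz))) _ = —-sym dg
      edges (fs (fs (fs (fs fz)))) (fs (fs (fs (fs fz)))) ()
      edges (fs (fs (fs (fs fz)))) (fs (fs (fs (fs (fs fz))))) ()
      edges (fs (fs (fs (fs (fs fz))))) fz _ = —-sym ah
      edges (fs (fs (fs (fs (fs fz))))) (fs fz) _ = —-sym ch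
      edges (fs (fs (fs (fs (fs fz))))) (fs (fs fz)) _ = —-sym bh
      edges (fs (fs (fs (fs (fs fz))))) (fs (fs (fs fz))) _ = —-sym dh
      edges (fs (fs (fs (fs (fs fz))))) (fs (fs (fs (fs fz)))) ()
      edges (fs (fs (fs (fs (fs fz))))) (fs (fs (fs (fs (fs fz))))) ()

      table : ∀ i j → adj octahedron i j ≡ adj G (vec i) (vec j)
      table i j with adj octahedron i j in e | antipodal i j
      ... | true  | _ = sym (edges i j e)
      ... | false | inj₁ refl = sym (irrefl G (vec i))
      ... | false | inj₂ (inj₁ ())
      ... | false | inj₂ (inj₂ refl) = sym (bool-false (gaps i))

      injective : ∀ i j → vec i ≡ vec j → i ≡ j
      injective i j e with antipodal i j
      ... | inj₁ p = p
      ... | inj₂ (inj₁ p) = contradiction e (—-≢ (edges i j p))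
      ... | inj₂ (inj₂ refl) = contradiction e (apart i)

      cover : ∀ v → Hit v
      cover v = reach (connected a v) (fz , refl)
        where
        reach : ∀ {u v} → Reach G (λ _ → false) u v → Hit u → Hit v
        reach reach-here h = h
        reach (reach-step uw _ p) (i , refl) = reach p (closed i uw)

    -- The ring and two hubs use up the degrees of all six vertices, so no edge leaves them and
    -- connectedness makes them the whole graph.
    is-octahedron : Isomorphic G octahedron
    is-octahedron = mk↔ₛ′ (λ v → proj₁ (cover v)) vec (λ i → injective _ _ (proj₂ (cover (vec i)))) (λ v → proj₂ (cover v))
      , λ u v → trans (table (proj₁ (cover u)) (proj₁ (cover v))) (cong₂ (adj G) (proj₂ (cover u)) (proj₂ (cover v)))

  one-hub : ∀ {a b c d g h} (ρ : Ring a b c d) → ¬ Ring.On-ring ρ g → ¬ Ring.On-ring ρ h → b — g → d — g → b — h → d — h → g ≡ h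
  one-hub {g = g} {h} ρ g∉ h∉ bg dg bh dh with g ≟ h
  ... | yes e = e
  ... | no ne = let ag , cg = hub-all ρ g∉ bg dg ; ah , ch = hub-all ρ h∉ bh dh in
        contradiction (Octahedral.is-octahedron ρ g∉ h∉ ne ag bg cg dg ah bh ch dh) not-octahedron

  -- If the second ring crossed at a, then q and t would lie on different sides of the first, so
  -- their common neighbour s lies on it and must be c. Then q and t are two hubs, against
  -- `one-hub`.
  no-crossing : ∀ {a b c d q s t} (ρ : Ring a b c d) → Ring a q s t → q ≡ b ⊎ q ≡ d
  no-crossing {a} {b} {c} {d} {q} {s} {t} ρ κ with q ≟ b | q ≟ d
  ... | yes e | _ = inj₁ e
  ... | no _ | yes e = inj₂ e
  ... | no q≢b | no q≢d = ⊥-elim (go (s ∈? (a ∷ b ∷ c ∷ d ∷ [])))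
    where
    open Ring ρ
    module κ = Ring κ
    ta = —-sym κ.da
    t≡ : t ≡ r² a q
    t≡ = r²-sym ta κ.at-a
    b≡ : d ≡ r² a b
    b≡ = r²-sym (—-sym da) at-a
    t≢b : t ≢ b
    t≢b e = q≢d (trans κ.at-a (trans (cong (r² a) e) (sym b≡)))
    t≢d : t ≢ d
    t≢d e = q≢b (trans κ.at-a (trans (cong (r² a) e) (sym at-a)))
    off : ∀ {k} → a — k → k ≢ b → k ≢ d → ¬ k ∈ (a ∷ b ∷ c ∷ d ∷ [])
    off ak k≢b k≢d (here refl) = —-≢ ak refl
    off ak k≢b k≢d (2nd e) = k≢b e
    off ak k≢b k≢d (3rd refl) = no-ac ak
    off ak k≢b k≢d (4th e) = k≢d e
    q∉ = off κ.ab q≢b q≢d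
    t∉ = off ta t≢b t≢d
    go : Dec (s ∈ (a ∷ b ∷ c ∷ d ∷ [])) → ⊥
    go (yes (here refl)) = κ.a≢c refl
    go (yes (2nd refl)) = κ.no-ac ab
    go (yes (4th refl)) = κ.no-ac (—-sym da)
    go (yes (3rd refl)) = κ.b≢d (one-hub (rotate ρ) (q∉ ∘ rotate-on) (t∉ ∘ rotate-on) (—-sym κ.bc) κ.ab κ.cd ta)
    go (no s∉) = not-≢ (trans (sym opposite-sides) (trans (sym (Split.same S (κ.cd) (offs s∉) (offs t∉))) (Split.same S (—-sym κ.bc) (offs s∉) (offs q∉))))
      where
      S = proj₁ split
      cr = proj₁ (proj₂ split)
      offs : ∀ {k} → ¬ k ∈ (a ∷ b ∷ c ∷ d ∷ []) → Split.Off S k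
      offs h = (λ e → h (here e)) , (λ e → h (2nd e)) , (λ e → h (3rd e)) , (λ e → h (4th e))
      next : Next a d q
      next = ¬opp-Next (—-sym da) κ.ab (q≢d ∘ sym) λ e → q≢b (trans e (sym at-a))
      opposite-sides : Split.sd S t ≡ not (Split.sd S q)
      opposite-sides = trans (cong (Split.sd S) t≡) (proj₂ (proj₂ (cross-sides S cr (—-sym da) κ.ab next)))

  ring-front : ∀ {a b c d v} → Ring a b c d → v ∈ (a ∷ b ∷ c ∷ d ∷ []) →
    ∃[ p ] ∃[ q ] ∃[ s ] (Ring v p q s × (∀ {w} → w ∈ (v ∷ p ∷ q ∷ s ∷ []) → w ∈ (a ∷ b ∷ c ∷ d ∷ [])) × (∀ {w} → w ∈ (a ∷ b ∷ c ∷ d ∷ []) → w ∈ (v ∷ p ∷ q ∷ s ∷ [])))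
  ring-front ρ (here refl) = _ , _ , _ , ρ , (λ m → m) , (λ m → m)
  ring-front ρ (2nd refl) = _ , _ , _ , rotate ρ , rotate-on , rotate-on ∘ rotate-on ∘ rotate-on
  ring-front ρ (3rd refl) = _ , _ , _ , rotate (rotate ρ) , rotate-on ∘ rotate-on , rotate-on ∘ rotate-on
  ring-front ρ (4th refl) = _ , _ , _ , rotate (rotate (rotate ρ)) , rotate-on ∘ rotate-on ∘ rotate-on , rotate-on

  -- A ring always goes straight on, so a vertex and a direction determine it, and `no-crossing`
  -- leaves one direction.
  same-ring : ∀ {a b c d q s t u v} → Ring a b c d → Ring q s t u → v ∈ (a ∷ b ∷ c ∷ d ∷ []) → v ∈ (q ∷ s ∷ t ∷ u ∷ []) →
    ∀ {w} → w ∈ (q ∷ s ∷ t ∷ u ∷ []) → w ∈ (a ∷ b ∷ c ∷ d ∷ [])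
  same-ring ρ κ v∈ρ v∈κ {w} w∈κ with ring-front ρ v∈ρ | ring-front κ v∈κ
  ... | b , c , d , ρ′ , back , _ | s , t , u , κ′ , _ , forth = back (go (forth w∈κ))
    where
    module ρ′ = Ring ρ′
    module κ′ = Ring κ′
    go : ∀ {w} → w ∈ (_ ∷ s ∷ t ∷ u ∷ []) → w ∈ (_ ∷ b ∷ c ∷ d ∷ [])
    go (here e) = here e
    go (2nd refl) = case no-crossing ρ′ κ′ of λ { (inj₁ e) → 2nd e ; (inj₂ e) → 4th e }
    go (4th refl) = case no-crossing ρ′ (rotate (rotate (reverse κ′))) of λ { (inj₁ e) → 2nd e ; (inj₂ e) → 4th e }
    go (3rd refl) = case no-crossing ρ′ κ′ of λ where
      (inj₁ refl) → 3rd (trans κ′.at-b (sym ρ′.at-b))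
      (inj₂ refl) → 3rd (trans κ′.at-b (sym (r²-sym (—-sym ρ′.cd) ρ′.at-d)))

  -- The invariant while rings are being destroyed

  -- A turned pair of opposite ring vertices, together with the hub of the ring if it has one
  record Anchor (σ : State) (v : V) : Set where
    field
      {y₁ y₂ y₃ y₄} : V
      ring : Ring y₁ y₂ y₃ y₄
      s₁ : σ y₁ ≡ nothing
      s₃ : σ y₃ ≡ nothing
      t₂ : σ y₂ ≢ nothing
      place : v ≡ y₂ ⊎ v ≡ y₄ ⊎ (y₁ — v × y₂ — v × y₃ — v × y₄ — v)

  -- Becomes `Stable` once no straight ring is left. `anchored` records why a vertex was turned,
  -- which controls the turned vertices met near another ring.
  record Partial (σ : State) : Set where
    field
      ok    : Valid σ
      mono  : ∀ {v} → σ v ≢ nothing → Mono σ v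
      good₃ : ∀ {a b c} → ¬ Bad₃ σ a b c
      rings : ∀ {a b c d} → Bad₄ σ a b c d → σ a ≡ nothing × σ b ≡ nothing × σ c ≡ nothing × σ d ≡ nothing
      anchored : ∀ {v} → σ v ≢ nothing → Anchor σ v

  bad-ring : ∀ {σ a b c d} → Bad₄ σ a b c d → σ a ≡ nothing → σ b ≡ nothing → σ c ≡ nothing → Ring a b c d
  bad-ring {σ} {a} {b} {c} {d} ((ab , bc , cd , da , a≢c , b≢d) , e , f , g) sa sb sc = record
    { ab = ab ; bc = bc ; cd = cd ; da = da ; a≢c = a≢c ; b≢d = b≢d ; at-a = at-a ; at-b = at-b ; at-c = at-c
    ; at-d = proj₁ (proj₂ (proj₂ (proj₂ (proj₂ (Quad.ring-split ab bc cd da a≢c b≢d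
        (λ ac → Next-¬opp (—-sym ab) bc (triangle-next ab bc (—-sym ac)) at-b) (λ bd → Next-¬opp (—-sym bc) cd (triangle-next bc cd (—-sym bd)) at-c) at-a at-b at-c))))) }
    where
    at-a : b ≡ r² a d
    at-a = trans (sym e) (τ-straight {σ} sa d)
    at-b : c ≡ r² b a
    at-b = trans (sym f) (τ-straight {σ} sb a)
    at-c : d ≡ r² c b
    at-c = trans (sym g) (τ-straight {σ} sc b)

  -- The name of the turn that pairs p with q: whichever of them precedes the other in the rotation.
  base : ∀ {v p q} → Next v p q → V
  base {p = p} (inj₁ _) = p
  base {q = q} (inj₂ _) = q

  base-nbr : ∀ {v p q} → v — p → v — q → (nx : Next v p q) → v — base nx
  base-nbr vp vq (inj₁ _) = vp
  base-nbr vp vq (inj₂ _) = vq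

  module Paired {σ : State} {v p q : V} (vp : v — p) (vq : v — q) (nx : Next v p q) (e : σ v ≡ just (base nx)) where

    private
      at : ∀ {u w} → pair v (just (base nx)) u ≡ w → τ σ v u ≡ w
      at {u} h = trans (cong (λ s → pair v s u) e) h

    τp : τ σ v p ≡ q
    τp = at (go nx)
      where
      go : (nx : Next v p q) → pair v (just (base nx)) p ≡ q
      go (inj₁ refl) = pair-a p
      go (inj₂ refl) = pair-r vq

    τq : τ σ v q ≡ p
    τq = at (go nx)
      where
      go : (nx : Next v p q) → pair v (just (base nx)) q ≡ p
      go (inj₁ refl) = pair-r vp
      go (inj₂ refl) = pair-a q

    τp′ : τ σ v (r² v p) ≡ r² v q
    τp′ = at (go nx)
      where
      go : (nx : Next v p q) → pair v (just (base nx)) (r² v p) ≡ r² v q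
      go (inj₁ refl) = pair-r² p
      go (inj₂ refl) = pair-r³ vq

    τq′ : τ σ v (r² v q) ≡ r² v p
    τq′ = at (go nx)
      where
      go : (nx : Next v p q) → pair v (just (base nx)) (r² v q) ≡ r² v p
      go (inj₁ refl) = pair-r³ vp
      go (inj₂ refl) = pair-r² q

    paired-unblocked : ¬ Blocked σ v p q → ¬ Blocked σ v (r² v p) (r² v q) → Unblocked σ v
    paired-unblocked h k {u} vu b with four vp vq nx vu
    ... | inj₁ refl = h (subst (Blocked σ v p) τp b)
    ... | inj₂ (inj₁ refl) = k (subst (Blocked σ v (r² v p)) τp′ b)
    ... | inj₂ (inj₂ (inj₁ refl)) = h (Blocked-sym (subst (Blocked σ v q) τq b))
    ... | inj₂ (inj₂ (inj₂ refl)) = k (Blocked-sym (subst (Blocked σ v (r² v q)) τq′ b))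

    paired-mono : σ ⊢ (v , p) ≈ (v , r² v p) → Mono σ v
    paired-mono h vu vw = trans (to vu) (sym (to vw))
      where
      link : σ ⊢ (v , p) ≈ (v , q)
      link = subst (λ w → σ ⊢ (v , p) ≈ (v , w)) τp (rep-link every σ refl vp)
      link′ : σ ⊢ (v , r² v p) ≈ (v , r² v q)
      link′ = subst (λ w → σ ⊢ (v , r² v p) ≈ (v , w)) τp′ (rep-link every σ refl (r²-nbr vp))
      to : ∀ {u} → v — u → σ ⊢ (v , u) ≈ (v , p)
      to vu with four vp vq nx vu
      ... | inj₁ refl = refl
      ... | inj₂ (inj₁ refl) = sym h
      ... | inj₂ (inj₂ (inj₁ refl)) = sym link
      ... | inj₂ (inj₂ (inj₂ refl)) = sym (trans h link′)

  -- All neighbours of a hub are on its ring. At a turned ring vertex the opposite neighbours y₁ and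
  -- y₃ alternate with the other two, so each pair of a turn contains one of them.
  anchor-corner : ∀ {σ v u} → Valid σ → (A : Anchor σ v) → σ v ≢ nothing → v — u →
    (u ∈ (Anchor.y₁ A ∷ Anchor.y₂ A ∷ Anchor.y₃ A ∷ Anchor.y₄ A ∷ [])) ⊎ (τ σ v u ∈ (Anchor.y₁ A ∷ Anchor.y₂ A ∷ Anchor.y₃ A ∷ Anchor.y₄ A ∷ []) × σ (τ σ v u) ≡ nothing)
  anchor-corner {σ} {v} {u} ok A t vu = go (Anchor.place A)
    where
    open Anchor A
    open Ring ring
    next : Next v u (τ σ v u)
    next with σ v in eq
    ... | nothing = contradiction refl t
    ... | just a = pair-next (ok eq) vu
    w = τ σ v u
    vw : v — w
    vw = τ-nbr ok vu
    straight-pair : ∀ {p q} → v — p → q ≡ r² v p → u ≢ p → u ≢ q → w ≡ p ⊎ w ≡ q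
    straight-pair {p} {q} vp q≡ u≢p u≢q with position vp vu | position vp vw
    ... | at0 e | _ = contradiction e u≢p
    ... | at2 e | _ = contradiction (trans e (sym q≡)) u≢q
    ... | _ | at0 e = inj₁ e
    ... | _ | at2 e = inj₂ (trans e (sym q≡))
    ... | at1 e | at1 e′ = contradiction (trans e′ (sym e)) (τ-≢ ok vu)
    ... | at3 e | at3 e′ = contradiction (trans e′ (sym e)) (τ-≢ ok vu)
    ... | at1 e | at3 e′ = contradiction (trans e′ (cong (r² v) (sym e))) (Next-¬opp vu vw next)
    ... | at3 e | at1 e′ = contradiction (trans (trans e′ (sym (r⁴ (r-nbr vp)))) (cong (r² v) (sym e))) (Next-¬opp vu vw next)
    go : v ≡ y₂ ⊎ v ≡ y₄ ⊎ (y₁ — v × y₂ — v × y₃ — v × y₄ — v) → _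
    go (inj₁ refl) with u ≟ y₁ | u ≟ y₃
    ... | yes e | _ = inj₁ (here e)
    ... | no _ | yes e = inj₁ (3rd e)
    ... | no n₁ | no n₃ with straight-pair (—-sym ab) at-b n₁ n₃
    ...   | inj₁ e = inj₂ (here e , subst (λ k → σ k ≡ nothing) (sym e) s₁)
    ...   | inj₂ e = inj₂ (3rd e , subst (λ k → σ k ≡ nothing) (sym e) s₃)
    go (inj₂ (inj₁ refl)) with u ≟ y₁ | u ≟ y₃
    ... | yes e | _ = inj₁ (here e)
    ... | no _ | yes e = inj₁ (3rd e)
    ... | no n₁ | no n₃ with straight-pair (—-sym cd) at-d n₃ n₁
    ...   | inj₁ e = inj₂ (3rd e , subst (λ k → σ k ≡ nothing) (sym e) s₃)
    ...   | inj₂ e = inj₂ (here e , subst (λ k → σ k ≡ nothing) (sym e) s₁)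
    go (inj₂ (inj₂ (h₁ , h₂ , h₃ , h₄))) = inj₁ (hub-nbrs ring h₁ h₂ h₃ h₄ vu)

  module AtRing {σ : State} (pt : Partial σ) {a b c d : V} (ρ : Ring a b c d)
    (sa : σ a ≡ nothing) (sb : σ b ≡ nothing) (sc : σ c ≡ nothing) (sd : σ d ≡ nothing) where

    open Partial pt
    open Ring ρ using (ab; bc; cd; da; a≢c; b≢d; at-a; at-b; at-c; at-d; no-ac; no-bd; On-ring)

    on-straight : ∀ {v} → On-ring v → σ v ≡ nothing
    on-straight (here refl) = sa
    on-straight (2nd refl) = sb
    on-straight (3rd refl) = sc
    on-straight (4th refl) = sd

    -- The anchor's ring has the turned vertex y₂ while ρ is straight throughout, so they are
    -- different rings.
    disjoint : ∀ {v w} (A : Anchor σ v) → w ∈ (Anchor.y₁ A ∷ Anchor.y₂ A ∷ Anchor.y₃ A ∷ Anchor.y₄ A ∷ []) → ¬ On-ring w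
    disjoint A w∈ w∈ρ = Anchor.t₂ A (on-straight (same-ring ρ (Anchor.ring A) w∈ρ w∈ (2nd refl)))

    -- The neighbour u on ρ is off the anchor's ring, so the other half of the pair is one of its
    -- straight vertices.
    use₂ : ∀ {v u} → σ v ≢ nothing → v — u → On-ring u → σ (τ σ v u) ≡ nothing × ¬ On-ring (τ σ v u)
    use₂ t vu u∈ with anchor-corner ok (anchored t) t vu
    ... | inj₁ m = contradiction u∈ (disjoint (anchored t) m)
    ... | inj₂ (m , s) = s , disjoint (anchored t) m

    module _ {σ′ : State} (sa′ : σ′ a ≡ nothing) {e : V} (be : b — e) (e∉ : ¬ On-ring e) (ed : ¬ e — d) (same-e : σ′ e ≡ σ e)
      (same-m : ∀ {m} → ¬ On-ring m → m — e → σ′ m ≡ σ m) where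

      private
        a≢e : a ≢ e
        a≢e refl = e∉ (here refl)
        next : Next b a e
        next = ¬opp-Next (—-sym ab) be a≢e λ h → e∉ (3rd (trans h (sym at-b)))
        d≡ : d ≡ r² a b
        d≡ = r²-sym (—-sym da) at-a
        τa : τ σ′ a b ≡ d
        τa = trans (τ-straight {σ′} sa′ b) (sym d≡)
        τe : ∀ {u} → τ σ′ e u ≡ τ σ e u
        τe {u} = cong (λ s → pair e s u) same-e

      -- The trail passes a straight to d, which is not adjacent to e, so a short subtrail would go
      -- on through e. There `use₂` excludes the triangle and the face, and the remaining shapes
      -- would make a cross to m or put the adjacent vertices c and d on opposite sides.
      ring-corner : ¬ Blocked σ′ b a e
      ring-corner (b₃ ae (inj₁ h)) = e∉ (4th (trans (sym h) τa))
      ring-corner (b₃ ae (inj₂ h)) = case ≡M-dec _≟_ (σ e) nothing of λ where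
          (yes s) → Next-¬opp (—-sym be) (—-sym ae) (triangle-next be (—-sym ae) ab) (trans (sym (trans (sym τe) h)) (τ-straight {σ} s b))
          (no t) → proj₂ (use₂ t (—-sym be) (2nd refl)) (here (trans (sym τe) h))
      ring-corner (b-uy m am me m≢b h _) = ed (—-sym (subst (_— e) (trans (sym h) τa) me))
      ring-corner (b-uw m am me m≢b h _) = ed (—-sym (subst (_— e) (trans (sym h) τa) me))
      ring-corner (b-yw m am me m≢b h k) = go (tip-shape (—-sym ab) am me (—-sym be) (m≢b ∘ sym) a≢e next)
        where
        m∉ : ¬ On-ring m
        m∉ (here refl) = —-≢ am refl
        m∉ (2nd e) = m≢b e
        m∉ (3rd refl) = no-ac am
        m∉ (4th refl) = ed (—-sym me)
        τm : τ σ m e ≡ a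
        τm = trans (cong (λ s → pair m s e) (sym (same-m m∉ me))) k
        τeb : τ σ e b ≡ m
        τeb = trans (sym τe) h
        not-cross : m ≢ r² a b
        not-cross e = m∉ (4th (trans e (sym d≡)))
        go : TipShape b a m e → ⊥
        go (facial q) = contradiction m-straight m-turned
          where
          e-next : Next e b m
          e-next = case q of λ { (inj₁ (_ , _ , p , _)) → inj₂ (sym p) ; (inj₂ (_ , _ , p , _)) → inj₁ (sym p) }
          m-next : Next m e a
          m-next = case q of λ { (inj₁ (_ , p , _)) → inj₂ (sym p) ; (inj₂ (_ , p , _)) → inj₁ (sym p) }
          e-turned : σ e ≢ nothing
          e-turned s = Next-¬opp (—-sym be) (—-sym me) e-next (trans (sym τeb) (τ-straight {σ} s b))
          m-straight : σ m ≡ nothing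
          m-straight = subst (λ k → σ k ≡ nothing) τeb (proj₁ (use₂ e-turned (—-sym be) (2nd refl)))
          m-turned : σ m ≢ nothing
          m-turned s = Next-¬opp me (—-sym am) m-next (trans (sym τm) (τ-straight {σ} s e))
        go (diamond _ p _) = not-cross p
        go (tips-xy _ _ S _ cr _) = not-cross (proj₁ cr)
        go (tips-xw _ _ S _ cr _) = not-cross (proj₁ cr)
        go (tips-xu _ _ S (_ , tb , ta) _ _) = not-≢ (trans (sym (proj₂ ta (—-sym da) d-off)) (trans (sym (Split.same S cd c-off d-off)) (proj₂ tb bc c-off)))
          where
          c-off : Split.Off S c
          c-off = —-≢ bc ∘ sym , a≢c ∘ sym , (λ { refl → m∉ (3rd refl) }) , (λ { refl → e∉ (3rd refl) })
          d-off : Split.Off S d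
          d-off = b≢d ∘ sym , —-≢ da , (λ { refl → m∉ (4th refl) }) , (λ { refl → e∉ (4th refl) })

  -- Destroying one ring

  module RowNext (X : V → Bool) (σ : State) (ok : Valid σ) (d : D) where

    open Ends X σ ok d

    row-next : ∀ {v p q} → v — p → v — q → Next v p q → row v ≡ K v p xor (K v q xor (K v (r² v p) xor K v (r² v q)))
    row-next vp vq (inj₁ refl) = row-at vp
    row-next {v} {q = q} vp vq (inj₂ refl) = trans (row-at vq) (swap₂ (K v q) (K v (r v q)) (K v (r² v q)) (K v (r³ v q)))
      where
      swap₂ : ∀ x y z w → x xor (y xor (z xor w)) ≡ y xor (x xor (w xor z))
      swap₂ x y z w = trans (sym (xor-assoc x y _)) (trans (cong₂ _xor_ (xor-comm x y) (xor-comm z w)) (xor-assoc y x _))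

  r²-inj : ∀ {v p q} → v — p → v — q → r² v p ≡ r² v q → p ≡ q
  r²-inj {v} vp vq h = trans (sym (r⁴ vp)) (trans (cong (r² v) h) (r⁴ vq))

  Fixed : State → V → Set
  Fixed σ b = ∃[ σ′ ] (Partial σ′ × (∀ v → σ′ v ≡ nothing → σ v ≡ nothing) × σ′ b ≢ nothing)

  module Finish {σ : State} (pt : Partial σ) {a b c d : V} (ρ : Ring a b c d)
    (sa : σ a ≡ nothing) (sb : σ b ≡ nothing) (sc : σ c ≡ nothing) (sd : σ d ≡ nothing)
    (X : List V) {σ′ : State} (agree : ∀ {v} → ¬ v ∈ X → σ′ v ≡ σ v)
    (place : ∀ {v} → v ∈ X → v ≡ b ⊎ v ≡ d ⊎ (¬ Ring.On-ring ρ v × a — v × b — v × c — v × d — v)) (b∈X : b ∈ X) (d∈X : d ∈ X)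
    (turned : ∀ {v} → v ∈ X → σ′ v ≢ nothing)
    (ok′ : Valid σ′) (free : ∀ {v} → v ∈ X → Unblocked σ′ v) (mono′ : ∀ {v} → v ∈ X → Mono σ′ v) where

    open Partial pt
    open Ring ρ using (ab; bc; cd; da; a≢c; b≢d; no-ac; On-ring)
    open AtRing pt ρ sa sb sc sd using (disjoint)

    private
      each : ∀ v → σ′ v ≡ σ v ⊎ Unblocked σ′ v
      each v with v ∈? X
      ... | yes m = inj₂ (free m)
      ... | no m = inj₁ (agree m)

      coarser : ∀ {d e} → σ ⊢ d ≈ e → σ′ ⊢ d ≈ e
      coarser = patch (On X) σ σ′ (λ f → agree (out-on f)) λ t vu → mono′ (in-on t) vu (τ-nbr ok vu)

      a∉X : ¬ a ∈ X
      a∉X m with place m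
      ... | inj₁ refl = —-≢ ab refl
      ... | inj₂ (inj₁ refl) = —-≢ da refl
      ... | inj₂ (inj₂ (∉ , _)) = ∉ (here refl)

      c∉X : ¬ c ∈ X
      c∉X m with place m
      ... | inj₁ refl = —-≢ bc refl
      ... | inj₂ (inj₁ refl) = —-≢ cd refl
      ... | inj₂ (inj₂ (∉ , _)) = ∉ (3rd refl)

      hub-nbr : ∀ {v w} → a — v × b — v × c — v × d — v → v — w → On-ring w
      hub-nbr (av , bv , cv , dv) = hub-nbrs ρ av bv cv dv

      straight∉ : ∀ {v} → σ′ v ≡ nothing → ¬ v ∈ X
      straight∉ s m = turned m s

      off-anchor : ∀ {v y y′} (A : Anchor σ v) → y ∈ (Anchor.y₁ A ∷ Anchor.y₂ A ∷ Anchor.y₃ A ∷ Anchor.y₄ A ∷ []) →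
        y′ ∈ (Anchor.y₁ A ∷ Anchor.y₂ A ∷ Anchor.y₃ A ∷ Anchor.y₄ A ∷ []) → y — y′ → ¬ y ∈ X
      off-anchor A y∈ y′∈ yy′ m with place m
      ... | inj₁ refl = disjoint A y∈ (2nd refl)
      ... | inj₂ (inj₁ refl) = disjoint A y∈ (4th refl)
      ... | inj₂ (inj₂ (_ , h)) = disjoint A y′∈ (hub-nbr h yy′)

      same-anchor : ∀ {v} → Anchor σ v → Anchor σ′ v
      same-anchor A = record
        { ring = A.ring
        ; s₁ = trans (agree (off-anchor A (here refl) (2nd refl) (Ring.ab A.ring))) A.s₁
        ; s₃ = trans (agree (off-anchor A (3rd refl) (2nd refl) (—-sym (Ring.bc A.ring)))) A.s₃
        ; t₂ = λ s → A.t₂ (trans (sym (agree (off-anchor A (2nd refl) (here refl) (—-sym (Ring.ab A.ring))))) s)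
        ; place = A.place }
        where module A = Anchor A

      corner : ∀ {v} → On-ring v → ¬ v ∈ X → v ≡ a ⊎ v ≡ c
      corner (here e) _ = inj₁ e
      corner (2nd refl) h = contradiction b∈X h
      corner (3rd e) _ = inj₂ e
      corner (4th refl) h = contradiction d∈X h

      corners : ∀ {p q} → On-ring p → On-ring q → ¬ p ∈ X → ¬ q ∈ X → ¬ p — q
      corners p∈ q∈ p∉ q∉ pq with corner p∈ p∉ | corner q∈ q∉
      ... | inj₁ refl | inj₁ refl = —-≢ pq refl
      ... | inj₁ refl | inj₂ refl = no-ac pq
      ... | inj₂ refl | inj₁ refl = no-ac (—-sym pq)
      ... | inj₂ refl | inj₂ refl = —-≢ pq refl

      -- With t equal to b or d the ring would be ρ, whose vertices outside X, a and c, are not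
      -- adjacent as p and q are. With t the hub, p would lie on ρ, so the ring would again be ρ,
      -- which does not contain the hub.
      closing : ∀ {p q s t} → Ring p q s t → ¬ p ∈ X → ¬ q ∈ X → ¬ t ∈ X
      closing κ p∉ q∉ m with place m
      ... | inj₁ refl = corners (inside (here refl)) (inside (2nd refl)) p∉ q∉ (Ring.ab κ)
        where inside = same-ring ρ κ (2nd refl) (4th refl)
      ... | inj₂ (inj₁ refl) = corners (inside (here refl)) (inside (2nd refl)) p∉ q∉ (Ring.ab κ)
        where inside = same-ring ρ κ (4th refl) (4th refl)
      ... | inj₂ (inj₂ (∉ , h)) = ∉ (same-ring ρ κ (hub-nbr h (Ring.da κ)) (here refl) (4th refl))

    finish : Partial σ′
    finish = record
      { ok = ok′
      ; mono = mono″
      ; good₃ = λ bad → good₃ (bad₃-unchanged ok′ each bad)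
      ; rings = rings′
      ; anchored = anchored′ }
      where
      mono″ : ∀ {v} → σ′ v ≢ nothing → Mono σ′ v
      mono″ {v} t with v ∈? X
      ... | yes m = mono′ m
      ... | no m = λ vu vw → coarser (mono (λ s → t (trans (agree m) s)) vu vw)
      anchored′ : ∀ {v} → σ′ v ≢ nothing → Anchor σ′ v
      anchored′ {v} t with v ∈? X
      ... | no m = same-anchor (anchored λ s → t (trans (agree m) s))
      ... | yes m = record
          { ring = ρ ; s₁ = trans (agree a∉X) sa ; s₃ = trans (agree c∉X) sc ; t₂ = turned b∈X
          ; place = case place m of λ { (inj₁ e) → inj₁ e ; (inj₂ (inj₁ e)) → inj₂ (inj₁ e) ; (inj₂ (inj₂ (_ , h))) → inj₂ (inj₂ h) } }
      rings′ : ∀ {p q s t} → Bad₄ σ′ p q s t → σ′ p ≡ nothing × σ′ q ≡ nothing × σ′ s ≡ nothing × σ′ t ≡ nothing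
      rings′ {p} {q} {s} {t} bad with bad₄-unchanged ok′ each bad
      ... | bad₀ , ep , eq , es with rings bad₀
      ...   | np , nq , ns , nt = sp , sq , trans es ns , trans (agree (closing (bad-ring {σ′} bad sp sq (trans es ns)) (straight∉ sp) (straight∉ sq))) nt
        where
        sp = trans ep np
        sq = trans eq nq

    fixed : Fixed σ b
    fixed = σ′ , finish , (λ v s → trans (sym (agree (straight∉ s))) s) , turned b∈X

  module Hubless {σ : State} (pt : Partial σ) {a b c d : V} (ρ : Ring a b c d)
    (sa : σ a ≡ nothing) (sb : σ b ≡ nothing) (sc : σ c ≡ nothing) (sd : σ d ≡ nothing)
    (hubless : ∀ {k} → ¬ Ring.On-ring ρ k → b — k → ¬ k — d) where

    open Partial pt
    open Ring ρ

    X : List V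
    X = b ∷ d ∷ []

    infix 4 _≃_
    _≃_ : D → D → Set
    d ≃ e = rep (not ∘ On X) σ d ≡ rep (not ∘ On X) σ e

    a∉X : ¬ a ∈ X
    a∉X (here refl) = —-≢ ab refl
    a∉X (2nd refl) = —-≢ da refl

    c∉X : ¬ c ∈ X
    c∉X (here refl) = —-≢ bc refl
    c∉X (2nd refl) = —-≢ cd refl

    d≡ : d ≡ r² a b
    d≡ = r²-sym (—-sym da) at-a

    off-ring : ∀ {k} → b — k → k ≢ a → k ≢ c → ¬ On-ring k
    off-ring bk k≢a k≢c (here e) = k≢a e
    off-ring bk k≢a k≢c (2nd refl) = —-≢ bk refl
    off-ring bk k≢a k≢c (3rd e) = k≢c e
    off-ring bk k≢a k≢c (4th refl) = no-bd bk

    off-ring′ : ∀ {k} → d — k → k ≢ a → k ≢ c → ¬ On-ring k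
    off-ring′ dk k≢a k≢c (here e) = k≢a e
    off-ring′ dk k≢a k≢c (4th refl) = —-≢ dk refl
    off-ring′ dk k≢a k≢c (3rd e) = k≢c e
    off-ring′ dk k≢a k≢c (2nd refl) = no-bd (—-sym dk)

    -- At b the ring edges to a and c are paired with e and f, at d with q and p. Each of the three
    -- links joins the trail through a to the one through c.
    module Turn {e q : V} (be : b — e) (dq : d — q) (nb : Next b a e) (nd : Next d a q)
      (link : (b , e) ≃ (b , r² b e) ⊎ (b , e) ≃ (d , r² d q) ⊎ (b , r² b e) ≃ (d , q)) where

      f p : V
      f = r² b e
      p = r² d q
      bf = r²-nbr be
      dp = r²-nbr dq

      σ₁ σ′ : State
      σ₁ = σ [ b ≔ base nb ]
      σ′ = σ₁ [ d ≔ base nd ]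

      at-σb : σ′ b ≡ just (base nb)
      at-σb = trans (≔-other {σ₁} {d} {base nd} b≢d) (≔-at {σ} {b} {base nb})
      at-σd : σ′ d ≡ just (base nd)
      at-σd = ≔-at {σ₁} {d} {base nd}

      agree : ∀ {v} → ¬ v ∈ X → σ′ v ≡ σ v
      agree h = trans (≔-other {σ₁} {d} {base nd} λ e → h (2nd e)) (≔-other {σ} {b} {base nb} λ e → h (here e))

      ba = —-sym ab
      module Pb = Paired {σ′} ba be nb at-σb
      module Pd = Paired {σ′} da dq nd at-σd

      ok′ : Valid σ′
      ok′ = ≔-valid {σ₁} {d} {base nd} (≔-valid {σ} {b} {base nb} ok (base-nbr ba be nb)) (base-nbr da dq nd)

      e∉ : ¬ On-ring e
      e∉ = off-ring be (Next-≢ ba be nb ∘ sym) λ h → Next-¬opp ba be nb (trans h at-b)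
      f∉ : ¬ On-ring f
      f∉ = off-ring bf (λ h → Next-¬opp be ba (Next-sym nb) (sym h)) λ h → Next-≢ ba be nb (r²-inj ba be (trans (sym at-b) (sym h)))
      c≡ : c ≡ r² d a
      c≡ = r²-sym (—-sym cd) at-d
      q∉ : ¬ On-ring q
      q∉ = off-ring′ dq (Next-≢ da dq nd ∘ sym) λ h → Next-¬opp da dq nd (trans h c≡)
      p∉ : ¬ On-ring p
      p∉ = off-ring′ dp (λ h → Next-¬opp dq da (Next-sym nd) (sym h)) λ h → Next-≢ da dq nd (r²-inj da dq (trans (sym c≡) (sym h)))

      sa′ = trans (agree a∉X) sa
      sc′ = trans (agree c∉X) sc

      unchanged : ∀ {v} → ¬ On-ring v → σ′ v ≡ σ v
      unchanged h = agree λ { (here e) → h (2nd e) ; (2nd e) → h (4th e) }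

      free-b : Unblocked σ′ b
      free-b = Pb.paired-unblocked
        (AtRing.ring-corner pt ρ sa sb sc sd {σ′} sa′ be e∉ (hubless e∉ be) (unchanged e∉) (λ m∉ _ → unchanged m∉))
        (subst (λ k → ¬ Blocked σ′ b k f) at-b
          (AtRing.ring-corner pt (reverse ρ) sc sb sa sd {σ′} sc′ bf (f∉ ∘ reverse-on) (hubless f∉ bf) (unchanged f∉) (λ m∉ _ → unchanged (m∉ ∘ reverse-on))))

      free-d : Unblocked σ′ d
      free-d = Pd.paired-unblocked
        (AtRing.ring-corner pt (rotate (rotate (reverse ρ))) sa sd sc sb {σ′} sa′ dq (q∉ ∘ reverse-on ∘ rotate-on ∘ rotate-on) (λ qb → hubless q∉ (—-sym qb) (—-sym dq)) (unchanged q∉) (λ m∉ _ → unchanged (m∉ ∘ rotate-on ∘ rotate-on ∘ reverse-on)))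
        (subst (λ k → ¬ Blocked σ′ d k p) c≡
          (AtRing.ring-corner pt (rotate (rotate ρ)) sc sd sa sb {σ′} sc′ dp (p∉ ∘ rotate-on ∘ rotate-on) (λ pb → hubless p∉ (—-sym pb) (—-sym dp)) (unchanged p∉) (λ m∉ _ → unchanged (m∉ ∘ rotate-on ∘ rotate-on))))

      infix 4 _≈_
      _≈_ : D → D → Set
      d ≈ e = σ′ ⊢ d ≈ e

      via : ∀ {v u w} → v — u → τ σ′ v u ≡ w → (v , u) ≈ (v , w)
      via vu refl = rep-link every σ′ refl vu

      ba≈da : (b , a) ≈ (d , a)
      ba≈da = rep-across every σ′ refl sa′ ba (—-sym da) d≡
      bc≈dc : (b , c) ≈ (d , c)
      bc≈dc = rep-across every σ′ refl sc′ bc cd at-c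
      ba≈be : (b , a) ≈ (b , e)
      ba≈be = via ba Pb.τp
      bc≈bf : (b , c) ≈ (b , f)
      bc≈bf = via bc (trans (cong (τ σ′ b) at-b) Pb.τp′)
      da≈dq : (d , a) ≈ (d , q)
      da≈dq = via da Pd.τp
      dc≈dp : (d , c) ≈ (d , p)
      dc≈dp = via (—-sym cd) (trans (cong (τ σ′ d) c≡) Pd.τp′)

      lift : ∀ {d e} → d ≃ e → d ≈ e
      lift = partial (On X) σ σ′ (λ g → agree (out-on g))

      ba≈bc : (b , a) ≈ (b , c)
      ba≈bc = case link of λ where
        (inj₁ h) → trans ba≈be (trans (lift h) (sym bc≈bf))
        (inj₂ (inj₁ h)) → trans ba≈be (trans (lift h) (trans (sym dc≈dp) (sym bc≈dc)))
        (inj₂ (inj₂ h)) → trans ba≈da (trans da≈dq (trans (sym (lift h)) (sym bc≈bf)))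

      mono-b : Mono σ′ b
      mono-b = Pb.paired-mono (subst (λ k → (b , a) ≈ (b , k)) at-b ba≈bc)

      mono-d : Mono σ′ d
      mono-d = Pd.paired-mono (subst (λ k → (d , a) ≈ (d , k)) c≡ (trans (sym ba≈da) (trans ba≈bc bc≈dc)))

      turned-fixed : Fixed σ b
      turned-fixed = Finish.fixed pt ρ sa sb sc sd X {σ′} agree
        (λ { (here e) → inj₁ e ; (2nd e) → inj₂ (inj₁ e) }) (here refl) (2nd refl)
        (λ { (here refl) s → case trans (sym s) at-σb of λ () ; (2nd refl) s → case trans (sym s) at-σd of λ () })
        ok′ (λ { (here refl) → free-b ; (2nd refl) → free-d }) (λ { (here refl) → mono-b ; (2nd refl) → mono-d })

    -- With b and d cut open, the arcs through a and c count twice, so by parity the piece of trail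
    -- starting at e ends at f, p or q.
    fixed : Fixed σ b
    fixed = go (one-true {K b f} {K d p} {K d q} (trans (sym (parity-flat (K b a) (K b c) (K b f) (K d p) (K d q))) even))
      where
      e q f p : V
      e = r b a
      f = r² b e
      q = r d a
      p = r² d q
      open Ends (On X) σ ok (b , r b a)
      open RowNext (On X) σ ok (b , r b a)
      ba = —-sym ab
      be = r-nbr ba
      dq = r-nbr da
      c≡ = r²-sym (—-sym cd) at-d
      Ka : K b a ≡ K d a
      Ka = K-cong (rep-across (not ∘ On X) σ (cong not (on-out a∉X)) sa ba (—-sym da) d≡)
      Kc : K b c ≡ K d c
      Kc = K-cong (rep-across (not ∘ On X) σ (cong not (on-out c∉X)) sc bc cd at-c)
      Ke : K b e ≡ true
      Ke = fromWit (_ ≟D _) refl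
      row-b : row b ≡ K b a xor (true xor (K b c xor K b f))
      row-b = trans (row-next ba be (inj₁ refl)) (cong (K b a xor_) (cong₂ _xor_ Ke (cong (λ k → K b k xor K b f) (sym at-b))))
      row-d : row d ≡ K b a xor (K d q xor (K b c xor K d p))
      row-d = trans (row-next da dq (inj₁ refl)) (cong₂ _xor_ (sym Ka) (cong (K d q xor_) (cong (_xor K d p) (trans (cong (K d) (sym c≡)) (sym Kc)))))
      even : (K b a xor (true xor (K b c xor K b f))) xor ((K b a xor (K d q xor (K b c xor K d p))) xor false) ≡ false
      even = trans (sym (cong₂ _xor_ row-b (cong (_xor false) row-d))) (even-rows ((b≢d ∷ []) ∷ [] ∷ []) in-on)
      flip-next : ∀ {v x y} → v — x → v — y → Next v x y → Next v x (r² v y)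
      flip-next vx vy nx = Next-sym (Next-opposite vy vx (Next-sym nx))
      go : K b f ≡ true ⊎ K d p ≡ true ⊎ K d q ≡ true → Fixed σ b
      go (inj₁ h) = Turn.turned-fixed be dq (inj₁ refl) (inj₁ refl) (inj₁ (sym (K-true h)))
      go (inj₂ (inj₁ h)) = Turn.turned-fixed be dq (inj₁ refl) (inj₁ refl) (inj₂ (inj₁ (sym (K-true h))))
      -- With e linked to q the turn used above would close the trail through a without reaching c.
      -- The other turn at b exchanges e and f, which gives the third link.
      go (inj₂ (inj₂ h)) = Turn.turned-fixed (r²-nbr be) dq (flip-next ba be (inj₁ refl)) (inj₁ refl)
        (inj₂ (inj₂ (trans (cong (λ k → rep (not ∘ On X) σ (b , k)) (r⁴ be)) (sym (K-true h)))))

  module Corners {σ : State} (pt : Partial σ) {a b c d : V} (ρ : Ring a b c d)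
    (sa : σ a ≡ nothing) (sb : σ b ≡ nothing) (sc : σ c ≡ nothing) (sd : σ d ≡ nothing)
    {g : V} (g∉ : ¬ Ring.On-ring ρ g) (ag : a — g) (bg : b — g) (cg : c — g) (dg : d — g)
    {σ′ : State} (sa′ : σ′ a ≡ nothing) (sc′ : σ′ c ≡ nothing) (same : ∀ {v} → ¬ Ring.On-ring ρ v → v ≢ g → σ′ v ≡ σ v)
    (tb : τ σ′ b g ≡ a) (tg : τ σ′ g b ≡ c) (td : τ σ′ d a ≢ g) where

    open Ring ρ
    open AtRing pt ρ sa sb sc sd using (use₂)

    private
      τa : τ σ′ a b ≡ d
      τa = trans (τ-straight {σ′} sa′ b) (sym (r²-sym (—-sym da) at-a))

    -- From the corner the trail runs on from a to d and from g to c; c is not adjacent to a, and by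
    -- `td` d does not lead back to g.
    inner : ¬ Blocked σ′ b a g
    inner (b₃ _ (inj₁ h)) = —-≢ dg (trans (sym τa) h)
    inner (b₃ _ (inj₂ h)) = a≢c (trans (sym h) tg)
    inner (b-uy m _ _ _ h k) = td (trans (cong (λ v → τ σ′ v a) (trans (sym τa) h)) k)
    inner (b-yw m am _ _ h _) = no-ac (subst (a —_) (trans (sym h) tg) am)
    inner (b-uw m am _ _ _ h) = no-ac (subst (a —_) (trans (sym h) tg) am)

    -- At b the trail goes to a, which is not adjacent to c. At c it goes straight to some m; if m
    -- led back to b, it would be a turned vertex of the face b, m, c that sends the trail from the
    -- ring to the ring, against `use₂`.
    at-hub : ¬ Blocked σ′ g b c
    at-hub (b₃ _ (inj₁ h)) = a≢c (trans (sym tb) h)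
    at-hub (b₃ _ (inj₂ h)) = Next-¬opp cg (—-sym bc) (triangle-next (—-sym cg) (—-sym bc) bg) (trans (sym h) (τ-straight {σ′} sc′ g))
    at-hub (b-uy m _ mc _ h _) = no-ac (subst (_— c) (trans (sym h) tb) mc)
    at-hub (b-uw m _ mc _ h _) = no-ac (subst (_— c) (trans (sym h) tb) mc)
    at-hub (b-yw m bm mc m≢g _ k) = proj₂ (use₂ m-turned mc (3rd refl)) (2nd τm)
      where
      m∉ : ¬ On-ring m
      m∉ (here refl) = no-ac mc
      m∉ (2nd refl) = —-≢ bm refl
      m∉ (3rd refl) = —-≢ mc refl
      m∉ (4th refl) = no-bd bm
      τm : τ σ m c ≡ b
      τm = trans (cong (λ s → pair m s c) (sym (same m∉ m≢g))) k
      m-turned : σ m ≢ nothing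
      m-turned s = Next-¬opp mc (—-sym bm) (triangle-next (—-sym mc) (—-sym bm) bc) (trans (sym τm) (τ-straight {σ} s c))

    -- Were `r² b g` adjacent to d, it would be a second hub; so `ring-corner` applies to the
    -- reversed ring.
    outer : ¬ Blocked σ′ b c (r² b g)
    outer = AtRing.ring-corner pt (reverse ρ) sc sb sa sd {σ′} sc′ bo (o∉ ∘ reverse-on)
      (λ od → r²≢ bg (one-hub ρ o∉ g∉ bo (—-sym od) bg dg)) (same o∉ (r²≢ bg))
      λ m∉ mo → same (m∉ ∘ reverse-on) λ { refl → o∉ (hub-nbrs ρ ag bg cg dg mo) }
      where
      bo = r²-nbr bg
      opposite∉ : ∀ {k} → b — k → Next b k g → r² b g ≢ k
      opposite∉ bk nx h = Next-¬opp bg bk (Next-sym nx) (sym h)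
      o∉ : ¬ On-ring (r² b g)
      o∉ (here e) = opposite∉ (—-sym ab) (triangle-next ab bg (—-sym ag)) e
      o∉ (2nd e) = —-≢ bo (sym e)
      o∉ (3rd e) = opposite∉ bc (triangle-next (—-sym bc) bg (—-sym cg)) e
      o∉ (4th e) = no-bd (subst (b —_) e bo)

  module Hubbed {σ : State} (pt : Partial σ) {a b c d : V} (ρ : Ring a b c d)
    (sa : σ a ≡ nothing) (sb : σ b ≡ nothing) (sc : σ c ≡ nothing) (sd : σ d ≡ nothing)
    {g : V} (g∉ : ¬ Ring.On-ring ρ g) (ag : a — g) (bg : b — g) (cg : c — g) (dg : d — g) where

    open Partial pt
    open Ring ρ

    X : List V
    X = b ∷ d ∷ g ∷ []

    infix 4 _≃_
    _≃_ : D → D → Set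
    d ≃ e = rep (not ∘ On X) σ d ≡ rep (not ∘ On X) σ e

    a∉X : ¬ a ∈ X
    a∉X (here refl) = —-≢ ab refl
    a∉X (2nd refl) = —-≢ da refl
    a∉X (3rd refl) = —-≢ ag refl

    c∉X : ¬ c ∈ X
    c∉X (here refl) = —-≢ bc refl
    c∉X (2nd refl) = —-≢ cd refl
    c∉X (3rd refl) = —-≢ cg refl

    ba = —-sym ab
    dc = —-sym cd
    gb = —-sym bg

    d≡ : d ≡ r² a b
    d≡ = r²-sym (—-sym da) at-a
    nb : Next b a g
    nb = triangle-next ab bg (—-sym ag)
    nd : Next d c g
    nd = triangle-next cd dg (—-sym cg)
    ng : Next g b c
    ng = triangle-next bg (—-sym cg) (—-sym bc)
    a≡ : a ≡ r² g c
    a≡ = Next-Next (—-sym cg) gb (—-sym ag) (Next-sym ng) (triangle-next bg (—-sym ag) ab) (a≢c ∘ sym)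
    g-opp : d ≡ r² g b
    g-opp = Next-Next gb (—-sym cg) (—-sym dg) ng (triangle-next cg (—-sym dg) dc) b≢d

    -- Either turn at b pairs g with a or c. If g stayed straight, both of these and g would lead on
    -- from b to d and close a four-cycle; therefore the hub is turned as well.
    module Turn (link : (b , r² b g) ≃ (d , r² d g) ⊎ (b , r² b g) ≃ (g , c)) where

      σ₁ σ₂ σ′ : State
      σ₁ = σ [ b ≔ base nb ]
      σ₂ = σ₁ [ d ≔ base nd ]
      σ′ = σ₂ [ g ≔ base ng ]

      at-σb : σ′ b ≡ just (base nb)
      at-σb = trans (≔-other {σ₂} {g} {base ng} (—-≢ bg)) (trans (≔-other {σ₁} {d} {base nd} b≢d) (≔-at {σ} {b} {base nb}))
      at-σd : σ′ d ≡ just (base nd)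
      at-σd = trans (≔-other {σ₂} {g} {base ng} (—-≢ dg)) (≔-at {σ₁} {d} {base nd})
      at-σg : σ′ g ≡ just (base ng)
      at-σg = ≔-at {σ₂} {g} {base ng}

      agree : ∀ {v} → ¬ v ∈ X → σ′ v ≡ σ v
      agree h = trans (≔-other {σ₂} {g} {base ng} λ e → h (3rd e))
        (trans (≔-other {σ₁} {d} {base nd} λ e → h (2nd e)) (≔-other {σ} {b} {base nb} λ e → h (here e)))

      module Pb = Paired {σ′} ba bg nb at-σb
      module Pd = Paired {σ′} dc dg nd at-σd
      module Pg = Paired {σ′} gb (—-sym cg) ng at-σg

      ok′ : Valid σ′
      ok′ = ≔-valid {σ₂} {g} {base ng} (≔-valid {σ₁} {d} {base nd} (≔-valid {σ} {b} {base nb} ok (base-nbr ba bg nb)) (base-nbr dc dg nd)) (base-nbr gb (—-sym cg) ng)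

      sa′ = trans (agree a∉X) sa
      sc′ = trans (agree c∉X) sc

      same : ∀ {v} → ¬ On-ring v → v ≢ g → σ′ v ≡ σ v
      same v∉ v≢g = agree λ { (here e) → v∉ (2nd e) ; (2nd e) → v∉ (4th e) ; (3rd e) → v≢g e }

      τbc : τ σ′ b c ≡ r² b g
      τbc = trans (cong (τ σ′ b) at-b) Pb.τp′
      τda : τ σ′ d a ≡ r² d g
      τda = trans (cong (τ σ′ d) at-d) Pd.τp′
      τgd : τ σ′ g d ≡ a
      τgd = trans (cong (τ σ′ g) g-opp) (trans Pg.τp′ (sym a≡))

      module C₁ = Corners pt ρ sa sb sc sd g∉ ag bg cg dg {σ′} sa′ sc′ same Pb.τq Pg.τp (λ h → r²≢ dg (trans (sym τda) h))
      module C₂ = Corners pt (rotate (rotate ρ)) sc sd sa sb (g∉ ∘ rotate-on ∘ rotate-on) cg dg ag bg {σ′} sc′ sa′ (λ v∉ → same (v∉ ∘ rotate-on ∘ rotate-on)) Pd.τq τgd (λ h → r²≢ bg (trans (sym τbc) h))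

      free-b : Unblocked σ′ b
      free-b = Pb.paired-unblocked C₁.inner (subst (λ k → ¬ Blocked σ′ b k (r² b g)) at-b C₁.outer)

      free-d : Unblocked σ′ d
      free-d = Pd.paired-unblocked C₂.inner (subst (λ k → ¬ Blocked σ′ d k (r² d g)) at-d C₂.outer)

      free-g : Unblocked σ′ g
      free-g = Pg.paired-unblocked C₁.at-hub (subst (¬_ ∘ Blocked σ′ g (r² g b)) a≡ (subst (λ k → ¬ Blocked σ′ g k a) g-opp C₂.at-hub))

      infix 4 _≈_
      _≈_ : D → D → Set
      d ≈ e = σ′ ⊢ d ≈ e

      via : ∀ {v u w} → v — u → τ σ′ v u ≡ w → (v , u) ≈ (v , w)
      via vu refl = rep-link every σ′ refl vu

      flips : ∀ {u v} → u — v → (u , v) ≈ (v , u)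
      flips = rep-flip every σ′

      ba≈da : (b , a) ≈ (d , a)
      ba≈da = rep-across every σ′ refl sa′ ba (—-sym da) d≡
      bc≈dc : (b , c) ≈ (d , c)
      bc≈dc = rep-across every σ′ refl sc′ bc cd at-c
      dc≈gd : (d , c) ≈ (g , d)
      dc≈gd = trans (via dc Pd.τp) (flips dg)
      ba≈gb : (b , a) ≈ (g , b)
      ba≈gb = trans (via ba Pb.τp) (flips bg)
      gb≈gc : (g , b) ≈ (g , c)
      gb≈gc = via gb Pg.τp

      lift : ∀ {d e} → d ≃ e → d ≈ e
      lift = partial (On X) σ σ′ (λ g → agree (out-on g))

      bc≈ba : (b , c) ≈ (b , a)
      bc≈ba = trans (via bc τbc) (case link of λ where
        (inj₁ h) → trans (lift h) (trans (sym (via da τda)) (sym ba≈da))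
        (inj₂ h) → trans (lift h) (sym (trans ba≈gb gb≈gc)))

      mono-b : Mono σ′ b
      mono-b = Pb.paired-mono (subst (λ k → (b , a) ≈ (b , k)) at-b (sym bc≈ba))

      mono-d : Mono σ′ d
      mono-d = Pd.paired-mono (subst (λ k → (d , c) ≈ (d , k)) at-d (trans (sym bc≈dc) (trans bc≈ba ba≈da)))

      mono-g : Mono σ′ g
      mono-g = Pg.paired-mono (subst (λ k → (g , b) ≈ (g , k)) g-opp (trans (sym ba≈gb) (trans (sym bc≈ba) (trans bc≈dc dc≈gd))))

      turned-fixed : Fixed σ b
      turned-fixed = Finish.fixed pt ρ sa sb sc sd X {σ′} agree
        (λ { (here e) → inj₁ e ; (2nd e) → inj₂ (inj₁ e) ; (3rd refl) → inj₂ (inj₂ (g∉ , ag , bg , cg , dg)) }) (here refl) (2nd refl)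
        (λ { (here refl) s → case trans (sym s) at-σb of λ () ; (2nd refl) s → case trans (sym s) at-σd of λ () ; (3rd refl) s → case trans (sym s) at-σg of λ () })
        ok′ (λ { (here refl) → free-b ; (2nd refl) → free-d ; (3rd refl) → free-g })
        (λ { (here refl) → mono-b ; (2nd refl) → mono-d ; (3rd refl) → mono-g })

    -- With b, d and g cut open, the ring arcs and the edges bg and dg count twice. Four ends
    -- remain, so the piece starting at the outer end at b finishes at one of the other three.
    linked : (b , r² b g) ≃ (d , r² d g) ⊎ (b , r² b g) ≃ (g , c) ⊎ (b , r² b g) ≃ (g , a)
    linked = go (one-true {K d (r² d g)} {K g c} {K g a} (trans (sym (parity-hub (K b a) (K b c) (K b g) (K d g) (K d (r² d g)) (K g c) (K g a))) even))
      where
      open Ends (On X) σ ok (b , r² b g)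
      open RowNext (On X) σ ok (b , r² b g)
      flips : ∀ {u v} → u — v → (u , v) ≃ (v , u)
      flips = rep-flip (not ∘ On X) σ
      Ka : K b a ≡ K d a
      Ka = K-cong (rep-across (not ∘ On X) σ (cong not (on-out a∉X)) sa ba (—-sym da) d≡)
      Kc : K b c ≡ K d c
      Kc = K-cong (rep-across (not ∘ On X) σ (cong not (on-out c∉X)) sc bc cd at-c)
      row-b : row b ≡ K b a xor (K b g xor (K b c xor true))
      row-b = trans (row-next ba bg nb) (cong (λ z → K b a xor (K b g xor z)) (cong₂ _xor_ (cong (K b) (sym at-b)) (fromWit (_ ≟D _) refl)))
      row-d : row d ≡ K b c xor (K d g xor (K b a xor K d (r² d g)))
      row-d = trans (row-next dc dg nd) (cong₂ _xor_ (sym Kc) (cong (λ z → K d g xor (z xor K d (r² d g))) (trans (cong (K d) (sym at-d)) (sym Ka))))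
      row-g : row g ≡ K b g xor (K g c xor (K d g xor K g a))
      row-g = trans (row-next gb (—-sym cg) ng) (cong₂ _xor_ (K-cong (flips gb)) (cong (K g c xor_) (cong₂ _xor_ (trans (cong (K g) (sym g-opp)) (K-cong (flips (—-sym dg)))) (cong (K g) (sym a≡)))))
      even : (K b a xor (K b g xor (K b c xor true))) xor ((K b c xor (K d g xor (K b a xor K d (r² d g)))) xor ((K b g xor (K g c xor (K d g xor K g a))) xor false)) ≡ false
      even = trans (sym (cong₂ _xor_ row-b (cong₂ _xor_ row-d (cong (_xor false) row-g)))) (even-rows ((b≢d ∷ —-≢ bg ∷ []) ∷ (—-≢ dg ∷ []) ∷ [] ∷ []) in-on)
      go : K d (r² d g) ≡ true ⊎ K g c ≡ true ⊎ K g a ≡ true → _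
      go (inj₁ h) = inj₁ (sym (K-true h))
      go (inj₂ (inj₁ h)) = inj₂ (inj₁ (sym (K-true h)))
      go (inj₂ (inj₂ h)) = inj₂ (inj₂ (sym (K-true h)))

  fix-ring : ∀ {σ a b c d} → Partial σ → Ring a b c d → σ a ≡ nothing → σ b ≡ nothing → σ c ≡ nothing → σ d ≡ nothing → Fixed σ b
  fix-ring {σ} {a} {b} {c} {d} pt ρ sa sb sc sd = go (any? (λ e → ¬? (e ∈? (a ∷ b ∷ c ∷ d ∷ [])) ×-dec (adj? b e ×-dec adj? d e)))
    where
    hubbed : ∀ {g} → ¬ Ring.On-ring ρ g → a — g → b — g → c — g → d — g → Fixed σ b
    hubbed g∉ ag bg cg dg = case Hubbed.linked pt ρ sa sb sc sd g∉ ag bg cg dg of λ where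
      (inj₁ h) → Hubbed.Turn.turned-fixed pt ρ sa sb sc sd g∉ ag bg cg dg (inj₁ h)
      (inj₂ (inj₁ h)) → Hubbed.Turn.turned-fixed pt ρ sa sb sc sd g∉ ag bg cg dg (inj₂ h)
      -- Reading the ring in reverse exchanges a and c, which turns this link into the second one.
      (inj₂ (inj₂ h)) → Hubbed.Turn.turned-fixed pt (reverse ρ) sc sb sa sd (g∉ ∘ reverse-on) cg bg ag dg (inj₂ h)
    go : Dec (∃[ e ] (¬ Ring.On-ring ρ e × b — e × d — e)) → Fixed σ b
    go (no none) = Hubless.fixed pt ρ sa sb sc sd λ k∉ bk kd → none (_ , k∉ , bk , —-sym kd)
    go (yes (g , g∉ , bg , dg)) = let ag , cg = hub-all ρ g∉ bg dg in hubbed g∉ ag bg cg dg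

  -- Assembling the construction

  Straight-ring : State → V → V → V → V → Set
  Straight-ring σ a b c d = (a — b × b — c × c — d × d — a) × (a ≢ c × b ≢ d) × (b ≡ r² a d × c ≡ r² b a × d ≡ r² c b × a ≡ r² d c)
    × (σ a ≡ nothing × σ b ≡ nothing × σ c ≡ nothing × σ d ≡ nothing)

  straight-ring? : ∀ σ a b c d → Dec (Straight-ring σ a b c d)
  straight-ring? σ a b c d = (adj? a b ×-dec (adj? b c ×-dec (adj? c d ×-dec adj? d a))) ×-dec ((¬? (a ≟ c) ×-dec ¬? (b ≟ d))
    ×-dec (((b ≟ r² a d) ×-dec ((c ≟ r² b a) ×-dec ((d ≟ r² c b) ×-dec (a ≟ r² d c))))
    ×-dec (≡M-dec _≟_ (σ a) nothing ×-dec (≡M-dec _≟_ (σ b) nothing ×-dec (≡M-dec _≟_ (σ c) nothing ×-dec ≡M-dec _≟_ (σ d) nothing)))))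

  ringless-stable : ∀ {σ} → Partial σ → (∀ {a b c d} → ¬ Straight-ring σ a b c d) → Stable σ
  ringless-stable {σ} pt none = record { ok = ok ; mono = mono ; good = record { good₃ = good₃ ; good₄ = good₄ } }
    where
    open Partial pt
    good₄ : ∀ {a b c d} → ¬ Bad₄ σ a b c d
    good₄ bad = let sa , sb , sc , sd = rings bad
                    open Ring (bad-ring {σ} bad sa sb sc)
                in none ((ab , bc , cd , da) , (a≢c , b≢d) , (at-a , at-b , at-c , at-d) , sa , sb , sc , sd)

  -- A triangle is a face, so its edges are consecutive at each vertex and no straight passage
  -- follows two of them.
  all-straight : Partial (λ _ → nothing)
  all-straight = record
    { ok = λ () ; mono = contradiction refl ; rings = λ _ → refl , refl , refl , refl ; anchored = contradiction refl
    ; good₃ = λ ((ab , bc , ca) , e , _) → Next-¬opp (—-sym ca) ab (triangle-next ca ab bc) (sym e) }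

  turn-rings : ∀ k {σ} → count (straight? σ) ≤ k → Partial σ → ∃[ σ′ ] Stable σ′
  turn-rings k {σ} l pt with any? (λ a → any? (λ b → any? (λ c → any? (λ d → straight-ring? σ a b c d))))
  ... | no none = σ , ringless-stable pt λ h → none (_ , _ , _ , _ , h)
  ... | yes (a , b , c , d , (ab , bc , cd , da) , (a≢c , b≢d) , (at-a , at-b , at-c , at-d) , sa , sb , sc , sd) =
        let σ′ , pt′ , keep , tb = fix-ring pt ρ sa sb sc sd
        in next k (≤-trans (count-< {p = straight? σ′} {q = straight? σ} (λ i e → cong is-nothing (keep i (straight?-true {σ′} e))) b (straight?-false {σ′} tb) (cong is-nothing sb)) l) pt′
    where
    ρ : Ring a b c d
    ρ = record { ab = ab ; bc = bc ; cd = cd ; da = da ; a≢c = a≢c ; b≢d = b≢d ; at-a = at-a ; at-b = at-b ; at-c = at-c ; at-d = at-d }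
    next : ∀ k {σ′} → count (straight? σ′) < k → Partial σ′ → ∃[ σ″ ] Stable σ″
    next (suc k) (s≤s l′) = turn-rings k l′

  avoiding-circuit : Σ (Circuit G) (λ C → IsEulerian C × LocallySelfAvoiding 4 C)
  avoiding-circuit = conclude (proj₂ (turn-rings _ ≤-refl all-straight))

theorem3 : ∀ {n : ℕ} (G : Graph n) →
    ThreeConnected G → Quartic G → Planar G → ¬ Isomorphic G octahedron →
    Σ (Circuit G) (λ C → IsEulerian C × LocallySelfAvoiding 4 C)
theorem3 G 3-connected quartic (R , euler) not-octahedron = Construction.avoiding-circuit G R quartic 3-connected euler not-octahedron
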